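{- Let $G(q,w)=\sum_{P} q^{\mathrm{area}(P)} w^{d(P)}$, the sum over all simplex-duplex polyominoes $P$, where $d(P)$ is the number of duplex columns of $P$. Then $G(q,w)=\mathrm{NUM}/\mathrm{DEN}$, where, with the series $\tilde\alpha,\dots,\tilde\mu$ defined in the context, \begin{align*} \mathrm{NUM} ={}& (1-q)^4(\tilde{\alpha}+\tilde{\gamma}+2\tilde{\alpha}\tilde{\eta}-2\tilde{\gamma}\tilde{\epsilon})+q^2w(1-q)^2\big(\tilde{\iota}+\tilde{\lambda}-\tilde{\alpha}\tilde{\kappa}-\tilde{\alpha}\tilde{\mu}+\tilde{\beta}\tilde{\iota}+\tilde{\beta}\tilde{\lambda}-\tilde{\gamma}\tilde{\kappa}-\tilde{\gamma}\tilde{\mu}+\tilde{\delta}\tilde{\iota}+\tilde{\delta}\tilde{\lambda}-2\tilde{\epsilon}\tilde{\lambda}+2\tilde{\eta}\tilde{\iota}\\ &+2\tilde{\alpha}\tilde{\zeta}\tilde{\lambda}-2\tilde{\alpha}\tilde{\eta}\tilde{\kappa}-2\tilde{\alpha}\tilde{\eta}\tilde{\mu}+2\tilde{\alpha}\tilde{\theta}\tilde{\lambda}-2\tilde{\beta}\tilde{\epsilon}\tilde{\lambda}+2\tilde{\beta}\tilde{\eta}\tilde{\iota}+2\tilde{\gamma}\tilde{\epsilon}\tilde{\kappa}+2\tilde{\gamma}\tilde{\epsilon}\tilde{\mu}-2\tilde{\gamma}\tilde{\zeta}\tilde{\iota}-2\tilde{\gamma}\tilde{\theta}\tilde{\iota}-2\tilde{\delta}\tilde{\epsilon}\tilde{\lambda}+2\tilde{\delta}\tilde{\eta}\tilde{\iota}\big)\\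 &+2q^2w(1-q^2)(\tilde{\alpha}\tilde{\lambda}-\tilde{\gamma}\tilde{\iota}),\\ \mathrm{DEN} ={}& (1-q)^4(1-\tilde{\beta}+\tilde{\delta}-\tilde{\epsilon}+\tilde{\eta}-\tilde{\alpha}\tilde{\zeta}+\tilde{\alpha}\tilde{\theta}+\tilde{\beta}\tilde{\epsilon}-\tilde{\beta}\tilde{\eta}+\tilde{\gamma}\tilde{\zeta}-\tilde{\gamma}\tilde{\theta}-\tilde{\delta}\tilde{\epsilon}+\tilde{\delta}\tilde{\eta})-2(1-q)^3(\tilde{\gamma}+\tilde{\alpha}\tilde{\eta}-\tilde{\gamma}\tilde{\epsilon})\\ &-2q^2w(1-q)^2\big(\tilde{\kappa}-\tilde{\beta}\tilde{\mu}+\tilde{\delta}\tilde{\kappa}-\tilde{\epsilon}\tilde{\kappa}+\tilde{\zeta}\tilde{\iota}-\tilde{\zeta}\tilde{\lambda}+\tilde{\eta}\tilde{\kappa}-\tilde{\alpha}\tilde{\zeta}\tilde{\mu}+\tilde{\alpha}\tilde{\theta}\tilde{\kappa}+\tilde{\beta}\tilde{\epsilon}\tilde{\mu}-\tilde{\beta}\tilde{\eta}\tilde{\mu}-\tilde{\beta}\tilde{\theta}\tilde{\iota}+\tilde{\beta}\tilde{\theta}\tilde{\lambda}\\ &\quad+\tilde{\gamma}\tilde{\zeta}\tilde{\mu}-\tilde{\gamma}\tilde{\theta}\tilde{\kappa}-\tilde{\delta}\tilde{\epsilon}\tilde{\kappa}+\tilde{\delta}\tilde{\zeta}\tilde{\iota}-\tilde{\delta}\tilde{\zeta}\tilde{\lambda}+\tilde{\delta}\tilde{\eta}\tilde{\kappa}\big)\\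 &-4q^2w(1-q)\big(\tilde{\beta}\tilde{\lambda}-\tilde{\gamma}\tilde{\kappa}+\tilde{\alpha}\tilde{\zeta}\tilde{\lambda}-\tilde{\alpha}\tilde{\eta}\tilde{\kappa}-\tilde{\beta}\tilde{\epsilon}\tilde{\lambda}+\tilde{\beta}\tilde{\eta}\tilde{\iota}+\tilde{\gamma}\tilde{\epsilon}\tilde{\kappa}-\tilde{\gamma}\tilde{\zeta}\tilde{\iota}\big)\\ &-2q^3w(1-q)\big(\tilde{\iota}+\tilde{\alpha}\tilde{\kappa}-\tilde{\alpha}\tilde{\mu}-\tilde{\beta}\tilde{\iota}+\tilde{\delta}\tilde{\iota}-\tilde{\epsilon}\tilde{\lambda}+\tilde{\eta}\tilde{\iota}-\tilde{\alpha}\tilde{\zeta}\tilde{\lambda}+\tilde{\alpha}\tilde{\eta}\tilde{\kappa}-\tilde{\alpha}\tilde{\eta}\tilde{\mu}+\tilde{\alpha}\tilde{\theta}\tilde{\lambda}+\tilde{\beta}\tilde{\epsilon}\tilde{\lambda}-\tilde{\beta}\tilde{\eta}\tilde{\iota}\\ &\quad-\tilde{\gamma}\tilde{\epsilon}\tilde{\kappa}+\tilde{\gamma}\tilde{\epsilon}\tilde{\mu}+\tilde{\gamma}\tilde{\zeta}\tilde{\iota}-\tilde{\gamma}\tilde{\theta}\tilde{\iota}-\tilde{\delta}\tilde{\epsilon}\tilde{\lambda}+\tilde{\delta}\tilde{\eta}\tilde{\iota}\big)-4q^3w(\tilde{\alpha}\tilde{\lambda}-\tilde{\gamma}\tilde{\iota}).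 \end{align*}
   Context: A cell is a unit square in the plane whose vertices have integer coordinates. A polyomino is a union of finitely many cells whose interior is connected; polyominoes are counted up to translation. The columns of a polyomino are the blocks of the partition of its cells according to their horizontal projection (a column need not be connected). A column with one connected component is simplex, one with two components is duplex. A simplex-duplex polyomino is a polyomino all of whose columns are simplex or duplex and in which no two adjacent columns are both duplex. The area is the number of cells. For $i\ge1$ let $P_i=\prod_{k=1}^{i-1}(1-q^k)$, $\Sigma_i=\sum_{k=1}^{i-1}\frac{q^k}{1-q^k}$, $\Sigma'_i=\sum_{k=1}^{i-1}\frac{q^{2k}}{(1-q^k)^2}$. For $a\in\{1,2\}$ define $F_a(i)=\frac{(-3)^{i-1}q^{i^2+2i-2}w^{i-1}}{(1-q)^{2i-2}P_i^4(1-q^i)^a}$, $L_a(i)=2i-2+4\Sigma_i+\frac{a q^i}{1-q^i}$, $M_a(i)=-2i+2+4\Sigma'_i+\frac{a q^{2i}}{(1-q^i)^2}$. Define $H_3(i)=\frac{(-3)^{i-1}q^{i^2+4i}w^{i}}{(1-q)^{2i}P_i^4(1-q^i)^3}$, $H_4(i)=\frac{(-3)^{i}q^{i^2+4i}w^{i}}{(1-q)^{2i}P_i^4(1-q^i)^4}$, and for $b\in\{3,4\}$: $L'_b(i)=2i+4\Sigma_i+\frac{b q^i}{1-q^i}$, $M'_b(i)=-2i+4\Sigma'_i+\frac{b q^{2i}}{(1-q^i)^2}$. Then (all sums over $i\ge1$, as formal power series in $q,w$): $\tilde\alpha=\sum F_1(i)$, $\tilde\beta=\sum F_2(i)$, $\tilde\gamma=\sum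 H_3(i)$, $\tilde\delta=\sum H_4(i)$, $\tilde\epsilon=\sum F_1(i)L_1(i)$, $\tilde\zeta=\sum F_2(i)L_2(i)$, $\tilde\eta=\sum H_3(i)L'_3(i)$, $\tilde\theta=\sum H_4(i)L'_4(i)$, $\tilde\iota=\frac12\sum F_1(i)\big(L_1(i)^2+M_1(i)\big)$, $\tilde\kappa=\frac12\sum F_2(i)\big(L_2(i)^2+M_2(i)\big)$, $\tilde\lambda=\frac12\sum H_3(i)\big(L'_3(i)^2+M'_3(i)\big)$, $\tilde\mu=\frac12\sum H_4(i)\big(L'_4(i)^2+M'_4(i)\big)$. -}

module Defs where

open import Data.Nat as ℕ using (ℕ; zero; suc; _∸_; _≤_; _<_)
open import Data.Bool using (if_then_else_; _∧_)
open import Data.Integer using (+_)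
open import Data.Rational as ℚ using (ℚ; 0ℚ; 1ℚ; ½)
open import Data.Product using (Σ; _×_; _,_; proj₁; proj₂)
open import Data.Sum using (_⊎_)
open import Data.List using (List; length)
open import Data.List.Membership.Propositional using (_∈_)
open import Data.List.Relation.Unary.Any using (Any)
open import Data.List.Relation.Unary.Linked using (Linked)
open import Data.List.Relation.Unary.Unique.Propositional using (Unique)
open import Function.Bundles using (_⇔_)
open import Relation.Binary.PropositionalEquality using (_≡_)
open import Relation.Nullary using (¬_)

-- A cell is identified with its lower-left corner (x , y).
Cell : Set
Cell = ℕ × ℕ

Adjacent : Cell → Cell → Set
Adjacent (x , y) (x' , y') =
  (x ≡ x' × (suc y ≡ y' ⊎ suc y' ≡ y)) ⊎ (y ≡ y' × (suc x ≡ x' ⊎ suc x' ≡ x))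

_<ₗ_ : Cell → Cell → Set
(x , y) <ₗ (x' , y') = x < x' ⊎ (x ≡ x' × y < y')

data Path (S : List Cell) : Cell → Cell → Set where
  here : ∀ {c} → Path S c c
  step : ∀ {c d e} → Adjacent c d → d ∈ S → Path S d e → Path S c e

-- A polyomino up to translation is represented by its unique translate whose
-- minimal x-coordinate and minimal y-coordinate are 0 (so it lies in ℕ × ℕ),
-- the set of cells being given as a strictly lexicographically sorted list.
-- The interior of a union of cells is connected iff the cells are connected
-- through shared edges.
IsPolyomino : List Cell → Set
IsPolyomino S =
  Linked _<ₗ_ S
  × Any (λ c → proj₁ c ≡ 0) S
  × Any (λ c → proj₂ c ≡ 0) S
  × (∀ c d → c ∈ S → d ∈ S → Path S c d)

area : List Cell → ℕ
area S = length S

Simplex : List Cell → ℕ → Set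
Simplex S x = Σ ℕ λ a → Σ ℕ λ b → a ≤ b ×
  (∀ y → ((x , y) ∈ S) ⇔ (a ≤ y × y ≤ b))

Duplex : List Cell → ℕ → Set
Duplex S x = Σ ℕ λ a → Σ ℕ λ b → Σ ℕ λ c → Σ ℕ λ d →
  a ≤ b × suc b < c × c ≤ d ×
  (∀ y → ((x , y) ∈ S) ⇔ ((a ≤ y × y ≤ b) ⊎ (c ≤ y × y ≤ d)))

IsSimplexDuplex : List Cell → Set
IsSimplexDuplex S =
  IsPolyomino S
  × (∀ x → (Σ ℕ λ y → (x , y) ∈ S) → Simplex S x ⊎ Duplex S x)
  × (∀ x → ¬ (Duplex S x × Duplex S (suc x)))

DuplexCount : List Cell → ℕ → Set
DuplexCount S m = Σ (List ℕ) λ D →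
  Unique D × (∀ x → (x ∈ D) ⇔ Duplex S x) × length D ≡ m

-- f n m = coefficient of q^n w^m
FPS : Set
FPS = ℕ → ℕ → ℚ

sumUpTo : ℕ → (ℕ → ℚ) → ℚ
sumUpTo zero g = g zero
sumUpTo (suc n) g = sumUpTo n g ℚ.+ g (suc n)

nℚ : ℕ → ℚ
nℚ n = + n ℚ./ 1

infixl 6 _⊕_ _⊖_
infixl 7 _⊛_
infixr 8 _^ₛ_

_⊕_ : FPS → FPS → FPS
(f ⊕ g) n m = f n m ℚ.+ g n m

negₛ : FPS → FPS
negₛ f n m = ℚ.- f n m

_⊖_ : FPS → FPS → FPS
f ⊖ g = f ⊕ negₛ g

_⊛_ : FPS → FPS → FPS
(f ⊛ g) n m = sumUpTo n λ i → sumUpTo m λ j → f i j ℚ.* g (n ∸ i) (m ∸ j)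

cst : ℚ → FPS
cst c zero zero = c
cst c _ _ = 0ℚ

natₛ : ℕ → FPS
natₛ k = cst (nℚ k)

zeroₛ oneₛ : FPS
zeroₛ _ _ = 0ℚ
oneₛ = cst 1ℚ

mono : ℕ → ℕ → FPS
mono a b n m = if (n ℕ.≡ᵇ a) ∧ (m ℕ.≡ᵇ b) then 1ℚ else 0ℚ

q w : FPS
q = mono 1 0
w = mono 0 1

qp : ℕ → FPS
qp k = mono k 0

_^ₛ_ : FPS → ℕ → FPS
f ^ₛ zero = oneₛ
f ^ₛ suc k = f ⊛ (f ^ₛ k)

-- Multiplicative inverse of a series f with constant term 1:
-- 1/f = Σ_{k≥0} (1 - f)^k ; since 1 - f has no constant term,
-- (1-f)^k contributes nothing to q^n w^m once k > n + m.
inv : FPS → FPS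
inv f n m = sumUpTo (n ℕ.+ m) λ k → ((oneₛ ⊖ f) ^ₛ k) n m

sumₛ : ℕ → (ℕ → FPS) → FPS
sumₛ zero g = zeroₛ
sumₛ (suc N) g = sumₛ N g ⊕ g (suc N)

prodₛ : ℕ → (ℕ → FPS) → FPS
prodₛ zero g = oneₛ
prodₛ (suc N) g = prodₛ N g ⊛ g (suc N)

-- Infinite sum Σ_{i≥1} g i, for families where g i has q-adic order ≥ i
-- (true for all families used below): the coefficient of q^n w^m only
-- receives contributions from i ≤ n + 1.
sum≥1 : (ℕ → FPS) → FPS
sum≥1 g n m = sumUpTo n λ j → g (suc j) n m

Pᵢ : ℕ → FPS
Pᵢ i = prodₛ (i ∸ 1) λ k → oneₛ ⊖ qp k

Σᵢ : ℕ → FPS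
Σᵢ i = sumₛ (i ∸ 1) λ k → qp k ⊛ inv (oneₛ ⊖ qp k)

Σ'ᵢ : ℕ → FPS
Σ'ᵢ i = sumₛ (i ∸ 1) λ k → qp (2 ℕ.* k) ⊛ inv ((oneₛ ⊖ qp k) ^ₛ 2)

minus3 : FPS
minus3 = cst (ℚ.- nℚ 3)

Fₐ : ℕ → ℕ → FPS
Fₐ a i = (minus3 ^ₛ (i ∸ 1)) ⊛ mono (i ℕ.* i ℕ.+ 2 ℕ.* i ∸ 2) (i ∸ 1)
  ⊛ inv (((oneₛ ⊖ q) ^ₛ (2 ℕ.* i ∸ 2)) ⊛ (Pᵢ i ^ₛ 4) ⊛ ((oneₛ ⊖ qp i) ^ₛ a))

Lₐ : ℕ → ℕ → FPS
Lₐ a i = natₛ (2 ℕ.* i ∸ 2) ⊕ natₛ 4 ⊛ Σᵢ i ⊕ natₛ a ⊛ qp i ⊛ inv (oneₛ ⊖ qp i)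

Mₐ : ℕ → ℕ → FPS
Mₐ a i = negₛ (natₛ (2 ℕ.* i ∸ 2)) ⊕ natₛ 4 ⊛ Σ'ᵢ i
  ⊕ natₛ a ⊛ qp (2 ℕ.* i) ⊛ inv ((oneₛ ⊖ qp i) ^ₛ 2)

H₃ : ℕ → FPS
H₃ i = (minus3 ^ₛ (i ∸ 1)) ⊛ mono (i ℕ.* i ℕ.+ 4 ℕ.* i) i
  ⊛ inv (((oneₛ ⊖ q) ^ₛ (2 ℕ.* i)) ⊛ (Pᵢ i ^ₛ 4) ⊛ ((oneₛ ⊖ qp i) ^ₛ 3))

H₄ : ℕ → FPS
H₄ i = (minus3 ^ₛ i) ⊛ mono (i ℕ.* i ℕ.+ 4 ℕ.* i) i
  ⊛ inv (((oneₛ ⊖ q) ^ₛ (2 ℕ.* i)) ⊛ (Pᵢ i ^ₛ 4) ⊛ ((oneₛ ⊖ qp i) ^ₛ 4))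

L'ᵦ : ℕ → ℕ → FPS
L'ᵦ b i = natₛ (2 ℕ.* i) ⊕ natₛ 4 ⊛ Σᵢ i ⊕ natₛ b ⊛ qp i ⊛ inv (oneₛ ⊖ qp i)

M'ᵦ : ℕ → ℕ → FPS
M'ᵦ b i = negₛ (natₛ (2 ℕ.* i)) ⊕ natₛ 4 ⊛ Σ'ᵢ i
  ⊕ natₛ b ⊛ qp (2 ℕ.* i) ⊛ inv ((oneₛ ⊖ qp i) ^ₛ 2)

halfₛ : FPS
halfₛ = cst ½

α̃ β̃ γ̃ δ̃ ε̃ ζ̃ η̃ θ̃ ι̃ κ̃ λ̃ μ̃ : FPS
α̃ = sum≥1 (Fₐ 1)
β̃ = sum≥1 (Fₐ 2)
γ̃ = sum≥1 H₃
δ̃ = sum≥1 H₄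
ε̃ = sum≥1 λ i → Fₐ 1 i ⊛ Lₐ 1 i
ζ̃ = sum≥1 λ i → Fₐ 2 i ⊛ Lₐ 2 i
η̃ = sum≥1 λ i → H₃ i ⊛ L'ᵦ 3 i
θ̃ = sum≥1 λ i → H₄ i ⊛ L'ᵦ 4 i
ι̃ = halfₛ ⊛ sum≥1 λ i → Fₐ 1 i ⊛ (Lₐ 1 i ^ₛ 2 ⊕ Mₐ 1 i)
κ̃ = halfₛ ⊛ sum≥1 λ i → Fₐ 2 i ⊛ (Lₐ 2 i ^ₛ 2 ⊕ Mₐ 2 i)
λ̃ = halfₛ ⊛ sum≥1 λ i → H₃ i ⊛ (L'ᵦ 3 i ^ₛ 2 ⊕ M'ᵦ 3 i)
μ̃ = halfₛ ⊛ sum≥1 λ i → H₄ i ⊛ (L'ᵦ 4 i ^ₛ 2 ⊕ M'ᵦ 4 i)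

private
  two four : FPS
  two = natₛ 2
  four = natₛ 4
  1-q : FPS
  1-q = oneₛ ⊖ q

NUM : FPS
NUM =
  (1-q ^ₛ 4) ⊛ (α̃ ⊕ γ̃ ⊕ two ⊛ α̃ ⊛ η̃ ⊖ two ⊛ γ̃ ⊛ ε̃)
  ⊕ qp 2 ⊛ w ⊛ (1-q ^ₛ 2) ⊛
    ( ι̃ ⊕ λ̃ ⊖ α̃ ⊛ κ̃ ⊖ α̃ ⊛ μ̃ ⊕ β̃ ⊛ ι̃ ⊕ β̃ ⊛ λ̃ ⊖ γ̃ ⊛ κ̃ ⊖ γ̃ ⊛ μ̃
      ⊕ δ̃ ⊛ ι̃ ⊕ δ̃ ⊛ λ̃ ⊖ two ⊛ ε̃ ⊛ λ̃ ⊕ two ⊛ η̃ ⊛ ι̃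
      ⊕ two ⊛ α̃ ⊛ ζ̃ ⊛ λ̃ ⊖ two ⊛ α̃ ⊛ η̃ ⊛ κ̃ ⊖ two ⊛ α̃ ⊛ η̃ ⊛ μ̃
      ⊕ two ⊛ α̃ ⊛ θ̃ ⊛ λ̃ ⊖ two ⊛ β̃ ⊛ ε̃ ⊛ λ̃ ⊕ two ⊛ β̃ ⊛ η̃ ⊛ ι̃
      ⊕ two ⊛ γ̃ ⊛ ε̃ ⊛ κ̃ ⊕ two ⊛ γ̃ ⊛ ε̃ ⊛ μ̃ ⊖ two ⊛ γ̃ ⊛ ζ̃ ⊛ ι̃
      ⊖ two ⊛ γ̃ ⊛ θ̃ ⊛ ι̃ ⊖ two ⊛ δ̃ ⊛ ε̃ ⊛ λ̃ ⊕ two ⊛ δ̃ ⊛ η̃ ⊛ ι̃ )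
  ⊕ two ⊛ qp 2 ⊛ w ⊛ (oneₛ ⊖ qp 2) ⊛ (α̃ ⊛ λ̃ ⊖ γ̃ ⊛ ι̃)

DEN : FPS
DEN =
  (1-q ^ₛ 4) ⊛
    ( oneₛ ⊖ β̃ ⊕ δ̃ ⊖ ε̃ ⊕ η̃ ⊖ α̃ ⊛ ζ̃ ⊕ α̃ ⊛ θ̃ ⊕ β̃ ⊛ ε̃ ⊖ β̃ ⊛ η̃
      ⊕ γ̃ ⊛ ζ̃ ⊖ γ̃ ⊛ θ̃ ⊖ δ̃ ⊛ ε̃ ⊕ δ̃ ⊛ η̃ )
  ⊖ two ⊛ (1-q ^ₛ 3) ⊛ (γ̃ ⊕ α̃ ⊛ η̃ ⊖ γ̃ ⊛ ε̃)
  ⊖ two ⊛ qp 2 ⊛ w ⊛ (1-q ^ₛ 2) ⊛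
    ( κ̃ ⊖ β̃ ⊛ μ̃ ⊕ δ̃ ⊛ κ̃ ⊖ ε̃ ⊛ κ̃ ⊕ ζ̃ ⊛ ι̃ ⊖ ζ̃ ⊛ λ̃ ⊕ η̃ ⊛ κ̃
      ⊖ α̃ ⊛ ζ̃ ⊛ μ̃ ⊕ α̃ ⊛ θ̃ ⊛ κ̃ ⊕ β̃ ⊛ ε̃ ⊛ μ̃ ⊖ β̃ ⊛ η̃ ⊛ μ̃
      ⊖ β̃ ⊛ θ̃ ⊛ ι̃ ⊕ β̃ ⊛ θ̃ ⊛ λ̃
      ⊕ γ̃ ⊛ ζ̃ ⊛ μ̃ ⊖ γ̃ ⊛ θ̃ ⊛ κ̃ ⊖ δ̃ ⊛ ε̃ ⊛ κ̃ ⊕ δ̃ ⊛ ζ̃ ⊛ ι̃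
      ⊖ δ̃ ⊛ ζ̃ ⊛ λ̃ ⊕ δ̃ ⊛ η̃ ⊛ κ̃ )
  ⊖ four ⊛ qp 2 ⊛ w ⊛ 1-q ⊛
    ( β̃ ⊛ λ̃ ⊖ γ̃ ⊛ κ̃ ⊕ α̃ ⊛ ζ̃ ⊛ λ̃ ⊖ α̃ ⊛ η̃ ⊛ κ̃ ⊖ β̃ ⊛ ε̃ ⊛ λ̃
      ⊕ β̃ ⊛ η̃ ⊛ ι̃ ⊕ γ̃ ⊛ ε̃ ⊛ κ̃ ⊖ γ̃ ⊛ ζ̃ ⊛ ι̃ )
  ⊖ two ⊛ qp 3 ⊛ w ⊛ 1-q ⊛
    ( ι̃ ⊕ α̃ ⊛ κ̃ ⊖ α̃ ⊛ μ̃ ⊖ β̃ ⊛ ι̃ ⊕ δ̃ ⊛ ι̃ ⊖ ε̃ ⊛ λ̃ ⊕ η̃ ⊛ ι̃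
      ⊖ α̃ ⊛ ζ̃ ⊛ λ̃ ⊕ α̃ ⊛ η̃ ⊛ κ̃ ⊖ α̃ ⊛ η̃ ⊛ μ̃ ⊕ α̃ ⊛ θ̃ ⊛ λ̃
      ⊕ β̃ ⊛ ε̃ ⊛ λ̃ ⊖ β̃ ⊛ η̃ ⊛ ι̃
      ⊖ γ̃ ⊛ ε̃ ⊛ κ̃ ⊕ γ̃ ⊛ ε̃ ⊛ μ̃ ⊕ γ̃ ⊛ ζ̃ ⊛ ι̃ ⊖ γ̃ ⊛ θ̃ ⊛ ι̃
      ⊖ δ̃ ⊛ ε̃ ⊛ λ̃ ⊕ δ̃ ⊛ η̃ ⊛ ι̃ )
  ⊖ four ⊛ qp 3 ⊛ w ⊛ (α̃ ⊛ λ̃ ⊖ γ̃ ⊛ ι̃)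

-- NUM / DEN  (DEN has constant term 1, since every tilde-series is O(q))
NUM/DEN : FPS
NUM/DEN = NUM ⊛ inv DEN

{-# OPTIONS --safe #-}
module Submission where

-- A duplex column of a simplex-duplex polyomino has simplex neighbours, each of which meets at
-- least one of its two components, and one of them meets both. Hence the generating functions
-- f_m of the polyominoes whose first column is a simplex of m + 1 cells satisfy a linear recursion
-- f_m = q^{m+1} (c₀ + c₁ m + c₂ binom(m,2) - 3p Σ_k f_k Σ_{g≥1} (k-g)⁺ (m-g)⁺), p = q²w/(1-q)²,
-- where c₀, c₁, c₂ depend only on A = F(1), B = F'(1) and C = F''(1)/2 for F(s) = Σ f_m s^m, and
-- the sum over the gap sizes g makes up for the positions counted twice. Summing over m turns it
-- into an equation F(s) = R(s) - 3pq x²/(1-x)⁴ F(x), x = sq, whose iteration expresses F through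
-- the tilde series; the latter are the value, derivative and half second derivative at s = 1 of
-- four q-series, so that working modulo (s-1)³ gives all of them at once. The result is a linear
-- system for A, B, C, which is solved by Cramer's rule; the generating function wanted is A + pC.

open import Defs
open import Algebra using (CommutativeRing; AbelianGroup)
import Algebra.Construct.Pointwise as Pointwise
import Algebra.Solver.Ring as RingSolver
open import Algebra.Solver.Ring.AlmostCommutativeRing using (fromCommutativeRing; _-Raw-AlmostCommutative⟶_)
open import Algebra.Structures using (IsCommutativeRing)
open import Data.Bool using (true; false)
open import Data.Empty using (⊥; ⊥-elim)
open import Data.Integer as ℤ using (ℤ)
import Data.Integer.Properties as ℤ
open import Data.List using (List; []; _∷_; _++_; map; length; filter; upTo; applyUpTo)
import Data.List.Properties as List
open import Data.List.Membership.Propositional using (_∈_; lose; find)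
import Data.List.Membership.Propositional.Properties as ∈
open import Data.List.Relation.Unary.All as All using (All; []; _∷_)
import Data.List.Relation.Unary.All.Properties as All
open import Data.List.Relation.Unary.AllPairs using (AllPairs; []; _∷_)
import Data.List.Relation.Unary.AllPairs.Properties as AllPairs
open import Data.List.Relation.Unary.Any using (Any; here; there)
import Data.List.Relation.Unary.Linked.Properties as Linked
open import Data.List.Relation.Unary.Unique.Propositional using (Unique)
import Data.List.Relation.Unary.Unique.Propositional.Properties as Unique
open import Data.Maybe using (Maybe; just; nothing)
open import Data.Nat as ℕ using (ℕ; zero; suc; _+_; _*_; _∸_; _≤_; _<_; z≤n; s≤s)
import Data.Nat.Properties as ℕ
open import Data.Nat.Tactic.RingSolver using (solve-∀)
open import Data.Product using (Σ; ∃; _×_; _,_; proj₁; proj₂)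
open import Data.Rational as ℚ using (ℚ; 0ℚ; 1ℚ; ½)
import Data.Rational.Properties as ℚ
import Data.Rational.Unnormalised as ℚᵘ
import Data.Rational.Unnormalised.Properties as ℚᵘ
open import Data.Sum as Sum using (_⊎_; inj₁; inj₂; [_,_]′)
open import Data.Unit using (⊤; tt)
open import Function using (_∘_)
open import Function.Bundles using (_⇔_; mk⇔; Equivalence)
open import Level using (0ℓ)
open import Relation.Binary.PropositionalEquality as ≡ using (_≡_; cong; cong₂; subst)
import Relation.Binary.Reasoning.Setoid as SetoidReasoning
open import Relation.Nullary using (¬_; Dec; yes; no)
open import Relation.Nullary.Decidable using (¬?; _×-dec_)
open import Relation.Unary using (Decidable)

-- Positions are natural numbers, so a column near ordinate 0 would have fewer admissible positions
-- than one higher up. All counting is therefore done with the first column at a height at least the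
-- total area: each extension uses up no more height than area, a gap being paid for by the simplex
-- column that has to cover it. With that height equal to the area, lowering a sequence until it
-- rests on 0 is a bijection onto the polyominoes. Over all gaps, a simplex column of m + 1 cells
-- meets both components of a duplex column in binom(m,2) positions. This is also the coefficient of
-- (s-1)² in s^m, which is why A, B and C are all that enters the recursion besides the sum over
-- gaps. Summed over m against x^m, that sum becomes x² (k/(1-x)³ - (1-x^k)/(1-x)⁴), and its x^k is
-- what reproduces F at x = qs. Every iteration gains a factor q and so converges q-adically.
-- Working with jets at s = 1 avoids series in a third variable. In the unknowns A/(1-q), B,
-- pC/(1-q) the determinant of the system is exactly DEN, with no spurious factor.

IntegersInto : CommutativeRing 0ℓ 0ℓ → Set
IntegersInto R = ℤ.+-*-rawRing -Raw-AlmostCommutative⟶ fromCommutativeRing R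

-- The ring of bivariate power series and a solver for it

module IntegerSolver (R : CommutativeRing 0ℓ 0ℓ) (homo : IntegersInto R) where
  open _-Raw-AlmostCommutative⟶_ homo using (⟦_⟧)
  open CommutativeRing R using (_≈_; reflexive)

  private
    -- Equality of series is undecidable, so the solver normalises with integer coefficients, whose
    -- equality can be tested; like terms then cancel.
    _coeff≟_ : ∀ i j → Maybe (⟦ i ⟧ ≈ ⟦ j ⟧)
    i coeff≟ j with i ℤ.≟ j
    ... | yes i≡j = just (reflexive (cong ⟦_⟧ i≡j))
    ... | no _ = nothing

  open RingSolver ℤ.+-*-rawRing (fromCommutativeRing R) homo _coeff≟_ public
    using (Polynomial; solve; _:=_; _:+_; _:*_; _:-_; :-_; _:^_)
  open RingSolver ℤ.+-*-rawRing (fromCommutativeRing R) homo _coeff≟_ using (con)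

  lit : ∀ {n} → ℕ → Polynomial n
  lit k = con (ℤ.+ k)

-- Univariate power series over R; the recursive form of the Cauchy product
-- turns each ring law into a one-line induction on the degree.
module Cauchy (R : CommutativeRing 0ℓ 0ℓ) where
  open CommutativeRing R renaming (_+_ to _+ᴿ_; _*_ to _*ᴿ_; -_ to -ᴿ_)
  open SetoidReasoning setoid
  open import Algebra.Properties.CommutativeSemigroup
    (CommutativeRing.+-commutativeSemigroup R) using (interchange; x∙yz≈y∙xz)

  conv : (ℕ → Carrier) → (ℕ → Carrier) → ℕ → Carrier
  conv f g zero = f 0 *ᴿ g 0
  conv f g (suc n) = f 0 *ᴿ g (suc n) +ᴿ conv (f ∘ suc) g n

  unit : ℕ → Carrier
  unit zero = 1#
  unit (suc _) = 0#

  conv-cong : ∀ {f f′ g g′} → (∀ n → f n ≈ f′ n) → (∀ n → g n ≈ g′ n) →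
              ∀ n → conv f g n ≈ conv f′ g′ n
  conv-cong f≈ g≈ zero = *-cong (f≈ 0) (g≈ 0)
  conv-cong f≈ g≈ (suc n) = +-cong (*-cong (f≈ 0) (g≈ (suc n))) (conv-cong (f≈ ∘ suc) g≈ n)

  conv-distribʳ : ∀ h f g n → conv (λ i → f i +ᴿ g i) h n ≈ conv f h n +ᴿ conv g h n
  conv-distribʳ h f g zero = distribʳ _ _ _
  conv-distribʳ h f g (suc n) =
    trans (+-cong (distribʳ _ _ _) (conv-distribʳ h (f ∘ suc) (g ∘ suc) n)) (interchange _ _ _ _)

  conv-scaleˡ : ∀ c f g n → conv (λ i → c *ᴿ f i) g n ≈ c *ᴿ conv f g n
  conv-scaleˡ c f g zero = *-assoc _ _ _
  conv-scaleˡ c f g (suc n) =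
    trans (+-cong (*-assoc _ _ _) (conv-scaleˡ c (f ∘ suc) g n)) (sym (distribˡ _ _ _))

  conv-assoc : ∀ f g h n → conv (conv f g) h n ≈ conv f (conv g h) n
  conv-assoc f g h zero = *-assoc _ _ _
  conv-assoc f g h (suc n) = begin
    f 0 *ᴿ g 0 *ᴿ h (suc n) +ᴿ conv (conv f g ∘ suc) h n
      ≈⟨ +-cong (*-assoc _ _ _) (trans (conv-distribʳ h (λ i → f 0 *ᴿ g (suc i)) (conv (f ∘ suc) g) n)
           (+-cong (conv-scaleˡ (f 0) (g ∘ suc) h n) (conv-assoc (f ∘ suc) g h n))) ⟩
    f 0 *ᴿ (g 0 *ᴿ h (suc n)) +ᴿ (f 0 *ᴿ conv (g ∘ suc) h n +ᴿ conv (f ∘ suc) (conv g h) n)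
      ≈⟨ trans (sym (+-assoc _ _ _)) (+-congʳ (sym (distribˡ _ _ _))) ⟩
    f 0 *ᴿ conv g h (suc n) +ᴿ conv (f ∘ suc) (conv g h) n ∎

  conv-sucʳ : ∀ f g n → conv f g (suc n) ≈ g 0 *ᴿ f (suc n) +ᴿ conv f (g ∘ suc) n
  conv-sucʳ f g zero = trans (+-comm _ _) (+-congʳ (*-comm _ _))
  conv-sucʳ f g (suc n) = trans (+-congˡ (conv-sucʳ (f ∘ suc) g n)) (x∙yz≈y∙xz _ _ _)

  conv-comm : ∀ f g n → conv f g n ≈ conv g f n
  conv-comm f g zero = *-comm _ _
  conv-comm f g (suc n) = trans (+-congˡ (conv-comm (f ∘ suc) g n)) (sym (conv-sucʳ g f n))

  conv-zeroˡ : ∀ g n → conv (λ _ → 0#) g n ≈ 0#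
  conv-zeroˡ g zero = zeroˡ _
  conv-zeroˡ g (suc n) = trans (+-cong (zeroˡ _) (conv-zeroˡ g n)) (+-identityˡ _)

  conv-identityˡ : ∀ f n → conv unit f n ≈ f n
  conv-identityˡ f zero = *-identityˡ _
  conv-identityˡ f (suc n) = trans (+-cong (*-identityˡ _) (conv-zeroˡ f n)) (+-identityʳ _)

  seriesRing : CommutativeRing 0ℓ 0ℓ
  seriesRing = record
    { _*_ = conv ; 1# = unit
    ; isCommutativeRing = record
      { isRing = record
        { +-isAbelianGroup = AbelianGroup.isAbelianGroup (Pointwise.abelianGroup ℕ +-abelianGroup)
        ; *-cong = conv-cong
        ; *-assoc = conv-assoc
        ; *-identity = conv-identityˡ , λ f n → trans (conv-comm f unit n) (conv-identityˡ f n)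
        ; distrib =
            (λ f g h n → trans (conv-comm f (λ i → g i +ᴿ h i) n)
              (trans (conv-distribʳ f g h n) (+-cong (conv-comm g f n) (conv-comm h f n))))
          , conv-distribʳ }
      ; *-comm = conv-comm } }

fromℤ : ℤ → ℚ
fromℤ i = i ℚ./ 1

-- Division of integers reduces by a gcd, which is stuck on variables. Unnormalised fractions with
-- denominator 1 carry the homomorphism laws by plain integer arithmetic.
fromℤ-unnormalised : ∀ i → ℚ.toℚᵘ (fromℤ i) ℚᵘ.≃ ℚᵘ.mkℚᵘ i 0
fromℤ-unnormalised i = ℚ.toℚᵘ-fromℚᵘ (ℚᵘ.mkℚᵘ i 0)

fromℤ-+ : ∀ i j → fromℤ (i ℤ.+ j) ≡ fromℤ i ℚ.+ fromℤ j
fromℤ-+ i j = ℚ.toℚᵘ-injective (begin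
  ℚ.toℚᵘ (fromℤ (i ℤ.+ j)) ≈⟨ fromℤ-unnormalised (i ℤ.+ j) ⟩
  ℚᵘ.mkℚᵘ (i ℤ.+ j) 0 ≈⟨ ℚᵘ.*≡* (cong (ℤ._* ℤ.+ 1) (cong₂ ℤ._+_ (≡.sym (ℤ.*-identityʳ i)) (≡.sym (ℤ.*-identityʳ j)))) ⟩
  ℚᵘ.mkℚᵘ i 0 ℚᵘ.+ ℚᵘ.mkℚᵘ j 0 ≈⟨ ℚᵘ.+-cong (fromℤ-unnormalised i) (fromℤ-unnormalised j) ⟨
  ℚ.toℚᵘ (fromℤ i) ℚᵘ.+ ℚ.toℚᵘ (fromℤ j) ≈⟨ ℚ.toℚᵘ-homo-+ (fromℤ i) (fromℤ j) ⟨
  ℚ.toℚᵘ (fromℤ i ℚ.+ fromℤ j) ∎)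
  where open SetoidReasoning ℚᵘ.≃-setoid

fromℤ-* : ∀ i j → fromℤ (i ℤ.* j) ≡ fromℤ i ℚ.* fromℤ j
fromℤ-* i j = ℚ.toℚᵘ-injective (begin
  ℚ.toℚᵘ (fromℤ (i ℤ.* j)) ≈⟨ fromℤ-unnormalised (i ℤ.* j) ⟩
  ℚᵘ.mkℚᵘ i 0 ℚᵘ.* ℚᵘ.mkℚᵘ j 0 ≈⟨ ℚᵘ.*-cong (fromℤ-unnormalised i) (fromℤ-unnormalised j) ⟨
  ℚ.toℚᵘ (fromℤ i) ℚᵘ.* ℚ.toℚᵘ (fromℤ j) ≈⟨ ℚ.toℚᵘ-homo-* (fromℤ i) (fromℤ j) ⟨
  ℚ.toℚᵘ (fromℤ i ℚ.* fromℤ j) ∎)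
  where open SetoidReasoning ℚᵘ.≃-setoid

fromℤ-neg : ∀ i → fromℤ (ℤ.- i) ≡ ℚ.- fromℤ i
fromℤ-neg i = ℚ.toℚᵘ-injective (begin
  ℚ.toℚᵘ (fromℤ (ℤ.- i)) ≈⟨ fromℤ-unnormalised (ℤ.- i) ⟩
  ℚᵘ.- ℚᵘ.mkℚᵘ i 0 ≈⟨ ℚᵘ.-‿cong (fromℤ-unnormalised i) ⟨
  ℚᵘ.- ℚ.toℚᵘ (fromℤ i) ≈⟨ ℚ.toℚᵘ-homo‿- (fromℤ i) ⟨
  ℚ.toℚᵘ (ℚ.- fromℤ i) ∎)
  where open SetoidReasoning ℚᵘ.≃-setoid

-- A series in q and w is a series in q whose coefficients are series in w: the univariate
-- construction is applied twice.
module ℚ[[w]] = Cauchy ℚ.+-*-commutativeRing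
module ℚ[[w]][[q]] = Cauchy ℚ[[w]].seriesRing
module ℚ[[q,w]] = CommutativeRing ℚ[[w]][[q]].seriesRing

sumUpTo-cong : ∀ n {f g : ℕ → ℚ} → (∀ i → i ≤ n → f i ≡ g i) → sumUpTo n f ≡ sumUpTo n g
sumUpTo-cong zero f≡g = f≡g 0 z≤n
sumUpTo-cong (suc n) f≡g =
  cong₂ ℚ._+_ (sumUpTo-cong n (λ i i≤n → f≡g i (ℕ.m≤n⇒m≤1+n i≤n))) (f≡g (suc n) ℕ.≤-refl)

sumUpTo-head : ∀ n (f : ℕ → ℚ) → sumUpTo (suc n) f ≡ f 0 ℚ.+ sumUpTo n (f ∘ suc)
sumUpTo-head zero f = ≡.refl
sumUpTo-head (suc n) f =
  ≡.trans (cong (ℚ._+ f (suc (suc n))) (sumUpTo-head n f))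
    (ℚ.+-assoc (f 0) (sumUpTo n (f ∘ suc)) (f (suc (suc n))))

-- Wrapping the pointwise equality in a record keeps the two series inferable from it.
infix 4 _≈_
record _≈_ (f g : FPS) : Set where
  constructor pointwise
  field at : ∀ n m → f n m ≡ g n m
open _≈_ public

-- The bridge over which the ring laws of the nested convolution pass to the product used in the
-- statement.
⊛-conv : ∀ f g n m → (f ⊛ g) n m ≡ ℚ[[w]][[q]].conv f g n m
⊛-conv f g n m = ≡.trans (sumUpTo-cong n (λ i _ → inner m (f i) (g (n ∸ i)))) (outer n f)
  where
  inner : ∀ m (a b : ℕ → ℚ) → sumUpTo m (λ j → a j ℚ.* b (m ∸ j)) ≡ ℚ[[w]].conv a b m
  inner zero a b = ≡.refl
  inner (suc m) a b = ≡.trans (sumUpTo-head m _) (cong (a 0 ℚ.* b (suc m) ℚ.+_) (inner m (a ∘ suc) b))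
  outer : ∀ n f → sumUpTo n (λ i → ℚ[[w]].conv (f i) (g (n ∸ i)) m) ≡ ℚ[[w]][[q]].conv f g n m
  outer zero f = ≡.refl
  outer (suc n) f = ≡.trans (sumUpTo-head n _)
    (cong (ℚ[[w]].conv (f 0) (g (suc n)) m ℚ.+_) (outer n (f ∘ suc)))

oneₛ-unit : ∀ n m → oneₛ n m ≡ ℚ[[w]][[q]].unit n m
oneₛ-unit zero zero = ≡.refl
oneₛ-unit zero (suc m) = ≡.refl
oneₛ-unit (suc n) m = ≡.refl

private
  conv₂ : FPS → FPS → FPS
  conv₂ = ℚ[[w]][[q]].conv

  ≈-conv : ∀ {f g f′ g′} → (∀ n m → conv₂ f g n m ≡ conv₂ f′ g′ n m) → f ⊛ g ≈ f′ ⊛ g′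
  ≈-conv {f} {g} {f′} {g′} eq = pointwise λ n m →
    ≡.trans (⊛-conv f g n m) (≡.trans (eq n m) (≡.sym (⊛-conv f′ g′ n m)))

  ⊛-congᵖ : ∀ {f f′ g g′} → f ≈ f′ → g ≈ g′ → f ⊛ g ≈ f′ ⊛ g′
  ⊛-congᵖ f≈ g≈ = ≈-conv (ℚ[[q,w]].*-cong (at f≈) (at g≈))

  ⊛-commᵖ : ∀ f g → f ⊛ g ≈ g ⊛ f
  ⊛-commᵖ f g = ≈-conv (ℚ[[q,w]].*-comm f g)

  ⊛-assocᵖ : ∀ f g h → (f ⊛ g) ⊛ h ≈ f ⊛ (g ⊛ h)
  ⊛-assocᵖ f g h = ≈-conv (λ n m →
    ≡.trans (ℚ[[q,w]].*-cong (⊛-conv f g) (λ _ _ → ≡.refl {x = h _ _}) n m)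
      (≡.trans (ℚ[[q,w]].*-assoc f g h n m)
        (ℚ[[q,w]].*-cong (λ _ _ → ≡.refl {x = f _ _}) (λ n m → ≡.sym (⊛-conv g h n m)) n m)))

  ⊛-identityˡᵖ : ∀ f → oneₛ ⊛ f ≈ f
  ⊛-identityˡᵖ f = pointwise λ n m → ≡.trans (⊛-conv oneₛ f n m)
    (≡.trans (ℚ[[q,w]].*-cong oneₛ-unit (λ _ _ → ≡.refl {x = f _ _}) n m)
      (ℚ[[q,w]].*-identityˡ f n m))

  ⊛-distribʳᵖ : ∀ h f g → (f ⊕ g) ⊛ h ≈ f ⊛ h ⊕ g ⊛ h
  ⊛-distribʳᵖ h f g = pointwise λ n m → ≡.trans (⊛-conv (f ⊕ g) h n m)
    (≡.trans (ℚ[[q,w]].distribʳ h f g n m)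
      (≡.sym (cong₂ ℚ._+_ (⊛-conv f h n m) (⊛-conv g h n m))))

  ≈-transᵖ : ∀ {f g h} → f ≈ g → g ≈ h → f ≈ h
  ≈-transᵖ f≈g g≈h = pointwise λ n m → ≡.trans (at f≈g n m) (at g≈h n m)

  ⊕-congᵖ : ∀ {f f′ g g′} → f ≈ f′ → g ≈ g′ → f ⊕ g ≈ f′ ⊕ g′
  ⊕-congᵖ f≈ g≈ = pointwise λ n m → cong₂ ℚ._+_ (at f≈ n m) (at g≈ n m)

FPSRing : CommutativeRing 0ℓ 0ℓ
FPSRing = record
  { _≈_ = _≈_ ; _+_ = _⊕_ ; _*_ = _⊛_ ; -_ = negₛ ; 0# = zeroₛ ; 1# = oneₛ
  ; isCommutativeRing = record
    { isRing = record
      { +-isAbelianGroup = record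
        { isGroup = record
          { isMonoid = record
            { isSemigroup = record
              { isMagma = record
                { isEquivalence = record
                  { refl = pointwise λ _ _ → ≡.refl
                  ; sym = λ f≈g → pointwise λ n m → ≡.sym (at f≈g n m)
                  ; trans = ≈-transᵖ }
                ; ∙-cong = ⊕-congᵖ }
              ; assoc = λ f g h → pointwise λ n m → ℚ.+-assoc (f n m) (g n m) (h n m) }
            ; identity = (λ f → pointwise λ n m → ℚ.+-identityˡ (f n m))
                       , (λ f → pointwise λ n m → ℚ.+-identityʳ (f n m)) }
          ; inverse = (λ f → pointwise λ n m → ℚ.+-inverseˡ (f n m))
                    , (λ f → pointwise λ n m → ℚ.+-inverseʳ (f n m))
          ; ⁻¹-cong = λ f≈g → pointwise λ n m → cong ℚ.-_ (at f≈g n m) }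
        ; comm = λ f g → pointwise λ n m → ℚ.+-comm (f n m) (g n m) }
      ; *-cong = ⊛-congᵖ
      ; *-assoc = ⊛-assocᵖ
      ; *-identity = ⊛-identityˡᵖ , λ f → ≈-transᵖ (⊛-commᵖ f oneₛ) (⊛-identityˡᵖ f)
      ; distrib = (λ f g h → ≈-transᵖ (⊛-commᵖ f (g ⊕ h))
                    (≈-transᵖ (⊛-distribʳᵖ f g h) (⊕-congᵖ (⊛-commᵖ g f) (⊛-commᵖ h f))))
                , ⊛-distribʳᵖ }
    ; *-comm = ⊛-commᵖ } }

-- Opaque copies of the operations: a transparent product of functions can never be
-- inverted by unification, an opaque one always can.
infixl 6 _⊞_
infixl 7 _⊡_
infix 8 ⊟_
infixr 9 _↑_
opaque
  _⊞_ _⊡_ : FPS → FPS → FPS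
  _⊞_ = _⊕_
  _⊡_ = _⊛_
  ⊟_ : FPS → FPS
  ⊟_ = negₛ
  𝟘 𝟙 : FPS
  𝟘 = zeroₛ
  𝟙 = oneₛ
  const : ℚ → FPS
  const = cst
  _⁻¹ : FPS → FPS
  _⁻¹ = inv
  isCommutativeRing : IsCommutativeRing _≈_ _⊞_ _⊡_ ⊟_ 𝟘 𝟙
  isCommutativeRing = CommutativeRing.isCommutativeRing FPSRing

_↑_ : FPS → ℕ → FPS
f ↑ zero = 𝟙
f ↑ suc k = f ⊡ f ↑ k

SeriesRing : CommutativeRing 0ℓ 0ℓ
SeriesRing = record { isCommutativeRing = isCommutativeRing }

open CommutativeRing SeriesRing public
  using (refl; sym; trans; reflexive; setoid; zeroˡ; zeroʳ)
  renaming (+-cong to ⊞-cong; +-congˡ to ⊞-congˡ; +-congʳ to ⊞-congʳ; +-assoc to ⊞-assoc; +-comm to ⊞-comm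
    ; +-identityˡ to ⊞-identityˡ; +-identityʳ to ⊞-identityʳ
    ; *-cong to ⊡-cong; *-congˡ to ⊡-congˡ; *-congʳ to ⊡-congʳ; *-assoc to ⊡-assoc; *-comm to ⊡-comm
    ; *-identityˡ to ⊡-identityˡ; *-identityʳ to ⊡-identityʳ; -‿cong to ⊟-cong
    ; distribˡ to ⊡-distribˡ; distribʳ to ⊡-distribʳ)

opaque
  unfolding _⊞_
  const-cong : ∀ {a b} → a ≡ b → const a ≈ const b
  const-cong ≡.refl = refl

  const-+ : ∀ a b → const (a ℚ.+ b) ≈ const a ⊞ const b
  const-+ a b = pointwise λ { zero zero → ≡.refl ; zero (suc m) → ≡.refl ; (suc n) m → ≡.refl }

  const-neg : ∀ a → const (ℚ.- a) ≈ ⊟ (const a)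
  const-neg a = pointwise λ { zero zero → ≡.refl ; zero (suc m) → ≡.refl ; (suc n) m → ≡.refl }

  const-⊡-at : ∀ a f n m → (const a ⊡ f) n m ≡ a ℚ.* f n m
  const-⊡-at a f n m = ≡.trans (⊛-conv (const a) f n m) (go n m)
    where
    zero-q : ∀ n m → conv₂ (λ i → const a (suc i)) f n m ≡ 0ℚ
    zero-q n m = ℚ[[q,w]].zeroˡ f n m
    zero-w : ∀ b m → ℚ[[w]].conv (λ j → const a 0 (suc j)) b m ≡ 0ℚ
    zero-w b m = ℚ[[w]].conv-zeroˡ b m
    low : ∀ b m → ℚ[[w]].conv (const a 0) b m ≡ a ℚ.* b m
    low b zero = ≡.refl
    low b (suc m) = ≡.trans (cong (a ℚ.* b (suc m) ℚ.+_) (zero-w b m)) (ℚ.+-identityʳ (a ℚ.* b (suc m)))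
    go : ∀ n m → conv₂ (const a) f n m ≡ a ℚ.* f n m
    go zero m = low (f 0) m
    go (suc n) m = ≡.trans (cong₂ ℚ._+_ (low (f (suc n)) m) (zero-q n m)) (ℚ.+-identityʳ (a ℚ.* f (suc n) m))

  const-* : ∀ a b → const (a ℚ.* b) ≈ const a ⊡ const b
  const-* a b = pointwise λ n m → ≡.trans (scale n m) (≡.sym (const-⊡-at a (const b) n m))
    where
    scale : ∀ n m → const (a ℚ.* b) n m ≡ a ℚ.* const b n m
    scale zero zero = ≡.refl
    scale zero (suc m) = ≡.sym (ℚ.*-zeroʳ a)
    scale (suc n) m = ≡.sym (ℚ.*-zeroʳ a)

  const-0 : const 0ℚ ≈ 𝟘
  const-0 = pointwise λ { zero zero → ≡.refl ; zero (suc m) → ≡.refl ; (suc n) m → ≡.refl }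

  const-1 : const 1ℚ ≈ 𝟙
  const-1 = refl

ℤ→Series : IntegersInto SeriesRing
ℤ→Series = record
  { ⟦_⟧ = λ i → const (fromℤ i)
  ; +-homo = λ i j → trans (const-cong (fromℤ-+ i j)) (const-+ (fromℤ i) (fromℤ j))
  ; *-homo = λ i j → trans (const-cong (fromℤ-* i j)) (const-* (fromℤ i) (fromℤ j))
  ; -‿homo = λ i → trans (const-cong (fromℤ-neg i)) (const-neg (fromℤ i))
  ; 0-homo = const-0
  ; 1-homo = const-1 }

module Solver = IntegerSolver SeriesRing ℤ→Series

open import Algebra.Properties.CommutativeSemigroup
  (CommutativeRing.+-commutativeSemigroup ℚ.+-*-commutativeRing) using (interchange)

sumUpTo-zero : ∀ n {f} → (∀ i → i ≤ n → f i ≡ 0ℚ) → sumUpTo n f ≡ 0ℚ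
sumUpTo-zero zero f≡0 = f≡0 0 z≤n
sumUpTo-zero (suc n) f≡0 =
  cong₂ ℚ._+_ (sumUpTo-zero n (λ i i≤n → f≡0 i (ℕ.m≤n⇒m≤1+n i≤n))) (f≡0 (suc n) ℕ.≤-refl)

sumUpTo-+ : ∀ n (f g : ℕ → ℚ) → sumUpTo n (λ i → f i ℚ.+ g i) ≡ sumUpTo n f ℚ.+ sumUpTo n g
sumUpTo-+ zero f g = ≡.refl
sumUpTo-+ (suc n) f g = ≡.trans (cong (ℚ._+ (f (suc n) ℚ.+ g (suc n))) (sumUpTo-+ n f g))
  (interchange (sumUpTo n f) (sumUpTo n g) (f (suc n)) (g (suc n)))

sumUpTo-swap : ∀ n m (f : ℕ → ℕ → ℚ) →
  sumUpTo n (λ i → sumUpTo m (f i)) ≡ sumUpTo m (λ j → sumUpTo n (λ i → f i j))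
sumUpTo-swap zero m f = ≡.refl
sumUpTo-swap (suc n) m f = ≡.trans (cong (ℚ._+ sumUpTo m (f (suc n))) (sumUpTo-swap n m f))
  (≡.sym (sumUpTo-+ m (λ j → sumUpTo n (λ i → f i j)) (f (suc n))))

sumUpTo-extend : ∀ {n N} (f : ℕ → ℚ) → n ≤ N → (∀ i → n < i → f i ≡ 0ℚ) → sumUpTo N f ≡ sumUpTo n f
sumUpTo-extend {n} {N} f n≤N f≡0 = go (ℕ.≤⇒≤′ n≤N)
  where
  go : ∀ {N} → n ℕ.≤′ N → sumUpTo N f ≡ sumUpTo n f
  go (ℕ.≤′-reflexive ≡.refl) = ≡.refl
  go (ℕ.≤′-step {N} n≤N) = ≡.trans (cong₂ ℚ._+_ (go n≤N) (f≡0 (suc N) (s≤s (ℕ.≤′⇒≤ n≤N))))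
    (ℚ.+-identityʳ (sumUpTo n f))

opaque
  unfolding _⊞_
  -- Allows an infinite sum inside a product to be replaced by a partial sum that agrees with it up
  -- to the degree considered.
  ⊡-local : ∀ h {f g} n m → (∀ i j → i ≤ n → j ≤ m → f i j ≡ g i j) → (h ⊡ f) n m ≡ (h ⊡ g) n m
  ⊡-local h n m f≡g = sumUpTo-cong n λ i _ → sumUpTo-cong m λ j _ →
    cong (h i j ℚ.*_) (f≡g (n ∸ i) (m ∸ j) (ℕ.m∸n≤m n i) (ℕ.m∸n≤m m j))

-- Order in q alone: every column has cells, so q governs convergence whatever the powers of w.
record Order≥ (k : ℕ) (f : FPS) : Set where
  constructor vanishing
  field below : ∀ n m → n < k → f n m ≡ 0ℚ
open Order≥ public

opaque
  unfolding _⊞_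
  Order≥-resp : ∀ {k f g} → f ≈ g → Order≥ k f → Order≥ k g
  Order≥-resp f≈g o = vanishing λ n m n<k → ≡.trans (≡.sym (at f≈g n m)) (below o n m n<k)

  Order≥-0 : ∀ {f} → Order≥ 0 f
  Order≥-0 = vanishing λ _ _ ()

  Order≥-zero : ∀ {k} → Order≥ k 𝟘
  Order≥-zero = vanishing λ _ _ _ → ≡.refl

  Order≥-weaken : ∀ {k l f} → k ≤ l → Order≥ l f → Order≥ k f
  Order≥-weaken k≤l o = vanishing λ n m n<k → below o n m (ℕ.≤-trans n<k k≤l)

  Order≥-⊞ : ∀ {k f g} → Order≥ k f → Order≥ k g → Order≥ k (f ⊞ g)
  Order≥-⊞ o p = vanishing λ n m n<k → cong₂ ℚ._+_ (below o n m n<k) (below p n m n<k)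

  Order≥-⊡ : ∀ {a b f g} → Order≥ a f → Order≥ b g → Order≥ (a + b) (f ⊡ g)
  Order≥-⊡ {a} {b} {f} {g} o p = vanishing λ n m n<a+b →
    sumUpTo-zero n λ i i≤n → sumUpTo-zero m λ j _ → term n m n<a+b i i≤n j
    where
    term : ∀ n m → n < a + b → ∀ i → i ≤ n → ∀ j → f i j ℚ.* g (n ∸ i) (m ∸ j) ≡ 0ℚ
    term n m n<a+b i i≤n j with i ℕ.<? a
    ... | yes i<a = ≡.trans (cong (ℚ._* g (n ∸ i) (m ∸ j)) (below o i j i<a)) (ℚ.*-zeroˡ (g (n ∸ i) (m ∸ j)))
    ... | no i≮a = ≡.trans (cong (f i j ℚ.*_) (below p (n ∸ i) (m ∸ j) n∸i<b)) (ℚ.*-zeroʳ (f i j))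
      where
      n∸i<b : n ∸ i < b
      n∸i<b = ℕ.+-cancelˡ-< i (n ∸ i) b
        (≡.subst (_< i + b) (≡.sym (ℕ.m+[n∸m]≡n i≤n))
          (ℕ.<-≤-trans n<a+b (ℕ.+-monoˡ-≤ b (ℕ.≮⇒≥ i≮a))))

  Order≥-⊡ʳ : ∀ {k g} f → Order≥ k g → Order≥ k (f ⊡ g)
  Order≥-⊡ʳ f = Order≥-⊡ (Order≥-0 {f})

  Order≥-⊡ˡ : ∀ {k f} g → Order≥ k f → Order≥ k (f ⊡ g)
  Order≥-⊡ˡ {f = f} g o = Order≥-resp (⊡-comm g f) (Order≥-⊡ʳ g o)

∑≤ : ℕ → (ℕ → FPS) → FPS
∑≤ zero g = g 0
∑≤ (suc N) g = ∑≤ N g ⊞ g (suc N)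

opaque
  unfolding _⊞_
  ∑≤-at : ∀ N g n m → ∑≤ N g n m ≡ sumUpTo N (λ j → g j n m)
  ∑≤-at zero g n m = ≡.refl
  ∑≤-at (suc N) g n m = cong (ℚ._+ g (suc N) n m) (∑≤-at N g n m)

  ∑≤-⊡ : ∀ N h g → h ⊡ ∑≤ N g ≈ ∑≤ N (λ j → h ⊡ g j)
  ∑≤-⊡ zero h g = refl
  ∑≤-⊡ (suc N) h g = trans (⊡-distribˡ h (∑≤ N g) (g (suc N))) (⊞-congʳ (∑≤-⊡ N h g))

  ∑≤-head : ∀ N g → ∑≤ (suc N) g ≈ g 0 ⊞ ∑≤ N (g ∘ suc)
  ∑≤-head zero g = refl
  ∑≤-head (suc N) g = trans (⊞-congʳ (∑≤-head N g)) (⊞-assoc (g 0) (∑≤ N (g ∘ suc)) (g (suc (suc N))))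

opaque
  -- Stopping at j = n gives the full sum as soon as the j-th term has order at least j. With the
  -- index shifted by one this is `sum≥1`.
  ∑ : (ℕ → FPS) → FPS
  ∑ g n m = sumUpTo n (λ j → g j n m)

opaque
  unfolding _⊞_ ∑
  ∑-partial : ∀ {g} → (∀ j → Order≥ j (g j)) → ∀ {n N} → n ≤ N → ∀ m → ∑ g n m ≡ ∑≤ N g n m
  ∑-partial {g} o {n} {N} n≤N m = ≡.sym (≡.trans (∑≤-at N g n m)
    (sumUpTo-extend (λ j → g j n m) n≤N (λ i n<i → below (o i) n m n<i)))

  ∑-cong : ∀ {g h} → (∀ j → g j ≈ h j) → ∑ g ≈ ∑ h
  ∑-cong g≈h = pointwise λ n m → sumUpTo-cong n (λ j _ → at (g≈h j) n m)

  ∑-⊞ : ∀ g h → ∑ (λ j → g j ⊞ h j) ≈ ∑ g ⊞ ∑ h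
  ∑-⊞ g h = pointwise λ n m → sumUpTo-+ n (λ j → g j n m) (λ j → h j n m)

  ∑-⊡ : ∀ h {g} → (∀ j → Order≥ j (g j)) → h ⊡ ∑ g ≈ ∑ (λ j → h ⊡ g j)
  ∑-⊡ h {g} o = pointwise λ n m → ≡.trans
    (⊡-local h n m (λ i j i≤n _ → ∑-partial o i≤n j))
    (≡.trans (at (∑≤-⊡ n h g) n m) (∑≤-at n (λ j → h ⊡ g j) n m))

  ∑-head : ∀ {g} → (∀ j → Order≥ j (g j)) → ∑ g ≈ g 0 ⊞ ∑ (g ∘ suc)
  ∑-head {g} o = pointwise go
    where
    go : ∀ n m → ∑ g n m ≡ (g 0 ⊞ ∑ (g ∘ suc)) n m
    go zero m = ≡.sym (≡.trans (cong (g 0 0 m ℚ.+_) (below (o 1) 0 m (s≤s z≤n))) (ℚ.+-identityʳ (g 0 0 m)))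
    go (suc n) m = ≡.trans (sumUpTo-head n (λ j → g j (suc n) m)) (cong (g 0 (suc n) m ℚ.+_)
      (≡.sym (sumUpTo-extend (λ j → g (suc j) (suc n) m) (ℕ.n≤1+n n)
        (λ i n<i → below (o (suc i)) (suc n) m (s≤s n<i)))))

  -- In degree n both sides run over the square i, j ≤ n.
  ∑-swap : ∀ (g : ℕ → ℕ → FPS) → ∑ (λ i → ∑ (g i)) ≈ ∑ (λ j → ∑ (λ i → g i j))
  ∑-swap g = pointwise λ n m → sumUpTo-swap n n (λ i j → g i j n m)

  ∑-𝟘 : ∑ (λ _ → 𝟘) ≈ 𝟘
  ∑-𝟘 = pointwise λ n m → sumUpTo-zero n (λ _ _ → ≡.refl)

  -- Unrolling n + 1 times leaves the remainder `r (suc n)`, whose order exceeds n, so that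
  -- coefficients of q^n see only the partial sum.
  ∑-limit : ∀ (g r : ℕ → FPS) → (∀ j → Order≥ j (g j)) → (∀ N → Order≥ N (r N)) →
            (∀ N → r N ≈ g N ⊞ r (suc N)) → r 0 ≈ ∑ g
  ∑-limit g r og or peel = pointwise λ n m → ≡.trans (at (unroll n) n m)
    (≡.trans (cong (∑≤ n g n m ℚ.+_) (below (or (suc n)) n m ℕ.≤-refl))
      (≡.trans (ℚ.+-identityʳ (∑≤ n g n m)) (∑≤-at n g n m)))
    where
    unroll : ∀ N → r 0 ≈ ∑≤ N g ⊞ r (suc N)
    unroll zero = peel 0
    unroll (suc N) = trans (unroll N) (trans (⊞-congˡ {∑≤ N g} (peel (suc N)))
      (sym (⊞-assoc (∑≤ N g) (g (suc N)) (r (suc (suc N))))))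

  Order≥-∑ : ∀ {k g} → (∀ j → Order≥ k (g j)) → Order≥ k (∑ g)
  Order≥-∑ o = vanishing λ n m n<k → sumUpTo-zero n (λ j _ → below (o j) n m n<k)

  -- Each factor without constant term adds at least 1 to the total degree in q and w. This is what
  -- justifies the cut-off n + m in `inv`.
  ↑-vanish : ∀ h → h 0 0 ≡ 0ℚ → ∀ k n m → n + m < k → (h ↑ k) n m ≡ 0ℚ
  ↑-vanish h h₀≡0 (suc k) n m (s≤s n+m≤k) =
    sumUpTo-zero n λ i i≤n → sumUpTo-zero m λ j j≤m → term i j i≤n j≤m
    where
    smaller : ∀ i j → i ≤ n → j ≤ m → 0 < i + j → (n ∸ i) + (m ∸ j) < k
    smaller i j i≤n j≤m 0<i+j = ℕ.+-cancelˡ-≤ (i + j) _ _ (ℕ.≤-trans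
      (ℕ.≤-reflexive (≡.trans (ℕ.+-suc (i + j) _) (cong suc (≡.trans (rearrange i j (n ∸ i) (m ∸ j))
        (cong₂ _+_ (ℕ.m+[n∸m]≡n i≤n) (ℕ.m+[n∸m]≡n j≤m))))))
      (ℕ.+-mono-≤ 0<i+j n+m≤k))
      where
      open import Algebra.Properties.CommutativeSemigroup ℕ.+-commutativeSemigroup
        renaming (interchange to rearrange)
    term : ∀ i j → i ≤ n → j ≤ m → h i j ℚ.* (h ↑ k) (n ∸ i) (m ∸ j) ≡ 0ℚ
    term zero zero _ _ = ≡.trans (cong (ℚ._* (h ↑ k) n m) h₀≡0) (ℚ.*-zeroˡ ((h ↑ k) n m))
    term zero (suc j) p r = ≡.trans (cong (h 0 (suc j) ℚ.*_)
      (↑-vanish h h₀≡0 k n (m ∸ suc j) (smaller 0 (suc j) p r (s≤s z≤n)))) (ℚ.*-zeroʳ (h 0 (suc j)))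
    term (suc i) j p r = ≡.trans (cong (h (suc i) j ℚ.*_)
      (↑-vanish h h₀≡0 k (n ∸ suc i) (m ∸ j) (smaller (suc i) j p r (s≤s z≤n)))) (ℚ.*-zeroʳ (h (suc i) j))

  ↑≡^ₛ : ∀ f k → f ↑ k ≡ f ^ₛ k
  ↑≡^ₛ f zero = ≡.refl
  ↑≡^ₛ f (suc k) = cong (f ⊛_) (↑≡^ₛ f k)

  -- The geometric series S of h = 1 - f satisfies S = 1 + h S. The truncations on the two sides
  -- differ by a power of h that vanishes in the degree considered.
  ⁻¹-fixpoint : ∀ f → f 0 0 ≡ 1ℚ → f ⁻¹ ≈ 𝟙 ⊞ (𝟙 ⊞ ⊟ f) ⊡ f ⁻¹
  ⁻¹-fixpoint f f₀≡1 = pointwise λ n m → ≡.trans (truncate n m (ℕ.n≤1+n (n + m)))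
    (≡.trans (at (∑≤-head (n + m) (h ↑_)) n m) (cong (oneₛ n m ℚ.+_) (≡.sym (≡.trans
      (⊡-local h n m (λ i j i≤n j≤m → truncate i j (ℕ.+-mono-≤ i≤n j≤m)))
      (at (∑≤-⊡ (n + m) h (h ↑_)) n m)))))
    where
    h : FPS
    h = 𝟙 ⊞ ⊟ f
    h₀≡0 : h 0 0 ≡ 0ℚ
    h₀≡0 = cong (λ c → 1ℚ ℚ.- c) f₀≡1
    truncate : ∀ n m {N} → n + m ≤ N → (f ⁻¹) n m ≡ ∑≤ N (h ↑_) n m
    truncate n m {N} n+m≤N = ≡.trans
      (sumUpTo-cong (n + m) (λ k _ → cong (λ p → p n m) (≡.sym (↑≡^ₛ h k))))
      (≡.sym (≡.trans (∑≤-at N (h ↑_) n m)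
        (sumUpTo-extend (λ k → (h ↑ k) n m) n+m≤N (λ k → ↑-vanish h h₀≡0 k n m))))

  ⊡-const : ∀ f g → f 0 0 ≡ 1ℚ → g 0 0 ≡ 1ℚ → (f ⊡ g) 0 0 ≡ 1ℚ
  ⊡-const f g f₀ g₀ = cong₂ ℚ._*_ f₀ g₀

  𝟙-const : 𝟙 0 0 ≡ 1ℚ
  𝟙-const = ≡.refl

↑-const : ∀ f → f 0 0 ≡ 1ℚ → ∀ k → (f ↑ k) 0 0 ≡ 1ℚ
↑-const f f₀ zero = 𝟙-const
↑-const f f₀ (suc k) = ⊡-const f (f ↑ k) f₀ (↑-const f f₀ k)

⁻¹-inverse : ∀ f → f 0 0 ≡ 1ℚ → f ⊡ f ⁻¹ ≈ 𝟙
⁻¹-inverse f f₀≡1 = begin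
  f ⊡ f ⁻¹ ≈⟨ sym (⊡-identityˡ _) ⟩
  𝟙 ⊡ (f ⊡ f ⁻¹) ≈⟨ solve 3 (λ o f i → o :* (f :* i) := o :* i :- (o :* i :- o :* (f :* i))) refl 𝟙 f (f ⁻¹) ⟩
  𝟙 ⊡ f ⁻¹ ⊞ ⊟ (𝟙 ⊡ f ⁻¹ ⊞ ⊟ (𝟙 ⊡ (f ⊡ f ⁻¹)))
    ≈⟨ ⊞-cong (trans (⊡-identityˡ _) (⁻¹-fixpoint f f₀≡1)) (⊟-cong (⊞-congˡ (⊟-cong (⊡-identityˡ _)))) ⟩
  (𝟙 ⊞ (𝟙 ⊞ ⊟ f) ⊡ f ⁻¹) ⊞ ⊟ (𝟙 ⊡ f ⁻¹ ⊞ ⊟ (f ⊡ f ⁻¹))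
    ≈⟨ solve 3 (λ o f i → (o :+ (o :- f) :* i) :- (o :* i :- f :* i) := o) refl 𝟙 f (f ⁻¹) ⟩
  𝟙 ∎
  where
  open SetoidReasoning setoid
  open Solver

-- Inverses in commutative rings

module Units (R : CommutativeRing 0ℓ 0ℓ) where
  open CommutativeRing R hiding (zero) renaming (_≈_ to _≈ᴿ_; _*_ to _*ᴿ_; 1# to 1ᴿ; sym to symᴿ; trans to transᴿ; *-assoc to *-assocᴿ; *-comm to *-commᴿ)

  inverse-unique : ∀ {x y z} → x *ᴿ y ≈ᴿ 1ᴿ → x *ᴿ z ≈ᴿ 1ᴿ → y ≈ᴿ z
  inverse-unique {x} {y} {z} xy≈1 xz≈1 = transᴿ (symᴿ (*-identityʳ y))
    (transᴿ (*-congˡ (symᴿ xz≈1)) (transᴿ (symᴿ (*-assocᴿ y x z))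
      (transᴿ (*-congʳ (transᴿ (*-commᴿ y x) xy≈1)) (*-identityˡ z))))

  inverse-product : ∀ {x x′ y y′} → x *ᴿ x′ ≈ᴿ 1ᴿ → y *ᴿ y′ ≈ᴿ 1ᴿ → (x *ᴿ y) *ᴿ (x′ *ᴿ y′) ≈ᴿ 1ᴿ
  inverse-product {x} {x′} {y} {y′} p r = transᴿ (rearrange x y x′ y′)
    (transᴿ (*-cong p r) (*-identityˡ 1ᴿ))
    where
    open import Algebra.Properties.CommutativeSemigroup *-commutativeSemigroup
      renaming (interchange to rearrange)

open Units SeriesRing public

⁻¹-unique : ∀ {f g} → f 0 0 ≡ 1ℚ → f ⊡ g ≈ 𝟙 → f ⁻¹ ≈ g
⁻¹-unique {f} f₀≡1 fg≈1 = inverse-unique (⁻¹-inverse f f₀≡1) fg≈1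

⁻¹-⊡ : ∀ f g → f 0 0 ≡ 1ℚ → g 0 0 ≡ 1ℚ → (f ⊡ g) ⁻¹ ≈ f ⁻¹ ⊡ g ⁻¹
⁻¹-⊡ f g f₀ g₀ = ⁻¹-unique (⊡-const f g f₀ g₀)
  (inverse-product (⁻¹-inverse f f₀) (⁻¹-inverse g g₀))

𝟙⁻¹ : 𝟙 ⁻¹ ≈ 𝟙
𝟙⁻¹ = ⁻¹-unique 𝟙-const (⊡-identityˡ 𝟙)

⁻¹-↑ : ∀ f → f 0 0 ≡ 1ℚ → ∀ k → (f ↑ k) ⁻¹ ≈ (f ⁻¹) ↑ k
⁻¹-↑ f f₀ zero = 𝟙⁻¹
⁻¹-↑ f f₀ (suc k) = trans (⁻¹-⊡ f (f ↑ k) f₀ (↑-const f f₀ k)) (⊡-congˡ (⁻¹-↑ f f₀ k))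

-- Jets

-- jet a b c stands for a + b e + c e² modulo e³, i.e. for the value, the derivative
-- and half the second derivative at s = 1 of a function of s = 1 + e.
record Jet : Set where
  constructor jet
  field
    c₀ c₁ c₂ : FPS
open Jet public

infix 4 _≈ᴶ_
record _≈ᴶ_ (a b : Jet) : Set where
  constructor jet≈
  field
    at₀ : c₀ a ≈ c₀ b
    at₁ : c₁ a ≈ c₁ b
    at₂ : c₂ a ≈ c₂ b
open _≈ᴶ_ public

infixl 6 _⊞ᴶ_
infixl 7 _⊡ᴶ_
infix 8 ⊟ᴶ_
infixr 9 _↑ᴶ_
opaque
  _⊞ᴶ_ _⊡ᴶ_ : Jet → Jet → Jet
  a ⊞ᴶ b = jet (c₀ a ⊞ c₀ b) (c₁ a ⊞ c₁ b) (c₂ a ⊞ c₂ b)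
  a ⊡ᴶ b = jet (c₀ a ⊡ c₀ b) (c₀ a ⊡ c₁ b ⊞ c₁ a ⊡ c₀ b) (c₀ a ⊡ c₂ b ⊞ c₁ a ⊡ c₁ b ⊞ c₂ a ⊡ c₀ b)
  ⊟ᴶ_ : Jet → Jet
  ⊟ᴶ a = jet (⊟ c₀ a) (⊟ c₁ a) (⊟ c₂ a)
  scalar : FPS → Jet
  scalar f = jet f 𝟘 𝟘
  𝟘ᴶ 𝟙ᴶ : Jet
  𝟘ᴶ = scalar 𝟘
  𝟙ᴶ = scalar 𝟙

  isCommutativeRingᴶ : IsCommutativeRing _≈ᴶ_ _⊞ᴶ_ _⊡ᴶ_ ⊟ᴶ_ 𝟘ᴶ 𝟙ᴶ
  isCommutativeRingᴶ = record
    { isRing = record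
      { +-isAbelianGroup = record
        { isGroup = record
          { isMonoid = record
            { isSemigroup = record
              { isMagma = record
                { isEquivalence = record
                  { refl = jet≈ refl refl refl
                  ; sym = λ (jet≈ p q r) → jet≈ (sym p) (sym q) (sym r)
                  ; trans = λ (jet≈ p q r) (jet≈ p′ q′ r′) → jet≈ (trans p p′) (trans q q′) (trans r r′) }
                ; ∙-cong = λ (jet≈ p q r) (jet≈ p′ q′ r′) → jet≈ (⊞-cong p p′) (⊞-cong q q′) (⊞-cong r r′) }
              ; assoc = λ a b c → jet≈ (⊞-assoc _ _ _) (⊞-assoc _ _ _) (⊞-assoc _ _ _) }
            ; identity = (λ a → jet≈ (⊞-identityˡ _) (⊞-identityˡ _) (⊞-identityˡ _))
                       , (λ a → jet≈ (⊞-identityʳ _) (⊞-identityʳ _) (⊞-identityʳ _)) }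
          ; inverse = (λ a → jet≈ (inverseˡ _) (inverseˡ _) (inverseˡ _))
                    , (λ a → jet≈ (inverseʳ _) (inverseʳ _) (inverseʳ _))
          ; ⁻¹-cong = λ (jet≈ p q r) → jet≈ (⊟-cong p) (⊟-cong q) (⊟-cong r) }
        ; comm = λ a b → jet≈ (⊞-comm _ _) (⊞-comm _ _) (⊞-comm _ _) }
      ; *-cong = ⊡-congᵖ
      ; *-assoc = assocᵖ
      ; *-identity = identityˡᵖ , λ a → transᵖ (commᵖ a 𝟙ᴶ) (identityˡᵖ a)
      ; distrib = (λ a b c → transᵖ (commᵖ a (b ⊞ᴶ c)) (transᵖ (distribʳᵖ a b c) (⊞-congᵖ (commᵖ b a) (commᵖ c a))))
                , distribʳᵖ }
    ; *-comm = commᵖ }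
    where
    open CommutativeRing SeriesRing using () renaming (-‿inverseˡ to inverseˡ; -‿inverseʳ to inverseʳ)
    open Solver
    transᵖ : ∀ {a b c} → a ≈ᴶ b → b ≈ᴶ c → a ≈ᴶ c
    transᵖ (jet≈ p q r) (jet≈ p′ q′ r′) = jet≈ (trans p p′) (trans q q′) (trans r r′)
    ⊞-congᵖ : ∀ {a b c d} → a ≈ᴶ b → c ≈ᴶ d → (a ⊞ᴶ c) ≈ᴶ (b ⊞ᴶ d)
    ⊞-congᵖ (jet≈ p q r) (jet≈ p′ q′ r′) = jet≈ (⊞-cong p p′) (⊞-cong q q′) (⊞-cong r r′)
    ⊡-congᵖ : ∀ {a b c d} → a ≈ᴶ b → c ≈ᴶ d → (a ⊡ᴶ c) ≈ᴶ (b ⊡ᴶ d)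
    ⊡-congᵖ (jet≈ p q r) (jet≈ p′ q′ r′) = jet≈ (⊡-cong p p′)
      (⊞-cong (⊡-cong p q′) (⊡-cong q p′))
      (⊞-cong (⊞-cong (⊡-cong p r′) (⊡-cong q q′)) (⊡-cong r p′))
    commᵖ : ∀ a b → (a ⊡ᴶ b) ≈ᴶ (b ⊡ᴶ a)
    commᵖ (jet a b c) (jet a′ b′ c′) = jet≈ (⊡-comm _ _)
      (solve 4 (λ a b a′ b′ → a :* b′ :+ b :* a′ := a′ :* b :+ b′ :* a) refl a b a′ b′)
      (solve 6 (λ a b c a′ b′ c′ → a :* c′ :+ b :* b′ :+ c :* a′ := a′ :* c :+ b′ :* b :+ c′ :* a)
        refl a b c a′ b′ c′)
    assocᵖ : ∀ a b c → ((a ⊡ᴶ b) ⊡ᴶ c) ≈ᴶ (a ⊡ᴶ (b ⊡ᴶ c))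
    assocᵖ (jet a b c) (jet a′ b′ c′) (jet a″ b″ c″) = jet≈ (⊡-assoc _ _ _)
      (solve 6 (λ a b a′ b′ a″ b″ → a :* a′ :* b″ :+ (a :* b′ :+ b :* a′) :* a″ :=
        a :* (a′ :* b″ :+ b′ :* a″) :+ b :* (a′ :* a″)) refl a b a′ b′ a″ b″)
      (solve 9 (λ a b c a′ b′ c′ a″ b″ c″ →
        a :* a′ :* c″ :+ (a :* b′ :+ b :* a′) :* b″ :+ (a :* c′ :+ b :* b′ :+ c :* a′) :* a″ :=
        a :* (a′ :* c″ :+ b′ :* b″ :+ c′ :* a″) :+ b :* (a′ :* b″ :+ b′ :* a″) :+ c :* (a′ :* a″))
        refl a b c a′ b′ c′ a″ b″ c″)
    identityˡᵖ : ∀ a → (𝟙ᴶ ⊡ᴶ a) ≈ᴶ a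
    identityˡᵖ (jet a b c) = jet≈ (⊡-identityˡ a)
      (trans (⊞-cong (⊡-identityˡ b) (zeroˡ a)) (⊞-identityʳ b))
      (trans (⊞-cong (trans (⊞-cong (⊡-identityˡ c) (zeroˡ b)) (⊞-identityʳ c)) (zeroˡ a)) (⊞-identityʳ c))
    distribʳᵖ : ∀ c a b → ((a ⊞ᴶ b) ⊡ᴶ c) ≈ᴶ (a ⊡ᴶ c ⊞ᴶ b ⊡ᴶ c)
    distribʳᵖ (jet a b c) (jet a′ b′ c′) (jet a″ b″ c″) = jet≈ (⊡-distribʳ _ _ _)
      (solve 6 (λ a b a′ b′ a″ b″ → (a′ :+ a″) :* b :+ (b′ :+ b″) :* a :=
        a′ :* b :+ b′ :* a :+ (a″ :* b :+ b″ :* a)) refl a b a′ b′ a″ b″)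
      (solve 9 (λ a b c a′ b′ c′ a″ b″ c″ →
        (a′ :+ a″) :* c :+ (b′ :+ b″) :* b :+ (c′ :+ c″) :* a :=
        a′ :* c :+ b′ :* b :+ c′ :* a :+ (a″ :* c :+ b″ :* b :+ c″ :* a))
        refl a b c a′ b′ c′ a″ b″ c″)

_↑ᴶ_ : Jet → ℕ → Jet
a ↑ᴶ zero = 𝟙ᴶ
a ↑ᴶ suc k = a ⊡ᴶ a ↑ᴶ k

JetRing : CommutativeRing 0ℓ 0ℓ
JetRing = record { isCommutativeRing = isCommutativeRingᴶ }

module 𝕁 = CommutativeRing JetRing

opaque
  unfolding _⊞ᴶ_

  scalar-cong : ∀ {f g} → f ≈ g → scalar f ≈ᴶ scalar g
  scalar-cong f≈g = jet≈ f≈g refl refl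

  scalar-⊞ : ∀ f g → scalar (f ⊞ g) ≈ᴶ scalar f ⊞ᴶ scalar g
  scalar-⊞ f g = jet≈ refl (sym (⊞-identityˡ 𝟘)) (sym (⊞-identityˡ 𝟘))

  scalar-⊟ : ∀ f → scalar (⊟ f) ≈ᴶ ⊟ᴶ scalar f
  scalar-⊟ f = jet≈ refl (sym -0#≈0#) (sym -0#≈0#)
    where open import Algebra.Properties.Ring (CommutativeRing.ring SeriesRing) using (-0#≈0#)

  scalar-⊡ : ∀ f g → scalar (f ⊡ g) ≈ᴶ scalar f ⊡ᴶ scalar g
  scalar-⊡ f g = jet≈ refl
    (sym (trans (⊞-cong (zeroʳ f) (zeroˡ g)) (⊞-identityˡ 𝟘)))
    (sym (trans (⊞-cong (trans (⊞-cong (zeroʳ f) (zeroˡ 𝟘)) (⊞-identityˡ 𝟘)) (zeroˡ g)) (⊞-identityˡ 𝟘)))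

  scalar-𝟘 : scalar 𝟘 ≈ᴶ 𝟘ᴶ
  scalar-𝟘 = 𝕁.refl

  scalar-𝟙 : scalar 𝟙 ≈ᴶ 𝟙ᴶ
  scalar-𝟙 = 𝕁.refl

ℤ→Jet : IntegersInto JetRing
ℤ→Jet = record
  { ⟦_⟧ = λ i → scalar (const (fromℤ i))
  ; +-homo = λ i j → 𝕁.trans (scalar-cong (+-homo i j)) (scalar-⊞ _ _)
  ; *-homo = λ i j → 𝕁.trans (scalar-cong (*-homo i j)) (scalar-⊡ _ _)
  ; -‿homo = λ i → 𝕁.trans (scalar-cong (-‿homo i)) (scalar-⊟ _)
  ; 0-homo = 𝕁.trans (scalar-cong 0-homo) scalar-𝟘
  ; 1-homo = 𝕁.trans (scalar-cong 1-homo) scalar-𝟙 }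
  where open _-Raw-AlmostCommutative⟶_ ℤ→Series

module JetSolver = IntegerSolver JetRing ℤ→Jet

record Order≥ᴶ (k : ℕ) (a : Jet) : Set where
  constructor orders
  field
    order₀ : Order≥ k (c₀ a)
    order₁ : Order≥ k (c₁ a)
    order₂ : Order≥ k (c₂ a)
open Order≥ᴶ public

opaque
  unfolding _⊞ᴶ_

  Order≥ᴶ-resp : ∀ {k a b} → a ≈ᴶ b → Order≥ᴶ k a → Order≥ᴶ k b
  Order≥ᴶ-resp (jet≈ p q r) (orders o o′ o″) = orders (Order≥-resp p o) (Order≥-resp q o′) (Order≥-resp r o″)

  Order≥ᴶ-weaken : ∀ {k l a} → k ≤ l → Order≥ᴶ l a → Order≥ᴶ k a
  Order≥ᴶ-weaken k≤l (orders o o′ o″) = orders (Order≥-weaken k≤l o) (Order≥-weaken k≤l o′) (Order≥-weaken k≤l o″)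

  Order≥ᴶ-0 : ∀ {a} → Order≥ᴶ 0 a
  Order≥ᴶ-0 = orders Order≥-0 Order≥-0 Order≥-0

  Order≥ᴶ-⊞ : ∀ {k a b} → Order≥ᴶ k a → Order≥ᴶ k b → Order≥ᴶ k (a ⊞ᴶ b)
  Order≥ᴶ-⊞ (orders o o′ o″) (orders p p′ p″) = orders (Order≥-⊞ o p) (Order≥-⊞ o′ p′) (Order≥-⊞ o″ p″)

  Order≥ᴶ-⊡ : ∀ {k l a b} → Order≥ᴶ k a → Order≥ᴶ l b → Order≥ᴶ (k + l) (a ⊡ᴶ b)
  Order≥ᴶ-⊡ (orders o o′ o″) (orders p p′ p″) = orders (Order≥-⊡ o p)
    (Order≥-⊞ (Order≥-⊡ o p′) (Order≥-⊡ o′ p))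
    (Order≥-⊞ (Order≥-⊞ (Order≥-⊡ o p″) (Order≥-⊡ o′ p′)) (Order≥-⊡ o″ p))

  Order≥ᴶ-scalar : ∀ {k f} → Order≥ k f → Order≥ᴶ k (scalar f)
  Order≥ᴶ-scalar o = orders o Order≥-zero Order≥-zero

  ∑ᴶ : (ℕ → Jet) → Jet
  ∑ᴶ g = jet (∑ (c₀ ∘ g)) (∑ (c₁ ∘ g)) (∑ (c₂ ∘ g))

  ∑ᴶ-cong : ∀ {g h} → (∀ j → g j ≈ᴶ h j) → ∑ᴶ g ≈ᴶ ∑ᴶ h
  ∑ᴶ-cong g≈h = jet≈ (∑-cong (at₀ ∘ g≈h)) (∑-cong (at₁ ∘ g≈h)) (∑-cong (at₂ ∘ g≈h))

  ∑ᴶ-⊞ : ∀ g h → ∑ᴶ (λ j → g j ⊞ᴶ h j) ≈ᴶ ∑ᴶ g ⊞ᴶ ∑ᴶ h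
  ∑ᴶ-⊞ g h = jet≈ (∑-⊞ _ _) (∑-⊞ _ _) (∑-⊞ _ _)

  ∑ᴶ-⊡ : ∀ a {g} → (∀ j → Order≥ᴶ j (g j)) → a ⊡ᴶ ∑ᴶ g ≈ᴶ ∑ᴶ (λ j → a ⊡ᴶ g j)
  ∑ᴶ-⊡ a o = jet≈ (∑-⊡ _ (λ j → order₀ (o j)))
    (trans (⊞-cong (∑-⊡ _ (λ j → order₁ (o j))) (∑-⊡ _ (λ j → order₀ (o j)))) (sym (∑-⊞ _ _)))
    (trans (⊞-cong (trans (⊞-cong (∑-⊡ _ (λ j → order₂ (o j))) (∑-⊡ _ (λ j → order₁ (o j)))) (sym (∑-⊞ _ _)))
      (∑-⊡ _ (λ j → order₀ (o j)))) (sym (∑-⊞ _ _)))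

  ∑ᴶ-head : ∀ {g} → (∀ j → Order≥ᴶ j (g j)) → ∑ᴶ g ≈ᴶ g 0 ⊞ᴶ ∑ᴶ (g ∘ suc)
  ∑ᴶ-head o = jet≈ (∑-head (λ j → order₀ (o j))) (∑-head (λ j → order₁ (o j))) (∑-head (λ j → order₂ (o j)))

  ∑ᴶ-swap : ∀ (g : ℕ → ℕ → Jet) → ∑ᴶ (λ i → ∑ᴶ (g i)) ≈ᴶ ∑ᴶ (λ j → ∑ᴶ (λ i → g i j))
  ∑ᴶ-swap g = jet≈ (∑-swap _) (∑-swap _) (∑-swap _)

  scalar-∑ : ∀ g → scalar (∑ g) ≈ᴶ ∑ᴶ (scalar ∘ g)
  scalar-∑ g = jet≈ refl (sym ∑-𝟘) (sym ∑-𝟘)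

  ∑ᴶ-limit : ∀ {a} (g : ℕ → Jet) (r : ℕ → Jet) → (∀ j → Order≥ᴶ j (g j)) → (∀ N → Order≥ᴶ N (r N)) →
             a ≈ᴶ r 0 → (∀ N → r N ≈ᴶ g N ⊞ᴶ r (suc N)) → a ≈ᴶ ∑ᴶ g
  ∑ᴶ-limit g r og or a≈r₀ peel = 𝕁.trans a≈r₀ (jet≈
    (∑-limit _ _ (λ j → order₀ (og j)) (λ j → order₀ (or j)) (λ N → at₀ (peel N)))
    (∑-limit _ _ (λ j → order₁ (og j)) (λ j → order₁ (or j)) (λ N → at₁ (peel N)))
    (∑-limit _ _ (λ j → order₂ (og j)) (λ j → order₂ (or j)) (λ N → at₂ (peel N))))

-- Monomials and numerals as series

shift : {X : Set} → X → ℕ → ℕ → (ℕ → ℕ → X) → ℕ → ℕ → X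
shift z zero zero h n m = h n m
shift z zero (suc b) h n zero = z
shift z zero (suc b) h n (suc m) = shift z zero b h n m
shift z (suc a) b h zero m = z
shift z (suc a) b h (suc n) m = shift z a b h n m

opaque
  unfolding _⊞_

  -- Multiplication by q^a w^b moves coefficients. `shift` is polymorphic in its values so that the
  -- same recursion also describes the counts of column sequences.
  mono-⊡ : ∀ a b f n m → (mono a b ⊡ f) n m ≡ shift 0ℚ a b f n m
  mono-⊡ a b f n m = ≡.trans (⊛-conv (mono a b) f n m) (go a n m)
    where
    w-shift : ∀ b (g : ℕ → ℚ) n m →
              ℚ[[w]].conv (mono 0 b 0) g m ≡ shift 0ℚ 0 b (λ _ → g) n m
    w-shift zero g n zero = ℚ.*-identityˡ (g 0)
    w-shift zero g n (suc m) = ≡.trans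
      (cong₂ ℚ._+_ (ℚ.*-identityˡ (g (suc m))) (ℚ[[w]].conv-zeroˡ g m)) (ℚ.+-identityʳ (g (suc m)))
    w-shift (suc b) g n zero = ℚ.*-zeroˡ (g 0)
    w-shift (suc b) g n (suc m) = ≡.trans
      (cong₂ ℚ._+_ (ℚ.*-zeroˡ (g (suc m))) (w-shift b g n m)) (ℚ.+-identityˡ _)
    same : ∀ b n m → shift 0ℚ 0 b (λ _ → f n) n m ≡ shift 0ℚ 0 b f n m
    same zero n m = ≡.refl
    same (suc b) n zero = ≡.refl
    same (suc b) n (suc m) = same b n m
    go : ∀ a n m → ℚ[[w]][[q]].conv (mono a b) f n m ≡ shift 0ℚ a b f n m
    go zero zero m = ≡.trans (w-shift b (f 0) 0 m) (same b 0 m)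
    go zero (suc n) m = ≡.trans (cong₂ ℚ._+_ (≡.trans (w-shift b (f (suc n)) (suc n) m) (same b (suc n) m))
      (ℚ[[q,w]].zeroˡ f n m)) (ℚ.+-identityʳ _)
    go (suc a) zero m = ℚ[[w]].conv-zeroˡ (f 0) m
    go (suc a) (suc n) m = ≡.trans (cong₂ ℚ._+_ (ℚ[[w]].conv-zeroˡ (f (suc n)) m) (go a n m)) (ℚ.+-identityˡ _)

  mono-mono : ∀ a b c d → mono (a + c) (b + d) ≈ mono a b ⊡ mono c d
  mono-mono a b c d = pointwise λ n m → ≡.sym (≡.trans (mono-⊡ a b (mono c d) n m) (go a b n m))
    where
    go : ∀ a b n m → shift 0ℚ a b (mono c d) n m ≡ mono (a + c) (b + d) n m
    go zero zero n m = ≡.refl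
    go zero (suc b) n zero with n ℕ.≡ᵇ c
    ... | true = ≡.refl
    ... | false = ≡.refl
    go zero (suc b) n (suc m) = go zero b n m
    go (suc a) b zero m = ≡.refl
    go (suc a) b (suc n) m = go a b n m

  mono-𝟙 : mono 0 0 ≈ 𝟙
  mono-𝟙 = pointwise λ { zero zero → ≡.refl ; zero (suc m) → ≡.refl ; (suc n) m → ≡.refl }

  Order≥-mono : ∀ a b → Order≥ a (mono a b)
  Order≥-mono a b = vanishing (go a)
    where
    go : ∀ a n m → n < a → mono a b n m ≡ 0ℚ
    go (suc a) zero m _ = ≡.refl
    go (suc a) (suc n) m (s≤s n<a) = go a n m n<a

qp-suc : ∀ k → qp (suc k) ≈ q ⊡ qp k
qp-suc k = mono-mono 1 0 k 0

qp-↑ : ∀ k → qp k ≈ q ↑ k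
qp-↑ zero = mono-𝟙
qp-↑ (suc k) = trans (qp-suc k) (⊡-congˡ (qp-↑ k))

nℚ-+ : ∀ a b → nℚ (a + b) ≡ nℚ a ℚ.+ nℚ b
nℚ-+ a b = fromℤ-+ (ℤ.+ a) (ℤ.+ b)

nℚ-* : ∀ a b → nℚ (a * b) ≡ nℚ a ℚ.* nℚ b
nℚ-* a b = ≡.trans (cong fromℤ (ℤ.pos-* a b)) (fromℤ-* (ℤ.+ a) (ℤ.+ b))

#_ : ℕ → FPS
# n = const (nℚ n)

#-+ : ∀ a b → # (a + b) ≈ # a ⊞ # b
#-+ a b = trans (const-cong (nℚ-+ a b)) (const-+ (nℚ a) (nℚ b))

#-* : ∀ a b → # (a * b) ≈ # a ⊡ # b
#-* a b = trans (const-cong (nℚ-* a b)) (const-* (nℚ a) (nℚ b))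

-- The binomial coefficient m(m-1)/2: the coefficient of (s-1)² in s^m, and the number of pairs of a
-- gap and a position in which a simplex column of m + 1 cells meets both components of a duplex
-- column.
tri : ℕ → ℕ
tri zero = 0
tri (suc m) = m + tri m

-- overlaps k l = Σ_{g ≥ 1} (k ∸ g) (l ∸ g)
overlaps : ℕ → ℕ → ℕ
overlaps zero l = 0
overlaps (suc k) zero = 0
overlaps (suc k) (suc l) = k * l + overlaps k l

natᴶ : ℕ → Jet
natᴶ n = scalar (# n)

natᴶ-+ : ∀ a b → natᴶ (a + b) ≈ᴶ natᴶ a ⊞ᴶ natᴶ b
natᴶ-+ a b = 𝕁.trans (scalar-cong (#-+ a b)) (scalar-⊞ _ _)

natᴶ-* : ∀ a b → natᴶ (a * b) ≈ᴶ natᴶ a ⊡ᴶ natᴶ b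
natᴶ-* a b = 𝕁.trans (scalar-cong (#-* a b)) (scalar-⊡ _ _)

natᴶ-0 : natᴶ 0 ≈ᴶ 𝟘ᴶ
natᴶ-0 = 𝕁.trans (scalar-cong const-0) scalar-𝟘

natᴶ-1 : natᴶ 1 ≈ᴶ 𝟙ᴶ
natᴶ-1 = 𝕁.trans (scalar-cong const-1) scalar-𝟙

natᴶ-suc : ∀ n → natᴶ (suc n) ≈ᴶ 𝟙ᴶ ⊞ᴶ natᴶ n
natᴶ-suc n = 𝕁.trans (natᴶ-+ 1 n) (𝕁.+-congʳ natᴶ-1)

-- For reasoning modulo a relation s = 0: the solver checks a polynomial identity in which the
-- multiple r of the relation is written out.
≈-modulo : ∀ {a b r s} → a ≈ᴶ b ⊞ᴶ r ⊡ᴶ s → s ≈ᴶ 𝟘ᴶ → a ≈ᴶ b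
≈-modulo {b = b} {r} eq s≈0 = 𝕁.trans eq
  (𝕁.trans (𝕁.+-congˡ (𝕁.trans (𝕁.*-congˡ s≈0) (𝕁.zeroʳ r))) (𝕁.+-identityʳ b))

≈-difference : ∀ {a b} → a ≈ᴶ b → a ⊞ᴶ ⊟ᴶ b ≈ᴶ 𝟘ᴶ
≈-difference {a} {b} a≈b = 𝕁.trans (𝕁.+-congʳ a≈b) (𝕁.-‿inverseʳ b)

Q : Jet
Q = scalar q

Order≥ᴶ-Q : Order≥ᴶ 1 Q
Order≥ᴶ-Q = Order≥ᴶ-scalar (Order≥-mono 1 0)

Order≥ᴶ-↑ : ∀ {x} → Order≥ᴶ 1 x → ∀ m → Order≥ᴶ m (x ↑ᴶ m)
Order≥ᴶ-↑ o zero = Order≥ᴶ-0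
Order≥ᴶ-↑ o (suc m) = Order≥ᴶ-⊡ o (Order≥ᴶ-↑ o m)

scalar-↑ : ∀ f m → scalar (f ↑ m) ≈ᴶ scalar f ↑ᴶ m
scalar-↑ f zero = scalar-𝟙
scalar-↑ f (suc m) = 𝕁.trans (scalar-⊡ f (f ↑ m)) (𝕁.*-congˡ (scalar-↑ f m))

↑ᴶ-distrib : ∀ x y m → (x ⊡ᴶ y) ↑ᴶ m ≈ᴶ x ↑ᴶ m ⊡ᴶ y ↑ᴶ m
↑ᴶ-distrib x y zero = 𝕁.sym (𝕁.*-identityˡ 𝟙ᴶ)
↑ᴶ-distrib x y (suc m) = 𝕁.trans (𝕁.*-congˡ (↑ᴶ-distrib x y m))
  (solve 4 (λ x y a b → x :* y :* (a :* b) := x :* a :* (y :* b)) 𝕁.refl x y (x ↑ᴶ m) (y ↑ᴶ m))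
  where open JetSolver

↑ᴶ-cong : ∀ {x y} m → x ≈ᴶ y → x ↑ᴶ m ≈ᴶ y ↑ᴶ m
↑ᴶ-cong zero x≈y = 𝕁.refl
↑ᴶ-cong (suc m) x≈y = 𝕁.*-cong x≈y (↑ᴶ-cong m x≈y)

-- Generating functions in a jet variable x

module Generating (x : Jet) (o : Order≥ᴶ 1 x) where
  open SetoidReasoning 𝕁.setoid
  open JetSolver

  private
    order : ∀ (a : ℕ → Jet) m → Order≥ᴶ m (a m ⊡ᴶ x ↑ᴶ m)
    order a m = Order≥ᴶ-⊡ (Order≥ᴶ-0 {a m}) (Order≥ᴶ-↑ o m)

  gen : (ℕ → Jet) → Jet
  gen a = ∑ᴶ (λ m → a m ⊡ᴶ x ↑ᴶ m)

  gen-cong : ∀ {a b} → (∀ m → a m ≈ᴶ b m) → gen a ≈ᴶ gen b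
  gen-cong a≈b = ∑ᴶ-cong (λ m → 𝕁.*-congʳ (a≈b m))

  gen-⊞ : ∀ a b → gen (λ m → a m ⊞ᴶ b m) ≈ᴶ gen a ⊞ᴶ gen b
  gen-⊞ a b = 𝕁.trans (∑ᴶ-cong (λ m → 𝕁.distribʳ (x ↑ᴶ m) (a m) (b m))) (∑ᴶ-⊞ _ _)

  gen-⊡ : ∀ c a → gen (λ m → c ⊡ᴶ a m) ≈ᴶ c ⊡ᴶ gen a
  gen-⊡ c a = 𝕁.trans (∑ᴶ-cong (λ m → 𝕁.*-assoc c (a m) (x ↑ᴶ m))) (𝕁.sym (∑ᴶ-⊡ c (order a)))

  gen-suc : ∀ a → gen a ≈ᴶ a 0 ⊞ᴶ x ⊡ᴶ gen (a ∘ suc)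
  gen-suc a = begin
    gen a ≈⟨ ∑ᴶ-head (order a) ⟩
    a 0 ⊡ᴶ 𝟙ᴶ ⊞ᴶ ∑ᴶ (λ m → a (suc m) ⊡ᴶ (x ⊡ᴶ x ↑ᴶ m)) ≈⟨ 𝕁.+-cong (𝕁.*-identityʳ (a 0))
      (∑ᴶ-cong (λ m → solve 3 (λ a x y → a :* (x :* y) := x :* (a :* y)) 𝕁.refl (a (suc m)) x (x ↑ᴶ m))) ⟩
    a 0 ⊞ᴶ ∑ᴶ (λ m → x ⊡ᴶ (a (suc m) ⊡ᴶ x ↑ᴶ m)) ≈⟨ 𝕁.+-congˡ (∑ᴶ-⊡ x (order (a ∘ suc))) ⟨
    a 0 ⊞ᴶ x ⊡ᴶ gen (a ∘ suc) ∎

  -- With e = 1/(1-x) these are e, x e² and x² e³.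
  gen₀ gen₁ gen₂ : Jet
  gen₀ = gen (λ _ → 𝟙ᴶ)
  gen₁ = gen natᴶ
  gen₂ = gen (natᴶ ∘ tri)

  gen₀-equation : gen₀ ≈ᴶ 𝟙ᴶ ⊞ᴶ x ⊡ᴶ gen₀
  gen₀-equation = gen-suc (λ _ → 𝟙ᴶ)

  geometric : gen₀ ⊞ᴶ ⊟ᴶ (𝟙ᴶ ⊞ᴶ x ⊡ᴶ gen₀) ≈ᴶ 𝟘ᴶ
  geometric = ≈-difference gen₀-equation

  private
    -- The hypothesis is y (1-x) = x z; multiply by `gen₀` = 1/(1-x).
    resolve : ∀ {y z} → y ≈ᴶ x ⊡ᴶ (z ⊞ᴶ y) → y ≈ᴶ x ⊡ᴶ gen₀ ⊡ᴶ z
    resolve {y} {z} eq = ≈-modulo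
      (≈-modulo
        (solve 4 (λ y z e x → y := x :* e :* z :+ (:- y) :* (e :- (lit 1 :+ x :* e)) :+ e :* (y :- x :* (z :+ y)))
          𝕁.refl y z gen₀ x)
        (≈-difference eq))
      -- The solver's literal 1 denotes `natᴶ 1` and has to be traded for `𝟙ᴶ`.
      (𝕁.trans (𝕁.+-congˡ (𝕁.-‿cong (𝕁.+-congʳ natᴶ-1))) geometric)

  gen₁-closed : gen₁ ≈ᴶ x ⊡ᴶ gen₀ ⊡ᴶ gen₀
  gen₁-closed = resolve (begin
    gen₁ ≈⟨ gen-suc natᴶ ⟩
    natᴶ 0 ⊞ᴶ x ⊡ᴶ gen (natᴶ ∘ suc) ≈⟨ 𝕁.+-cong natᴶ-0 (𝕁.*-congˡ (𝕁.trans (gen-cong natᴶ-suc) (gen-⊞ _ _))) ⟩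
    𝟘ᴶ ⊞ᴶ x ⊡ᴶ (gen₀ ⊞ᴶ gen₁) ≈⟨ 𝕁.+-identityˡ _ ⟩
    x ⊡ᴶ (gen₀ ⊞ᴶ gen₁) ∎)

  gen₂-closed : gen₂ ≈ᴶ x ⊡ᴶ gen₀ ⊡ᴶ gen₁
  gen₂-closed = resolve (begin
    gen₂ ≈⟨ gen-suc (natᴶ ∘ tri) ⟩
    natᴶ 0 ⊞ᴶ x ⊡ᴶ gen (λ m → natᴶ (m + tri m))
      ≈⟨ 𝕁.+-cong natᴶ-0 (𝕁.*-congˡ (𝕁.trans (gen-cong (λ m → natᴶ-+ m (tri m))) (gen-⊞ _ _))) ⟩
    𝟘ᴶ ⊞ᴶ x ⊡ᴶ (gen₁ ⊞ᴶ gen₂) ≈⟨ 𝕁.+-identityˡ _ ⟩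
    x ⊡ᴶ (gen₁ ⊞ᴶ gen₂) ∎)

  -- Write e for `gen₀` and G(k) for the left side. The recursion of `overlaps` becomes G(k+1) = x
  -- (k x e² + G(k)), and induction gives G(k) = x² (k e³ - (1 - x^k) e⁴). The summand with x^k
  -- later brings F(x) into the functional equation.
  gen-overlaps : ∀ k → gen (natᴶ ∘ overlaps k) ≈ᴶ
    x ↑ᴶ 2 ⊡ᴶ (natᴶ k ⊡ᴶ gen₀ ↑ᴶ 3 ⊞ᴶ (⊟ᴶ gen₀ ↑ᴶ 4 ⊞ᴶ gen₀ ↑ᴶ 4 ⊡ᴶ x ↑ᴶ k))
  gen-overlaps zero = begin
    gen (λ _ → natᴶ 0) ≈⟨ gen-cong (λ _ → 𝕁.trans natᴶ-0 (𝕁.sym (𝕁.zeroˡ 𝟙ᴶ))) ⟩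
    gen (λ _ → 𝟘ᴶ ⊡ᴶ 𝟙ᴶ) ≈⟨ gen-⊡ 𝟘ᴶ (λ _ → 𝟙ᴶ) ⟩
    𝟘ᴶ ⊡ᴶ gen₀ ≈⟨ 𝕁.*-congʳ natᴶ-0 ⟨
    natᴶ 0 ⊡ᴶ gen₀ ≈⟨ solve 3 (λ x e o → lit 0 :* e :=
        x :^ 2 :* (lit 0 :* e :^ 3 :+ (:- e :^ 4 :+ e :^ 4 :* lit 1))) 𝕁.refl x gen₀ 𝟙ᴶ ⟩
    x ↑ᴶ 2 ⊡ᴶ (natᴶ 0 ⊡ᴶ gen₀ ↑ᴶ 3 ⊞ᴶ (⊟ᴶ gen₀ ↑ᴶ 4 ⊞ᴶ gen₀ ↑ᴶ 4 ⊡ᴶ natᴶ 1))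
      ≈⟨ 𝕁.*-congˡ (𝕁.+-congˡ (𝕁.+-congˡ (𝕁.*-congˡ natᴶ-1))) ⟩
    x ↑ᴶ 2 ⊡ᴶ (natᴶ 0 ⊡ᴶ gen₀ ↑ᴶ 3 ⊞ᴶ (⊟ᴶ gen₀ ↑ᴶ 4 ⊞ᴶ gen₀ ↑ᴶ 4 ⊡ᴶ x ↑ᴶ 0)) ∎
  gen-overlaps (suc k) = begin
    gen (natᴶ ∘ overlaps (suc k)) ≈⟨ gen-suc _ ⟩
    natᴶ 0 ⊞ᴶ x ⊡ᴶ gen (λ l → natᴶ (k * l + overlaps k l)) ≈⟨ 𝕁.+-cong natᴶ-0 (𝕁.*-congˡ
      (𝕁.trans (gen-cong (λ l → 𝕁.trans (natᴶ-+ (k * l) (overlaps k l)) (𝕁.+-congʳ (natᴶ-* k l))))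
        (𝕁.trans (gen-⊞ _ _) (𝕁.+-congʳ (gen-⊡ (natᴶ k) natᴶ))))) ⟩
    𝟘ᴶ ⊞ᴶ x ⊡ᴶ (natᴶ k ⊡ᴶ gen₁ ⊞ᴶ gen (natᴶ ∘ overlaps k)) ≈⟨ 𝕁.+-identityˡ _ ⟩
    x ⊡ᴶ (natᴶ k ⊡ᴶ gen₁ ⊞ᴶ gen (natᴶ ∘ overlaps k))
      ≈⟨ 𝕁.*-congˡ (𝕁.+-cong (𝕁.*-congˡ gen₁-closed) (gen-overlaps k)) ⟩
    x ⊡ᴶ (natᴶ k ⊡ᴶ (x ⊡ᴶ gen₀ ⊡ᴶ gen₀) ⊞ᴶ
      x ↑ᴶ 2 ⊡ᴶ (natᴶ k ⊡ᴶ gen₀ ↑ᴶ 3 ⊞ᴶ (⊟ᴶ gen₀ ↑ᴶ 4 ⊞ᴶ gen₀ ↑ᴶ 4 ⊡ᴶ x ↑ᴶ k)))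
      ≈⟨ ≈-modulo (solve 4 (λ x e k y →
           x :* (k :* (x :* e :* e) :+ x :^ 2 :* (k :* e :^ 3 :+ (:- e :^ 4 :+ e :^ 4 :* y))) :=
           x :^ 2 :* ((lit 1 :+ k) :* e :^ 3 :+ (:- e :^ 4 :+ e :^ 4 :* (x :* y)))
             :+ (x :^ 2 :* e :^ 3 :- x :^ 2 :* k :* e :^ 2) :* (e :- (lit 1 :+ x :* e)))
           𝕁.refl x gen₀ (natᴶ k) (x ↑ᴶ k))
         (𝕁.trans (𝕁.+-congˡ (𝕁.-‿cong (𝕁.+-congʳ natᴶ-1))) geometric) ⟩
    x ↑ᴶ 2 ⊡ᴶ ((natᴶ 1 ⊞ᴶ natᴶ k) ⊡ᴶ gen₀ ↑ᴶ 3 ⊞ᴶ (⊟ᴶ gen₀ ↑ᴶ 4 ⊞ᴶ gen₀ ↑ᴶ 4 ⊡ᴶ (x ⊡ᴶ x ↑ᴶ k)))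
      ≈⟨ 𝕁.*-congˡ (𝕁.+-congʳ (𝕁.*-congʳ (natᴶ-+ 1 k))) ⟨
    x ↑ᴶ 2 ⊡ᴶ (natᴶ (suc k) ⊡ᴶ gen₀ ↑ᴶ 3 ⊞ᴶ (⊟ᴶ gen₀ ↑ᴶ 4 ⊞ᴶ gen₀ ↑ᴶ 4 ⊡ᴶ x ↑ᴶ suc k)) ∎

-- The jets of q^i s and of 1/(1 - q^i s) at s = 1

z₀ : Jet
z₀ = jet 𝟙 𝟙 𝟘

-- `z₀` is the variable s = 1 + e itself, and `zᵢ i` is q^i s, the argument of F after i iterations.
zᵢ : ℕ → Jet
zᵢ i = Q ↑ᴶ i ⊡ᴶ z₀

half : FPS
half = const ½

2half≈1 : # 2 ⊡ half ≈ # 1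
2half≈1 = sym (const-* (nℚ 2) ½)

-- The counterpart of `≈-modulo` for series. The relation s = t is mostly v = 1 + q v, that is v =
-- 1/(1-q).
vanishing-multiple : ∀ {a b r s t} → a ≈ b ⊞ r ⊡ (s ⊞ ⊟ t) → s ≈ t → a ≈ b
vanishing-multiple {b = b} {r} {s} {t} eq s≈t = trans eq
  (trans (⊞-congˡ (⊡-congˡ (⊞-congʳ s≈t))) (solve 3 (λ b r t → b :+ r :* (t :- t) := b) refl b r t))
  where open Solver

-- The jet with value f whose logarithm has first and second derivatives l and m:
-- products of such jets add up l and m.
logjet : FPS → FPS → FPS → Jet
logjet f l m = jet f (f ⊡ l) (half ⊡ (f ⊡ (l ↑ 2 ⊞ m)))

logjet-cong : ∀ {f f′ l l′ m m′} → f ≈ f′ → l ≈ l′ → m ≈ m′ → logjet f l m ≈ᴶ logjet f′ l′ m′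
logjet-cong f≈ l≈ m≈ = jet≈ f≈ (⊡-cong f≈ l≈)
  (⊡-congˡ (⊡-cong f≈ (⊞-cong (⊡-cong l≈ (⊡-congʳ l≈)) m≈)))

opaque
  unfolding _⊞ᴶ_

  -- The product rule yields the cross term l l′, which on the right appears as half of 2 l l′;
  -- hence the appeal to 2 · 1/2 = 1.
  logjet-⊡ : ∀ {x y f l m f′ l′ m′} → x ≈ᴶ logjet f l m → y ≈ᴶ logjet f′ l′ m′ →
             x ⊡ᴶ y ≈ᴶ logjet (f ⊡ f′) (l ⊞ l′) (m ⊞ m′)
  logjet-⊡ {f = f} {l} {m} {f′} {l′} {m′} x≈ y≈ = 𝕁.trans (𝕁.*-cong x≈ y≈) (jet≈ refl
    (solve 4 (λ f l f′ l′ → f :* (f′ :* l′) :+ f :* l :* f′ := f :* f′ :* (l :+ l′)) refl f l f′ l′)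
    (vanishing-multiple
      (solve 7 (λ f l m f′ l′ m′ h →
        f :* (h :* (f′ :* (l′ :^ 2 :+ m′))) :+ f :* l :* (f′ :* l′) :+ h :* (f :* (l :^ 2 :+ m)) :* f′ :=
        h :* (f :* f′ :* ((l :+ l′) :^ 2 :+ (m :+ m′)))
          :+ (:- (f :* f′ :* l :* l′)) :* (lit 2 :* h :- lit 1))
        refl f l m f′ l′ m′ half)
      2half≈1))
    where open Solver

  logjet-scalar : ∀ f → scalar f ≈ᴶ logjet f (# 0) (# 0)
  logjet-scalar f = jet≈ refl
    (trans (sym const-0) (solve 1 (λ f → lit 0 := f :* lit 0) refl f))
    (trans (sym const-0) (solve 2 (λ f h → lit 0 := h :* (f :* (lit 0 :^ 2 :+ lit 0))) refl f half))
    where open Solver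

  -- log s has derivatives 1 and -1 at s = 1. Through the squares of `zᵢ` in `Π` they produce the
  -- summands 2i - 2 of L and -2i + 2 of M.
  logjet-z₀ : z₀ ≈ᴶ logjet (# 1) (# 1) (⊟ # 1)
  logjet-z₀ = jet≈ (sym const-1)
    (trans (sym const-1) (solve 0 (lit 1 := lit 1 :* lit 1) refl))
    (trans (sym const-0) (solve 1 (λ h → lit 0 := h :* (lit 1 :* (lit 1 :^ 2 :+ (:- lit 1)))) refl half))
    where open Solver

  -- The function -log(1 - t s) has derivatives t/(1 - t s) and its square; at s = 1, with v =
  -- 1/(1-t), these are t v and (t v)². They become the summands of `Σᵢ` and `Σ'ᵢ`.
  jet-inverse : ∀ t v → v ≈ # 1 ⊞ t ⊡ v → let e = logjet v (t ⊡ v) ((t ⊡ v) ↑ 2) in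
                e ≈ᴶ 𝟙ᴶ ⊞ᴶ (scalar t ⊡ᴶ z₀) ⊡ᴶ e
  jet-inverse t v eq = 𝕁.sym (𝕁.trans (𝕁.+-cong (scalar-cong (sym const-1)) (𝕁.*-congʳ tz₀)) (𝕁.sym (jet≈
    eq
    (trans
      (vanishing-multiple
        (solve 2 (λ t v → v :* (t :* v) :=
          lit 0 :+ (t :* (v :* (t :* v)) :+ t :* v) :+ t :* v :* (v :- (lit 1 :+ t :* v))) refl t v)
        eq)
      (⊞-congʳ const-0))
    (trans
      (vanishing-multiple
        (vanishing-multiple
          (solve 3 (λ t v h → h :* (v :* ((t :* v) :^ 2 :+ (t :* v) :^ 2)) :=
            lit 0 :+ (t :* (h :* (v :* ((t :* v) :^ 2 :+ (t :* v) :^ 2))) :+ t :* (v :* (t :* v)) :+ lit 0 :* v)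
              :+ (h :* lit 2 :* (t :* v) :^ 2) :* (v :- (lit 1 :+ t :* v))
              :+ (t :* v) :^ 2 :* (lit 2 :* h :- lit 1)) refl t v half)
          2half≈1)
        eq)
      (⊞-congʳ const-0)))))
    where
    open Solver
    tz₀ : scalar t ⊡ᴶ z₀ ≈ᴶ jet t t (# 0)
    tz₀ = jet≈ (⊡-identityʳ t)
      (trans (⊞-cong (⊡-identityʳ t) (zeroˡ 𝟙)) (⊞-identityʳ t))
      (trans (⊞-cong (trans (⊞-cong (zeroʳ t) (zeroˡ 𝟙)) (⊞-identityʳ 𝟘)) (zeroˡ 𝟙)) (trans (⊞-identityʳ 𝟘) (sym const-0)))

logjet-↑ : ∀ {x f l m} → x ≈ᴶ logjet f l m → ∀ n → x ↑ᴶ n ≈ᴶ logjet (f ↑ n) (# n ⊡ l) (# n ⊡ m)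
logjet-↑ {f = f} {l} {m} x≈ zero = 𝕁.trans (𝕁.sym scalar-𝟙) (𝕁.trans (logjet-scalar 𝟙)
  (logjet-cong refl (times0 l) (times0 m)))
  where
  open Solver
  times0 : ∀ l → # 0 ≈ # 0 ⊡ l
  times0 = solve 1 (λ l → lit 0 := lit 0 :* l) refl
logjet-↑ {f = f} {l} {m} x≈ (suc n) = 𝕁.trans (logjet-⊡ x≈ (logjet-↑ x≈ n))
  (logjet-cong refl (times-suc l) (times-suc m))
  where
  open Solver
  times-suc : ∀ l → l ⊞ # n ⊡ l ≈ # suc n ⊡ l
  times-suc l = trans (solve 2 (λ n l → l :+ n :* l := (lit 1 :+ n) :* l) refl (# n) l)
    (⊡-congʳ (sym (#-+ 1 n)))

v : ℕ → FPS
v k = (𝟙 ⊞ ⊟ qp k) ⁻¹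

opaque
  unfolding _⊞_

  1-qp-const : ∀ k → (𝟙 ⊞ ⊟ qp (suc k)) 0 0 ≡ 1ℚ
  1-qp-const k = ≡.refl

  minus3≈ : minus3 ≈ ⊟ # 3
  minus3≈ = const-neg (nℚ 3)

v-inverse : ∀ k → (𝟙 ⊞ ⊟ qp (suc k)) ⊡ v (suc k) ≈ 𝟙
v-inverse k = ⁻¹-inverse (𝟙 ⊞ ⊟ qp (suc k)) (1-qp-const k)

v-equation : ∀ k → v (suc k) ≈ # 1 ⊞ qp (suc k) ⊡ v (suc k)
v-equation k = begin
  v (suc k) ≈⟨ ⊡-identityˡ _ ⟨
  𝟙 ⊡ v (suc k) ≈⟨ solve 3 (λ o t v → o :* v := (o :- t) :* v :+ t :* v) refl 𝟙 (qp (suc k)) (v (suc k)) ⟩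
  (𝟙 ⊞ ⊟ qp (suc k)) ⊡ v (suc k) ⊞ qp (suc k) ⊡ v (suc k) ≈⟨ ⊞-congʳ (trans (v-inverse k) (sym const-1)) ⟩
  # 1 ⊞ qp (suc k) ⊡ v (suc k) ∎
  where
  open SetoidReasoning setoid
  open Solver

-- The jet of 1/(1 - q^(i+1) s) at s = 1.
eᵢ : ℕ → Jet
eᵢ i = logjet (v (suc i)) (qp (suc i) ⊡ v (suc i)) ((qp (suc i) ⊡ v (suc i)) ↑ 2)

scalar-qp : ∀ i → scalar (qp i) ≈ᴶ Q ↑ᴶ i
scalar-qp i = 𝕁.trans (scalar-cong (qp-↑ i)) (scalar-↑ q i)

eᵢ-equation : ∀ i → eᵢ i ≈ᴶ 𝟙ᴶ ⊞ᴶ zᵢ (suc i) ⊡ᴶ eᵢ i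
eᵢ-equation i = 𝕁.trans (jet-inverse (qp (suc i)) (v (suc i)) (v-equation i))
  (𝕁.+-congˡ (𝕁.*-congʳ (𝕁.*-congʳ (scalar-qp (suc i)))))

-- The weight q²w/(1-q)² of a duplex column, summed over the sizes of its components.
p : FPS
p = qp 2 ⊡ w ⊡ v 1 ↑ 2

logjet-zᵢ : ∀ i → zᵢ i ≈ᴶ logjet (qp i) (# 1) (⊟ # 1)
logjet-zᵢ i = 𝕁.trans (logjet-⊡ (𝕁.trans (𝕁.sym (scalar-qp i)) (logjet-scalar (qp i))) logjet-z₀)
  (logjet-cong (solve 1 (λ t → t :* lit 1 := t) refl (qp i))
    (solve 0 (lit 0 :+ lit 1 := lit 1) refl)
    (solve 0 (lit 0 :+ (:- lit 1) := :- lit 1) refl))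
  where open Solver

P : Jet
P = scalar p

-- Π i = ∏_{k ≤ i} (-3 p q z_k² e_k⁴); the index of eᵢ is shifted by one.
Π : ℕ → Jet
Π zero = 𝟙ᴶ
Π (suc i) = Π i ⊡ᴶ (⊟ᴶ natᴶ 3 ⊡ᴶ P ⊡ᴶ Q ⊡ᴶ zᵢ (suc i) ↑ᴶ 2 ⊡ᴶ eᵢ i ↑ᴶ 4)

Π-order : ∀ i → Order≥ᴶ i (Π i)
Π-order zero = Order≥ᴶ-0
Π-order (suc i) = Order≥ᴶ-resp
  (solve 5 (λ y p q z e → q :* y :* ((:- lit 3) :* p :* z :* e) := y :* ((:- lit 3) :* p :* q :* z :* e))
    𝕁.refl (Π i) P Q (zᵢ (suc i) ↑ᴶ 2) (eᵢ i ↑ᴶ 4))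
  (Order≥ᴶ-weaken (ℕ.m≤m+n (suc i) 0) (Order≥ᴶ-⊡ (Order≥ᴶ-⊡ Order≥ᴶ-Q (Π-order i)) Order≥ᴶ-0))
  where open JetSolver

-- The four kinds of terms left behind by the i-th iteration. Summed over i they are the jets (α, ε,
-- ι), (β, ζ, κ), (γ, η, λ) and (δ, θ, μ).
aᵢ bᵢ cᵢ dᵢ : ℕ → Jet
aᵢ i = Π i ⊡ᴶ (Q ⊡ᴶ eᵢ i)
bᵢ i = Π i ⊡ᴶ (Q ⊡ᴶ eᵢ i ↑ᴶ 2)
cᵢ i = Π i ⊡ᴶ (Q ⊡ᴶ P ⊡ᴶ zᵢ (suc i) ↑ᴶ 2 ⊡ᴶ eᵢ i ↑ᴶ 3)
dᵢ i = Π i ⊡ᴶ (⊟ᴶ natᴶ 3 ⊡ᴶ Q ⊡ᴶ P ⊡ᴶ zᵢ (suc i) ↑ᴶ 2 ⊡ᴶ eᵢ i ↑ᴶ 4)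

-- The functional equation

-- f m is the generating function for a first column of m + 1 cells.
module FunctionalEquation
  (f : ℕ → FPS) (f-order : ∀ m → Order≥ m (f m)) (c₀′ c₁′ c₂′ : FPS)
  (recursion : ∀ m → f m ≈ qp (suc m) ⊡
    (c₀′ ⊞ c₁′ ⊡ # m ⊞ p ⊡ c₂′ ⊡ # tri m ⊞ ⊟ (# 3 ⊡ p ⊡ ∑ (λ k → f k ⊡ # overlaps k m))))
  where
  open SetoidReasoning 𝕁.setoid
  open JetSolver

  weighted : (ℕ → Jet) → Jet
  weighted a = ∑ᴶ (λ k → scalar (f k) ⊡ᴶ a k)

  private
    order : ∀ (a : ℕ → Jet) m → Order≥ᴶ m (scalar (f m) ⊡ᴶ a m)
    order a m = Order≥ᴶ-weaken (ℕ.m≤m+n m 0) (Order≥ᴶ-⊡ (Order≥ᴶ-scalar (f-order m)) (Order≥ᴶ-0 {a m}))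

  weighted-cong : ∀ {a b} → (∀ k → a k ≈ᴶ b k) → weighted a ≈ᴶ weighted b
  weighted-cong a≈b = ∑ᴶ-cong (λ k → 𝕁.*-congˡ (a≈b k))

  weighted-⊞ : ∀ a b → weighted (λ k → a k ⊞ᴶ b k) ≈ᴶ weighted a ⊞ᴶ weighted b
  weighted-⊞ a b = 𝕁.trans (∑ᴶ-cong (λ k → 𝕁.distribˡ (scalar (f k)) (a k) (b k))) (∑ᴶ-⊞ _ _)

  weighted-⊡ : ∀ c a → weighted (λ k → c ⊡ᴶ a k) ≈ᴶ c ⊡ᴶ weighted a
  weighted-⊡ c a = 𝕁.trans
    (∑ᴶ-cong (λ k → solve 3 (λ f c a → f :* (c :* a) := c :* (f :* a)) 𝕁.refl (scalar (f k)) c (a k)))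
    (𝕁.sym (∑ᴶ-⊡ c (order a)))

  A B : FPS
  A = ∑ (λ k → f k ⊡ # 1)
  B = ∑ (λ k → f k ⊡ # k)

  weighted-scalar : ∀ (a : ℕ → ℕ) → weighted (natᴶ ∘ a) ≈ᴶ scalar (∑ (λ k → f k ⊡ # a k))
  weighted-scalar a = 𝕁.sym (𝕁.trans (scalar-∑ _) (∑ᴶ-cong (λ k → scalar-⊡ (f k) (# a k))))

  F : Jet → Jet
  F z = weighted (z ↑ᴶ_)

  -- Here x = q z and e = 1/(1-x). The recursion times z^m is summed over m: q^(m+1) z^m = q x^m,
  -- the coefficients 1, m and binom(m,2) give e, x e² and x² e³, and in the gap sum, expanded by
  -- `gen-overlaps`, the terms k, 1 and x^k sum to B, A and F(x).
  functional-equation : ∀ z x e → x ≈ᴶ Q ⊡ᴶ z → e ≈ᴶ 𝟙ᴶ ⊞ᴶ x ⊡ᴶ e → F z ≈ᴶ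
    Q ⊡ᴶ (scalar c₀′ ⊡ᴶ e ⊞ᴶ scalar c₁′ ⊡ᴶ (x ⊡ᴶ e ⊡ᴶ e) ⊞ᴶ P ⊡ᴶ scalar c₂′ ⊡ᴶ (x ⊡ᴶ e ⊡ᴶ (x ⊡ᴶ e ⊡ᴶ e))
      ⊞ᴶ ⊟ᴶ (natᴶ 3 ⊡ᴶ P ⊡ᴶ (x ↑ᴶ 2 ⊡ᴶ (e ↑ᴶ 3 ⊡ᴶ scalar B ⊞ᴶ (⊟ᴶ e ↑ᴶ 4 ⊡ᴶ scalar A ⊞ᴶ e ↑ᴶ 4 ⊡ᴶ F x)))))
  functional-equation z x e x≈Qz e-eq = begin
    F z ≈⟨ ∑ᴶ-cong term ⟩
    ∑ᴶ (λ m → Q ⊡ᴶ weight m ⊡ᴶ x ↑ᴶ m) ≈⟨ gen-⊡ Q weight ⟩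
    Q ⊡ᴶ gen weight ≈⟨ 𝕁.*-congˡ split ⟩
    _ ≈⟨ 𝕁.*-congˡ (𝕁.+-cong (𝕁.+-cong (𝕁.+-cong (𝕁.*-congˡ gen₀≈e) (𝕁.*-congˡ gen₁≈))
           (𝕁.*-congˡ (𝕁.trans gen₂-closed (𝕁.*-cong (𝕁.*-congˡ gen₀≈e) gen₁≈))))
           (𝕁.-‿cong (𝕁.*-congˡ kernel))) ⟩
    _ ∎
    where
    x-order : Order≥ᴶ 1 x
    x-order = Order≥ᴶ-resp (𝕁.sym x≈Qz) (Order≥ᴶ-⊡ Order≥ᴶ-Q (Order≥ᴶ-0 {z}))

    open Generating x x-order

    gen₀≈e : gen₀ ≈ᴶ e
    gen₀≈e = Units.inverse-unique JetRing {𝟙ᴶ ⊞ᴶ ⊟ᴶ x} (inverse gen₀-equation) (inverse e-eq)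
      where
      inverse : ∀ {y} → y ≈ᴶ 𝟙ᴶ ⊞ᴶ x ⊡ᴶ y → (𝟙ᴶ ⊞ᴶ ⊟ᴶ x) ⊡ᴶ y ≈ᴶ 𝟙ᴶ
      inverse {y} eq = begin
        (𝟙ᴶ ⊞ᴶ ⊟ᴶ x) ⊡ᴶ y ≈⟨ 𝕁.trans (𝕁.distribʳ y 𝟙ᴶ (⊟ᴶ x)) (𝕁.+-congʳ (𝕁.*-identityˡ y)) ⟩
        y ⊞ᴶ ⊟ᴶ x ⊡ᴶ y ≈⟨ 𝕁.+-congʳ eq ⟩
        𝟙ᴶ ⊞ᴶ x ⊡ᴶ y ⊞ᴶ ⊟ᴶ x ⊡ᴶ y ≈⟨ solve 3 (λ o x y → o :+ x :* y :+ (:- x) :* y := o) 𝕁.refl 𝟙ᴶ x y ⟩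
        𝟙ᴶ ∎

    gen₁≈ : gen₁ ≈ᴶ x ⊡ᴶ e ⊡ᴶ e
    gen₁≈ = 𝕁.trans gen₁-closed (𝕁.*-cong (𝕁.*-congˡ gen₀≈e) gen₀≈e)

    corr : ℕ → FPS
    corr m = ∑ (λ k → f k ⊡ # overlaps k m)

    weight : ℕ → Jet
    weight m = scalar c₀′ ⊡ᴶ 𝟙ᴶ ⊞ᴶ scalar c₁′ ⊡ᴶ natᴶ m ⊞ᴶ P ⊡ᴶ scalar c₂′ ⊡ᴶ natᴶ (tri m)
      ⊞ᴶ ⊟ᴶ (natᴶ 3 ⊡ᴶ P) ⊡ᴶ scalar (corr m)

    scalar-weight : ∀ m → scalar (c₀′ ⊞ c₁′ ⊡ # m ⊞ p ⊡ c₂′ ⊡ # tri m ⊞ ⊟ (# 3 ⊡ p ⊡ corr m)) ≈ᴶ weight m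
    scalar-weight m = 𝕁.trans (scalar-⊞ _ _) (𝕁.+-cong
      (𝕁.trans (scalar-⊞ _ _) (𝕁.+-cong
        (𝕁.trans (scalar-⊞ _ _) (𝕁.+-cong (𝕁.sym (𝕁.*-identityʳ _)) (scalar-⊡ _ _)))
        (𝕁.trans (scalar-⊡ _ _) (𝕁.*-congʳ (scalar-⊡ p c₂′)))))
      (𝕁.trans (scalar-⊟ _) (𝕁.trans
        (𝕁.-‿cong (𝕁.trans (scalar-⊡ _ _) (𝕁.*-congʳ (scalar-⊡ _ _))))
        (solve 2 (λ a b → :- (a :* b) := (:- a) :* b) 𝕁.refl (natᴶ 3 ⊡ᴶ P) (scalar (corr m))))))

    term : ∀ m → scalar (f m) ⊡ᴶ z ↑ᴶ m ≈ᴶ Q ⊡ᴶ weight m ⊡ᴶ x ↑ᴶ m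
    term m = begin
      scalar (f m) ⊡ᴶ z ↑ᴶ m ≈⟨ 𝕁.*-congʳ (𝕁.trans (scalar-cong (recursion m)) (scalar-⊡ _ _)) ⟩
      scalar (qp (suc m)) ⊡ᴶ scalar _ ⊡ᴶ z ↑ᴶ m
        ≈⟨ 𝕁.*-congʳ (𝕁.*-cong (𝕁.trans (scalar-cong (qp-↑ (suc m))) (scalar-↑ q (suc m))) (scalar-weight m)) ⟩
      Q ⊡ᴶ Q ↑ᴶ m ⊡ᴶ weight m ⊡ᴶ z ↑ᴶ m
        ≈⟨ solve 4 (λ q r y s → q :* r :* y :* s := q :* y :* (r :* s)) 𝕁.refl Q (Q ↑ᴶ m) (weight m) (z ↑ᴶ m) ⟩
      Q ⊡ᴶ weight m ⊡ᴶ (Q ↑ᴶ m ⊡ᴶ z ↑ᴶ m) ≈⟨ 𝕁.*-congˡ (𝕁.trans (𝕁.sym (↑ᴶ-distrib Q z m)) (↑ᴶ-cong m (𝕁.sym x≈Qz))) ⟩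
      Q ⊡ᴶ weight m ⊡ᴶ x ↑ᴶ m ∎

    split : gen weight ≈ᴶ scalar c₀′ ⊡ᴶ gen₀ ⊞ᴶ scalar c₁′ ⊡ᴶ gen₁ ⊞ᴶ P ⊡ᴶ scalar c₂′ ⊡ᴶ gen₂
      ⊞ᴶ ⊟ᴶ (natᴶ 3 ⊡ᴶ P ⊡ᴶ gen (scalar ∘ corr))
    split = 𝕁.trans (gen-⊞ _ _) (𝕁.+-cong
      (𝕁.trans (gen-⊞ _ _) (𝕁.+-cong
        (𝕁.trans (gen-⊞ _ _) (𝕁.+-cong (gen-⊡ _ _) (gen-⊡ _ _)))
        (gen-⊡ _ _)))
      (𝕁.trans (gen-⊡ _ _)
        (solve 2 (λ a b → (:- a) :* b := :- (a :* b)) 𝕁.refl (natᴶ 3 ⊡ᴶ P) (gen (scalar ∘ corr)))))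

    kernel : gen (scalar ∘ corr) ≈ᴶ
      x ↑ᴶ 2 ⊡ᴶ (e ↑ᴶ 3 ⊡ᴶ scalar B ⊞ᴶ (⊟ᴶ e ↑ᴶ 4 ⊡ᴶ scalar A ⊞ᴶ e ↑ᴶ 4 ⊡ᴶ F x))
    kernel = begin
      ∑ᴶ (λ m → scalar (corr m) ⊡ᴶ x ↑ᴶ m) ≈⟨ ∑ᴶ-cong (λ m → 𝕁.trans (𝕁.*-congʳ (𝕁.sym (weighted-scalar (λ k → overlaps k m))))
          (𝕁.trans (𝕁.*-comm _ _) (𝕁.trans (∑ᴶ-⊡ (x ↑ᴶ m) (order (λ k → natᴶ (overlaps k m))))
            (∑ᴶ-cong (λ k → solve 3 (λ x f o → x :* (f :* o) := f :* (o :* x)) 𝕁.refl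
              (x ↑ᴶ m) (scalar (f k)) (natᴶ (overlaps k m))))))) ⟩
      -- With the sum over m moved inside, `gen-overlaps` applies for each k.
      ∑ᴶ (λ m → ∑ᴶ (λ k → scalar (f k) ⊡ᴶ (natᴶ (overlaps k m) ⊡ᴶ x ↑ᴶ m))) ≈⟨ ∑ᴶ-swap _ ⟩
      ∑ᴶ (λ k → ∑ᴶ (λ m → scalar (f k) ⊡ᴶ (natᴶ (overlaps k m) ⊡ᴶ x ↑ᴶ m)))
        ≈⟨ ∑ᴶ-cong (λ k → 𝕁.sym (∑ᴶ-⊡ (scalar (f k)) (λ m → Order≥ᴶ-⊡ (Order≥ᴶ-0 {natᴶ (overlaps k m)}) (Order≥ᴶ-↑ x-order m)))) ⟩
      weighted (λ k → gen (natᴶ ∘ overlaps k)) ≈⟨ weighted-cong (λ k → 𝕁.trans (gen-overlaps k) (rearrange k)) ⟩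
      weighted (λ k → x ↑ᴶ 2 ⊡ᴶ (gen₀ ↑ᴶ 3 ⊡ᴶ natᴶ k ⊞ᴶ (⊟ᴶ gen₀ ↑ᴶ 4 ⊡ᴶ natᴶ 1 ⊞ᴶ gen₀ ↑ᴶ 4 ⊡ᴶ x ↑ᴶ k)))
        ≈⟨ 𝕁.trans (weighted-⊡ _ _) (𝕁.*-congˡ (𝕁.trans (weighted-⊞ _ _) (𝕁.+-cong (weighted-⊡ _ _)
             (𝕁.trans (weighted-⊞ _ _) (𝕁.+-cong (weighted-⊡ _ _) (weighted-⊡ _ _)))))) ⟩
      x ↑ᴶ 2 ⊡ᴶ (gen₀ ↑ᴶ 3 ⊡ᴶ weighted natᴶ ⊞ᴶ (⊟ᴶ gen₀ ↑ᴶ 4 ⊡ᴶ weighted (λ _ → natᴶ 1) ⊞ᴶ gen₀ ↑ᴶ 4 ⊡ᴶ F x))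
        ≈⟨ 𝕁.*-congˡ (𝕁.+-cong (𝕁.*-cong (↑ᴶ-cong 3 gen₀≈e) (weighted-scalar (λ k → k)))
             (𝕁.+-cong (𝕁.*-cong (𝕁.-‿cong (↑ᴶ-cong 4 gen₀≈e)) (weighted-scalar (λ _ → 1))) (𝕁.*-congʳ (↑ᴶ-cong 4 gen₀≈e)))) ⟩
      x ↑ᴶ 2 ⊡ᴶ (e ↑ᴶ 3 ⊡ᴶ scalar B ⊞ᴶ (⊟ᴶ e ↑ᴶ 4 ⊡ᴶ scalar A ⊞ᴶ e ↑ᴶ 4 ⊡ᴶ F x)) ∎
      where
      rearrange : ∀ k → x ↑ᴶ 2 ⊡ᴶ (natᴶ k ⊡ᴶ gen₀ ↑ᴶ 3 ⊞ᴶ (⊟ᴶ gen₀ ↑ᴶ 4 ⊞ᴶ gen₀ ↑ᴶ 4 ⊡ᴶ x ↑ᴶ k)) ≈ᴶ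
        x ↑ᴶ 2 ⊡ᴶ (gen₀ ↑ᴶ 3 ⊡ᴶ natᴶ k ⊞ᴶ (⊟ᴶ gen₀ ↑ᴶ 4 ⊡ᴶ natᴶ 1 ⊞ᴶ gen₀ ↑ᴶ 4 ⊡ᴶ x ↑ᴶ k))
      rearrange k = solve 5 (λ x k a b y → x :* (k :* a :+ (:- b :+ b :* y)) :=
        x :* (a :* k :+ ((:- b) :* lit 1 :+ b :* y))) 𝕁.refl (x ↑ᴶ 2) (natᴶ k) (gen₀ ↑ᴶ 3) (gen₀ ↑ᴶ 4) (x ↑ᴶ k)

  -- Iterating the functional equation along z₀, q z₀, q² z₀, …
  iterated : F z₀ ≈ᴶ
    scalar (c₀′ ⊞ ⊟ c₁′) ⊡ᴶ ∑ᴶ aᵢ ⊞ᴶ scalar c₁′ ⊡ᴶ ∑ᴶ bᵢ ⊞ᴶ scalar (c₂′ ⊞ ⊟ (# 3 ⊡ B)) ⊡ᴶ ∑ᴶ cᵢ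
      ⊞ᴶ scalar (⊟ A) ⊡ᴶ ∑ᴶ dᵢ
  iterated = begin
    F z₀ ≈⟨ ∑ᴶ-limit X (λ i → Π i ⊡ᴶ F (zᵢ i)) X-order
              (λ i → Order≥ᴶ-weaken (ℕ.m≤m+n i 0) (Order≥ᴶ-⊡ (Π-order i) Order≥ᴶ-0))
              (𝕁.trans (weighted-cong (λ k → ↑ᴶ-cong k (𝕁.sym (𝕁.*-identityˡ z₀)))) (𝕁.sym (𝕁.*-identityˡ _))) peel ⟩
    ∑ᴶ X ≈⟨ 𝕁.trans (∑ᴶ-⊞ _ _) (𝕁.+-cong (𝕁.trans (∑ᴶ-⊞ _ _) (𝕁.+-cong (𝕁.trans (∑ᴶ-⊞ _ _)
              (𝕁.+-cong (pull a-order) (pull b-order))) (pull c-order))) (pull d-order)) ⟩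
    _ ∎
    where
    -- Since x e = e - 1, the term c₁ x e² splits into c₁ e² - c₁ e, which shifts the coefficient of
    -- e to c₀ - c₁. The part of the gap sum with e³ B has the shape of the binomial term and joins
    -- it.
    X : ℕ → Jet
    X i = scalar (c₀′ ⊞ ⊟ c₁′) ⊡ᴶ aᵢ i ⊞ᴶ scalar c₁′ ⊡ᴶ bᵢ i ⊞ᴶ scalar (c₂′ ⊞ ⊟ (# 3 ⊡ B)) ⊡ᴶ cᵢ i
      ⊞ᴶ scalar (⊟ A) ⊡ᴶ dᵢ i
    Π-first : ∀ y i → Order≥ᴶ i (Π i ⊡ᴶ y)
    Π-first y i = Order≥ᴶ-weaken (ℕ.m≤m+n i 0) (Order≥ᴶ-⊡ (Π-order i) (Order≥ᴶ-0 {y}))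
    a-order : ∀ i → Order≥ᴶ i (aᵢ i)
    a-order = λ i → Π-first _ i
    b-order : ∀ i → Order≥ᴶ i (bᵢ i)
    b-order = λ i → Π-first _ i
    c-order : ∀ i → Order≥ᴶ i (cᵢ i)
    c-order = λ i → Π-first _ i
    d-order : ∀ i → Order≥ᴶ i (dᵢ i)
    d-order = λ i → Π-first _ i
    X-order : ∀ i → Order≥ᴶ i (X i)
    X-order i = Order≥ᴶ-⊞ (Order≥ᴶ-⊞ (Order≥ᴶ-⊞ (Order≥ᴶ-⊡ Order≥ᴶ-0 (a-order i)) (Order≥ᴶ-⊡ Order≥ᴶ-0 (b-order i)))
      (Order≥ᴶ-⊡ Order≥ᴶ-0 (c-order i))) (Order≥ᴶ-⊡ Order≥ᴶ-0 (d-order i))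
    pull : ∀ {c g} → (∀ i → Order≥ᴶ i (g i)) → ∑ᴶ (λ i → c ⊡ᴶ g i) ≈ᴶ c ⊡ᴶ ∑ᴶ g
    pull {c} o = 𝕁.sym (∑ᴶ-⊡ c o)
    zᵢ-suc : ∀ i → zᵢ (suc i) ≈ᴶ Q ⊡ᴶ zᵢ i
    zᵢ-suc i = 𝕁.*-assoc Q (Q ↑ᴶ i) z₀
    peel : ∀ i → Π i ⊡ᴶ F (zᵢ i) ≈ᴶ X i ⊞ᴶ Π (suc i) ⊡ᴶ F (zᵢ (suc i))
    peel i = begin
      Π i ⊡ᴶ F (zᵢ i) ≈⟨ 𝕁.*-congˡ (functional-equation (zᵢ i) (zᵢ (suc i)) (eᵢ i) (zᵢ-suc i) (eᵢ-equation i)) ⟩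
      _ ≈⟨ ≈-modulo
            (solve 11 (λ y q p c0 c1 c2 a b x e f →
              y :* (q :* (c0 :* e :+ c1 :* (x :* e :* e) :+ p :* c2 :* (x :* e :* (x :* e :* e))
                :+ :- (lit 3 :* p :* (x :^ 2 :* (e :^ 3 :* b :+ ((:- e :^ 4) :* a :+ e :^ 4 :* f))))))
              := (c0 :+ :- c1) :* (y :* (q :* e)) :+ c1 :* (y :* (q :* e :^ 2))
                :+ (c2 :+ :- (lit 3 :* b)) :* (y :* (q :* p :* x :^ 2 :* e :^ 3))
                :+ (:- a) :* (y :* ((:- lit 3) :* q :* p :* x :^ 2 :* e :^ 4))
                :+ (y :* ((:- lit 3) :* p :* q :* x :^ 2 :* e :^ 4)) :* f
                :+ (:- (y :* q :* c1 :* e)) :* (e :- (lit 1 :+ x :* e)))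
              𝕁.refl (Π i) Q P (scalar c₀′) (scalar c₁′) (scalar c₂′) (scalar A) (scalar B) (zᵢ (suc i)) (eᵢ i) (F (zᵢ (suc i))))
            (𝕁.trans (𝕁.+-congˡ (𝕁.-‿cong (𝕁.+-congʳ natᴶ-1))) (≈-difference (eᵢ-equation i))) ⟩
      (scalar c₀′ ⊞ᴶ ⊟ᴶ scalar c₁′) ⊡ᴶ aᵢ i ⊞ᴶ scalar c₁′ ⊡ᴶ bᵢ i
        ⊞ᴶ (scalar c₂′ ⊞ᴶ ⊟ᴶ (natᴶ 3 ⊡ᴶ scalar B)) ⊡ᴶ cᵢ i
        ⊞ᴶ ⊟ᴶ scalar A ⊡ᴶ dᵢ i ⊞ᴶ Π (suc i) ⊡ᴶ F (zᵢ (suc i))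
        ≈⟨ 𝕁.+-congʳ (𝕁.+-cong (𝕁.+-cong (𝕁.+-congʳ (𝕁.*-congʳ
             (𝕁.sym (𝕁.trans (scalar-⊞ _ _) (𝕁.+-congˡ (scalar-⊟ _))))))
             (𝕁.*-congʳ (𝕁.sym (𝕁.trans (scalar-⊞ _ _) (𝕁.+-congˡ (𝕁.trans (scalar-⊟ _) (𝕁.-‿cong (scalar-⊡ _ _))))))))
             (𝕁.*-congʳ (𝕁.sym (scalar-⊟ A)))) ⟩
      X i ⊞ᴶ Π (suc i) ⊡ᴶ F (zᵢ (suc i)) ∎

-- The explicit form of the iterated series

opaque
  unfolding _⊞_

  -- `V i` is the inverse of `Pᵢ (suc i)`, assembled factor by factor.
  V : ℕ → FPS
  V zero = 𝟙
  V (suc i) = V i ⊡ v (suc i)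

  Pᵢ-const : ∀ i → Pᵢ (suc i) 0 0 ≡ 1ℚ
  Pᵢ-const zero = ≡.refl
  Pᵢ-const (suc i) = ⊡-const (Pᵢ (suc i)) (𝟙 ⊞ ⊟ qp (suc i)) (Pᵢ-const i) (1-qp-const i)

  V-inverse : ∀ i → Pᵢ (suc i) ⊡ V i ≈ 𝟙
  V-inverse zero = ⊡-identityˡ 𝟙
  V-inverse (suc i) = inverse-product {Pᵢ (suc i)} {V i} {𝟙 ⊞ ⊟ qp (suc i)} {v (suc i)} (V-inverse i) (v-inverse i)

  V-suc : ∀ i → V (suc i) ≈ V i ⊡ v (suc i)
  V-suc i = refl

  V-zero : V 0 ≈ 𝟙
  V-zero = refl

↑-cong : ∀ {f g} n → f ≈ g → f ↑ n ≈ g ↑ n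
↑-cong zero f≈g = refl
↑-cong (suc n) f≈g = ⊡-cong f≈g (↑-cong n f≈g)

denominator : ∀ k i a → ((𝟙 ⊞ ⊟ q) ↑ k ⊡ Pᵢ (suc i) ↑ 4 ⊡ (𝟙 ⊞ ⊟ qp (suc i)) ↑ a) ⁻¹ ≈
              v 1 ↑ k ⊡ V i ↑ 4 ⊡ v (suc i) ↑ a
denominator k i a = trans (⁻¹-⊡ _ _ (⊡-const _ _ u₀ P₀) t₀)
  (⊡-cong (trans (⁻¹-⊡ _ _ u₀ P₀) (⊡-cong (⁻¹-↑ _ (1-qp-const 0) k)
      (trans (⁻¹-↑ _ (Pᵢ-const i) 4) (↑-cong 4 (⁻¹-unique (Pᵢ-const i) (V-inverse i))))))
    (⁻¹-↑ _ (1-qp-const i) a))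
  where
  u₀ : ((𝟙 ⊞ ⊟ q) ↑ k) 0 0 ≡ 1ℚ
  u₀ = ↑-const _ (1-qp-const 0) k
  P₀ : (Pᵢ (suc i) ↑ 4) 0 0 ≡ 1ℚ
  P₀ = ↑-const _ (Pᵢ-const i) 4
  t₀ : ((𝟙 ⊞ ⊟ qp (suc i)) ↑ a) 0 0 ≡ 1ℚ
  t₀ = ↑-const _ (1-qp-const i) a

2*suc : ∀ i → 2 * suc i ≡ 2 + 2 * i
2*suc = solve-∀

2*suc∸2 : ∀ i → 2 * suc i ∸ 2 ≡ 2 * i
2*suc∸2 i = ≡.trans (cong (_∸ 2) (2*suc i)) (ℕ.m+n∸m≡n 2 (2 * i))

-- i² + 4i is the exponent of q in `Π i`: each of its i factors has q² from p and one more q, and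
-- the squares of the q^k s contribute i(i+1). The extra 1 is the factor q of `aᵢ` and `bᵢ`.
F-exponent : ∀ i → suc i * suc i + 2 * suc i ∸ 2 ≡ 1 + (i * i + 4 * i)
F-exponent i = ≡.trans (cong (_∸ 2) (eq i)) (ℕ.m+n∸m≡n 2 (1 + (i * i + 4 * i)))
  where
  eq : ∀ i → suc i * suc i + 2 * suc i ≡ 2 + (1 + (i * i + 4 * i))
  eq = solve-∀

-- The exponent of `Π i` plus 2 from p, 1 from q and 2(i+1) from the square of `zᵢ (suc i)`.
H-exponent : ∀ i → suc i * suc i + 4 * suc i ≡ 2 + (1 + ((suc i + suc i) + (i * i + 4 * i)))
H-exponent = solve-∀

opaque
  unfolding _⊞_ ∑

  -- At index i + 1 the truncated subtractions of the definition can be carried out. This and the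
  -- next equations restate the definitions in terms of the opaque operations.
  Fₐ-suc : ∀ a i → Fₐ a (suc i) ≡ minus3 ↑ i ⊡ mono (1 + (i * i + 4 * i)) i ⊡
    ((𝟙 ⊞ ⊟ q) ↑ (2 * i) ⊡ Pᵢ (suc i) ↑ 4 ⊡ (𝟙 ⊞ ⊟ qp (suc i)) ↑ a) ⁻¹
  Fₐ-suc a i = ≡.trans
    (cong₂ (λ k d → (minus3 ^ₛ i) ⊛ mono k i ⊛ inv (((oneₛ ⊖ q) ^ₛ d) ⊛ (Pᵢ (suc i) ^ₛ 4) ⊛ ((oneₛ ⊖ qp (suc i)) ^ₛ a)))
      (F-exponent i) (2*suc∸2 i))
    (≡.trans
      (cong₂ (λ m t → m ⊛ mono (1 + (i * i + 4 * i)) i ⊛ inv (((oneₛ ⊖ q) ^ₛ (2 * i)) ⊛ (Pᵢ (suc i) ^ₛ 4) ⊛ t))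
        (≡.sym (↑≡^ₛ minus3 i)) (≡.sym (↑≡^ₛ (oneₛ ⊖ qp (suc i)) a)))
      (cong (λ d → (minus3 ↑ i) ⊛ mono (1 + (i * i + 4 * i)) i ⊛ inv (d ⊛ (Pᵢ (suc i) ^ₛ 4) ⊛ ((oneₛ ⊖ qp (suc i)) ↑ a)))
        (≡.sym (↑≡^ₛ (oneₛ ⊖ q) (2 * i)))))

  H₃-suc : ∀ i → H₃ (suc i) ≡ minus3 ↑ i ⊡ mono (suc i * suc i + 4 * suc i) (suc i) ⊡
    ((𝟙 ⊞ ⊟ q) ↑ (2 * suc i) ⊡ Pᵢ (suc i) ↑ 4 ⊡ (𝟙 ⊞ ⊟ qp (suc i)) ↑ 3) ⁻¹
  H₃-suc i = cong₂ (λ m d → m ⊛ mono (suc i * suc i + 4 * suc i) (suc i) ⊛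
      inv (d ⊛ (Pᵢ (suc i) ^ₛ 4) ⊛ ((oneₛ ⊖ qp (suc i)) ^ₛ 3)))
    (≡.sym (↑≡^ₛ minus3 (i))) (≡.sym (↑≡^ₛ (oneₛ ⊖ q) (2 * suc i)))

  H₄-suc : ∀ i → H₄ (suc i) ≡ minus3 ↑ suc i ⊡ mono (suc i * suc i + 4 * suc i) (suc i) ⊡
    ((𝟙 ⊞ ⊟ q) ↑ (2 * suc i) ⊡ Pᵢ (suc i) ↑ 4 ⊡ (𝟙 ⊞ ⊟ qp (suc i)) ↑ 4) ⁻¹
  H₄-suc i = cong₂ (λ m d → m ⊛ mono (suc i * suc i + 4 * suc i) (suc i) ⊛
      inv (d ⊛ (Pᵢ (suc i) ^ₛ 4) ⊛ ((oneₛ ⊖ qp (suc i)) ^ₛ 4)))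
    (≡.sym (↑≡^ₛ minus3 (suc i))) (≡.sym (↑≡^ₛ (oneₛ ⊖ q) (2 * suc i)))

  Σ-zero : Σᵢ 1 ≈ # 0
  Σ-zero = sym const-0

  Σ-suc : ∀ i → Σᵢ (suc (suc i)) ≈ Σᵢ (suc i) ⊞ qp (suc i) ⊡ v (suc i)
  Σ-suc i = refl

  Σ'-zero : Σ'ᵢ 1 ≈ # 0
  Σ'-zero = sym const-0

  Σ'-suc : ∀ i → Σ'ᵢ (suc (suc i)) ≈ Σ'ᵢ (suc i) ⊞ qp (2 * suc i) ⊡ ((𝟙 ⊞ ⊟ qp (suc i)) ↑ 2) ⁻¹
  Σ'-suc i = refl

  Lₐ-suc : ∀ a i → Lₐ a (suc i) ≡ # (2 * i) ⊞ # 4 ⊡ Σᵢ (suc i) ⊞ # a ⊡ qp (suc i) ⊡ v (suc i)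
  Lₐ-suc a i = cong (λ d → natₛ d ⊕ natₛ 4 ⊛ Σᵢ (suc i) ⊕ natₛ a ⊛ qp (suc i) ⊛ inv (oneₛ ⊖ qp (suc i))) (2*suc∸2 i)

  Mₐ-suc : ∀ a i → Mₐ a (suc i) ≡ ⊟ # (2 * i) ⊞ # 4 ⊡ Σ'ᵢ (suc i)
    ⊞ # a ⊡ qp (2 * suc i) ⊡ ((𝟙 ⊞ ⊟ qp (suc i)) ↑ 2) ⁻¹
  Mₐ-suc a i = cong (λ d → negₛ (natₛ d) ⊕ natₛ 4 ⊛ Σ'ᵢ (suc i)
    ⊕ natₛ a ⊛ qp (2 * suc i) ⊛ inv ((oneₛ ⊖ qp (suc i)) ^ₛ 2)) (2*suc∸2 i)

  L'ᵦ-suc : ∀ b i → L'ᵦ b (suc i) ≡ # (2 * suc i) ⊞ # 4 ⊡ Σᵢ (suc i) ⊞ # b ⊡ qp (suc i) ⊡ v (suc i)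
  L'ᵦ-suc b i = ≡.refl

  M'ᵦ-suc : ∀ b i → M'ᵦ b (suc i) ≡ ⊟ # (2 * suc i) ⊞ # 4 ⊡ Σ'ᵢ (suc i)
    ⊞ # b ⊡ qp (2 * suc i) ⊡ ((𝟙 ⊞ ⊟ qp (suc i)) ↑ 2) ⁻¹
  M'ᵦ-suc b i = ≡.refl

mono-cong : ∀ {a b} c → a ≡ b → mono a c ≈ mono b c
mono-cong c ≡.refl = refl

H-mono : ∀ i → mono (suc i * suc i + 4 * suc i) (suc i) ≈
  qp 2 ⊡ w ⊡ (q ⊡ (qp (suc i) ⊡ qp (suc i) ⊡ mono (i * i + 4 * i) i))
H-mono i = trans (mono-cong (suc i) (H-exponent i)) (trans (mono-mono 2 1 _ i)
  (⊡-cong (mono-mono 2 0 0 1) (trans (mono-mono 1 0 _ i)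
    (⊡-congˡ (trans (mono-mono (suc i + suc i) 0 _ i) (⊡-congʳ (mono-mono (suc i) 0 (suc i) 0)))))))

↑-double : ∀ f i → f ↑ (2 * suc i) ≈ f ⊡ (f ⊡ f ↑ (2 * i))
↑-double f i = reflexive (cong (f ↑_) (2*suc i))

square-term : ∀ i → qp (2 * suc i) ⊡ ((𝟙 ⊞ ⊟ qp (suc i)) ↑ 2) ⁻¹ ≈ (qp (suc i) ⊡ v (suc i)) ↑ 2
square-term i = trans (⊡-cong
    (trans (mono-cong 0 (cong (λ k → suc i + k) (ℕ.+-identityʳ (suc i)))) (mono-mono (suc i) 0 (suc i) 0))
    (⁻¹-↑ _ (1-qp-const i) 2))
  (solve 2 (λ t v → t :* t :* v :^ 2 := (t :* v) :^ 2) refl (qp (suc i)) (v (suc i)))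
  where
  open Solver
#-2*suc : ∀ i → # (2 * suc i) ≈ # 2 ⊞ # (2 * i)
#-2*suc i = trans (reflexive (cong #_ (2*suc i))) (#-+ 2 (2 * i))

-- Logarithmic derivatives add up along the product. In the k-th factor only z² and e⁴ depend on s:
-- the former contributes 2 and -2, the latter four times q^k/(1-q^k) and four times its square.
logjet-Π : ∀ i → Π i ≈ᴶ logjet (minus3 ↑ i ⊡ mono (i * i + 4 * i) i ⊡ (v 1 ↑ (2 * i) ⊡ V i ↑ 4))
  (# (2 * i) ⊞ # 4 ⊡ Σᵢ (suc i)) (⊟ # (2 * i) ⊞ # 4 ⊡ Σ'ᵢ (suc i))
logjet-Π zero = 𝕁.trans (𝕁.sym scalar-𝟙) (𝕁.trans (logjet-scalar 𝟙) (logjet-cong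
  (sym (trans (⊡-cong (trans (⊡-identityˡ _) mono-𝟙) (trans (⊡-identityˡ _) (V-one 4))) (⊡-identityˡ 𝟙)))
  (sym (trans (⊞-congˡ (⊡-congˡ Σ-zero)) (solve 0 (lit 0 :+ lit 4 :* lit 0 := lit 0) refl)))
  (sym (trans (⊞-congˡ (⊡-congˡ Σ'-zero)) (solve 0 ((:- lit 0) :+ lit 4 :* lit 0 := lit 0) refl)))))
  where
  open Solver
  V-one : ∀ n → V 0 ↑ n ≈ 𝟙
  V-one zero = refl
  V-one (suc n) = trans (⊡-cong V-zero (V-one n)) (⊡-identityˡ 𝟙)
logjet-Π (suc i) = 𝕁.trans
  (logjet-⊡ (logjet-Π i) (logjet-⊡ (logjet-⊡ (logjet-⊡ (logjet-⊡
    (𝕁.trans (𝕁.sym (scalar-⊟ (# 3))) (logjet-scalar (⊟ # 3))) (logjet-scalar p)) (logjet-scalar q))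
    (logjet-↑ (logjet-zᵢ (suc i)) 2)) (logjet-↑ 𝕁.refl 4)))
  (logjet-cong value first second)
  where
  open SetoidReasoning setoid
  open Solver
  value : minus3 ↑ i ⊡ mono (i * i + 4 * i) i ⊡ (v 1 ↑ (2 * i) ⊡ V i ↑ 4)
    ⊡ (⊟ # 3 ⊡ p ⊡ q ⊡ qp (suc i) ↑ 2 ⊡ v (suc i) ↑ 4) ≈
    minus3 ↑ suc i ⊡ mono (suc i * suc i + 4 * suc i) (suc i) ⊡ (v 1 ↑ (2 * suc i) ⊡ V (suc i) ↑ 4)
  value = begin
    _ ≈⟨ solve 11 (λ m e v2 V t y q p w v x → m :* e :* (v2 :* V :^ 4) :* (x :* (p :* w :* v :^ 2) :* q :* t :^ 2 :* y :^ 4)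
           := x :* m :* (p :* w :* (q :* (t :* t :* e))) :* (v :* (v :* v2) :* (V :* y) :^ 4)) refl
           (minus3 ↑ i) (mono (i * i + 4 * i) i) (v 1 ↑ (2 * i)) (V i) (qp (suc i)) (v (suc i)) q (qp 2) w (v 1) (⊟ # 3) ⟩
    ⊟ # 3 ⊡ minus3 ↑ i ⊡ (qp 2 ⊡ w ⊡ (q ⊡ (qp (suc i) ⊡ qp (suc i) ⊡ mono (i * i + 4 * i) i)))
      ⊡ (v 1 ⊡ (v 1 ⊡ v 1 ↑ (2 * i)) ⊡ (V i ⊡ v (suc i)) ↑ 4)
      ≈⟨ ⊡-cong (⊡-cong (⊡-congʳ minus3≈) (H-mono i)) (⊡-cong (↑-double (v 1) i) (↑-cong 4 (V-suc i))) ⟨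
    minus3 ↑ suc i ⊡ mono (suc i * suc i + 4 * suc i) (suc i) ⊡ (v 1 ↑ (2 * suc i) ⊡ V (suc i) ↑ 4) ∎
  first : # (2 * i) ⊞ # 4 ⊡ Σᵢ (suc i) ⊞ (# 0 ⊞ # 0 ⊞ # 0 ⊞ # 2 ⊡ # 1 ⊞ # 4 ⊡ (qp (suc i) ⊡ v (suc i))) ≈
    # (2 * suc i) ⊞ # 4 ⊡ Σᵢ (suc (suc i))
  first = begin
    _ ≈⟨ solve 3 (λ n s u → n :+ lit 4 :* s :+ (lit 0 :+ lit 0 :+ lit 0 :+ lit 2 :* lit 1 :+ lit 4 :* u)
           := (lit 2 :+ n) :+ lit 4 :* (s :+ u)) refl (# (2 * i)) (Σᵢ (suc i)) (qp (suc i) ⊡ v (suc i)) ⟩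
    # 2 ⊞ # (2 * i) ⊞ # 4 ⊡ (Σᵢ (suc i) ⊞ qp (suc i) ⊡ v (suc i)) ≈⟨ ⊞-cong (#-2*suc i) (⊡-congˡ (Σ-suc i)) ⟨
    # (2 * suc i) ⊞ # 4 ⊡ Σᵢ (suc (suc i)) ∎
  second : ⊟ # (2 * i) ⊞ # 4 ⊡ Σ'ᵢ (suc i) ⊞ (# 0 ⊞ # 0 ⊞ # 0 ⊞ # 2 ⊡ ⊟ # 1 ⊞ # 4 ⊡ (qp (suc i) ⊡ v (suc i)) ↑ 2) ≈
    ⊟ # (2 * suc i) ⊞ # 4 ⊡ Σ'ᵢ (suc (suc i))
  second = begin
    _ ≈⟨ solve 3 (λ n s u → (:- n) :+ lit 4 :* s :+ (lit 0 :+ lit 0 :+ lit 0 :+ lit 2 :* (:- lit 1) :+ lit 4 :* u)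
           := (:- (lit 2 :+ n)) :+ lit 4 :* (s :+ u)) refl (# (2 * i)) (Σ'ᵢ (suc i)) ((qp (suc i) ⊡ v (suc i)) ↑ 2) ⟩
    ⊟ (# 2 ⊞ # (2 * i)) ⊞ # 4 ⊡ (Σ'ᵢ (suc i) ⊞ (qp (suc i) ⊡ v (suc i)) ↑ 2)
      ≈⟨ ⊞-cong (⊟-cong (#-2*suc i)) (⊡-congˡ (trans (Σ'-suc i) (⊞-congˡ (square-term i)))) ⟨
    ⊟ # (2 * suc i) ⊞ # 4 ⊡ Σ'ᵢ (suc (suc i)) ∎

module _ (i : ℕ) where
  open SetoidReasoning setoid
  open Solver

  private
    N S S′ U m e v2 : FPS
    N = # (2 * i)
    S = Σᵢ (suc i)
    S′ = Σ'ᵢ (suc i)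
    U = qp (suc i) ⊡ v (suc i)
    m = minus3 ↑ i
    e = mono (i * i + 4 * i) i
    v2 = v 1 ↑ (2 * i)

  Fₐ-closed : ∀ a → Fₐ a (suc i) ≈ m ⊡ e ⊡ (v2 ⊡ V i ↑ 4) ⊡ (q ⊡ v (suc i) ↑ a)
  Fₐ-closed a = begin
    Fₐ a (suc i) ≡⟨ Fₐ-suc a i ⟩
    _ ≈⟨ ⊡-cong (⊡-congˡ (mono-mono 1 0 (i * i + 4 * i) i)) (denominator (2 * i) i a) ⟩
    m ⊡ (q ⊡ e) ⊡ (v2 ⊡ V i ↑ 4 ⊡ v (suc i) ↑ a)
      ≈⟨ solve 6 (λ m q e v V y → m :* (q :* e) :* (v :* V :* y) := m :* e :* (v :* V) :* (q :* y)) refl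
           m q e v2 (V i ↑ 4) (v (suc i) ↑ a) ⟩
    m ⊡ e ⊡ (v2 ⊡ V i ↑ 4) ⊡ (q ⊡ v (suc i) ↑ a) ∎

  Lₐ-closed : ∀ a → Lₐ a (suc i) ≈ N ⊞ # 4 ⊡ S ⊞ # a ⊡ U
  Lₐ-closed a = trans (reflexive (Lₐ-suc a i)) (⊞-congˡ (⊡-assoc _ _ _))

  Mₐ-closed : ∀ a → Mₐ a (suc i) ≈ ⊟ N ⊞ # 4 ⊡ S′ ⊞ # a ⊡ U ↑ 2
  Mₐ-closed a = trans (reflexive (Mₐ-suc a i)) (⊞-congˡ (trans (⊡-assoc _ _ _) (⊡-congˡ (square-term i))))

  L'ᵦ-closed : ∀ b → L'ᵦ b (suc i) ≈ # 2 ⊞ N ⊞ # 4 ⊡ S ⊞ # b ⊡ U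
  L'ᵦ-closed b = trans (reflexive (L'ᵦ-suc b i)) (⊞-cong (⊞-congʳ (#-2*suc i)) (⊡-assoc _ _ _))

  M'ᵦ-closed : ∀ b → M'ᵦ b (suc i) ≈ ⊟ (# 2 ⊞ N) ⊞ # 4 ⊡ S′ ⊞ # b ⊡ U ↑ 2
  M'ᵦ-closed b = trans (reflexive (M'ᵦ-suc b i)) (⊞-cong (⊞-congʳ (⊟-cong (#-2*suc i)))
    (trans (⊡-assoc _ _ _) (⊡-congˡ (square-term i))))

  logjet-eᵢ : ∀ a → eᵢ i ↑ᴶ a ≈ᴶ logjet (v (suc i) ↑ a) (# a ⊡ U) (# a ⊡ U ↑ 2)
  logjet-eᵢ = logjet-↑ 𝕁.refl

  -- a = 1 and a = 2 are the terms of `aᵢ` and `bᵢ`.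
  logjet-F : ∀ a → Π i ⊡ᴶ (Q ⊡ᴶ eᵢ i ↑ᴶ a) ≈ᴶ logjet (Fₐ a (suc i)) (Lₐ a (suc i)) (Mₐ a (suc i))
  logjet-F a = 𝕁.trans (logjet-⊡ (logjet-Π i) (logjet-⊡ (logjet-scalar q) (logjet-eᵢ a)))
    (logjet-cong (sym (Fₐ-closed a)) (trans (drop (# a ⊡ U)) (sym (Lₐ-closed a)))
      (trans (drop (# a ⊡ U ↑ 2)) (sym (Mₐ-closed a))))
    where
    drop : ∀ {x} y → x ⊞ (# 0 ⊞ y) ≈ x ⊞ y
    drop {x} y = solve 2 (λ x y → x :+ (lit 0 :+ y) := x :+ y) refl x y

  logjet-H₃ : cᵢ i ≈ᴶ logjet (H₃ (suc i)) (L'ᵦ 3 (suc i)) (M'ᵦ 3 (suc i))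
  logjet-H₃ = 𝕁.trans
    (logjet-⊡ (logjet-Π i) (logjet-⊡ (logjet-⊡ (logjet-⊡ (logjet-scalar q) (logjet-scalar p))
      (logjet-↑ (logjet-zᵢ (suc i)) 2)) (logjet-eᵢ 3)))
    (logjet-cong (sym value)
      (trans (solve 3 (λ n s u → n :+ lit 4 :* s :+ (lit 0 :+ lit 0 :+ lit 2 :* lit 1 :+ lit 3 :* u)
        := lit 2 :+ n :+ lit 4 :* s :+ lit 3 :* u) refl N S U) (sym (L'ᵦ-closed 3)))
      (trans (solve 3 (λ n s u → (:- n) :+ lit 4 :* s :+ (lit 0 :+ lit 0 :+ lit 2 :* (:- lit 1) :+ lit 3 :* u)
        := (:- (lit 2 :+ n)) :+ lit 4 :* s :+ lit 3 :* u) refl N S′ (U ↑ 2)) (sym (M'ᵦ-closed 3))))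
    where
    value : H₃ (suc i) ≈ m ⊡ e ⊡ (v2 ⊡ V i ↑ 4) ⊡ (q ⊡ p ⊡ qp (suc i) ↑ 2 ⊡ v (suc i) ↑ 3)
    value = begin
      H₃ (suc i) ≡⟨ H₃-suc i ⟩
      _ ≈⟨ ⊡-cong (⊡-congˡ (H-mono i)) (trans (denominator (2 * suc i) i 3) (⊡-congʳ (⊡-congʳ (↑-double (v 1) i)))) ⟩
      _ ≈⟨ solve 10 (λ m e v2 V t y q p w v → m :* (p :* w :* (q :* (t :* t :* e))) :* (v :* (v :* v2) :* V :* y)
             := m :* e :* (v2 :* V) :* (q :* (p :* w :* v :^ 2) :* t :^ 2 :* y)) refl
             m e v2 (V i ↑ 4) (qp (suc i)) (v (suc i) ↑ 3) q (qp 2) w (v 1) ⟩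
      _ ∎

  logjet-H₄ : dᵢ i ≈ᴶ logjet (H₄ (suc i)) (L'ᵦ 4 (suc i)) (M'ᵦ 4 (suc i))
  logjet-H₄ = 𝕁.trans
    (logjet-⊡ (logjet-Π i) (logjet-⊡ (logjet-⊡ (logjet-⊡ (logjet-⊡
      (𝕁.trans (𝕁.sym (scalar-⊟ (# 3))) (logjet-scalar (⊟ # 3))) (logjet-scalar q)) (logjet-scalar p))
      (logjet-↑ (logjet-zᵢ (suc i)) 2)) (logjet-eᵢ 4)))
    (logjet-cong (sym value)
      (trans (solve 3 (λ n s u → n :+ lit 4 :* s :+ (lit 0 :+ lit 0 :+ lit 0 :+ lit 2 :* lit 1 :+ lit 4 :* u)
        := lit 2 :+ n :+ lit 4 :* s :+ lit 4 :* u) refl N S U) (sym (L'ᵦ-closed 4)))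
      (trans (solve 3 (λ n s u → (:- n) :+ lit 4 :* s :+ (lit 0 :+ lit 0 :+ lit 0 :+ lit 2 :* (:- lit 1) :+ lit 4 :* u)
        := (:- (lit 2 :+ n)) :+ lit 4 :* s :+ lit 4 :* u) refl N S′ (U ↑ 2)) (sym (M'ᵦ-closed 4))))
    where
    value : H₄ (suc i) ≈ m ⊡ e ⊡ (v2 ⊡ V i ↑ 4) ⊡ (⊟ # 3 ⊡ q ⊡ p ⊡ qp (suc i) ↑ 2 ⊡ v (suc i) ↑ 4)
    value = begin
      H₄ (suc i) ≡⟨ H₄-suc i ⟩
      _ ≈⟨ ⊡-cong (⊡-cong (⊡-congʳ minus3≈) (H-mono i)) (trans (denominator (2 * suc i) i 4) (⊡-congʳ (⊡-congʳ (↑-double (v 1) i)))) ⟩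
      _ ≈⟨ solve 11 (λ m e v2 V t y q p w v x → x :* m :* (p :* w :* (q :* (t :* t :* e))) :* (v :* (v :* v2) :* V :* y)
             := m :* e :* (v2 :* V) :* (x :* q :* (p :* w :* v :^ 2) :* t :^ 2 :* y)) refl
             m e v2 (V i ↑ 4) (qp (suc i)) (v (suc i) ↑ 4) q (qp 2) w (v 1) (⊟ # 3) ⟩
      _ ∎

opaque
  unfolding _⊞_ ∑ ∑ᴶ

  ∑-const : ∀ c g → const c ⊡ ∑ g ≈ ∑ (λ j → const c ⊡ g j)
  ∑-const c g = pointwise λ n m → ≡.trans (const-⊡-at c (∑ g) n m)
    (≡.trans (distrib n (λ j → g j n m)) (sumUpTo-cong n (λ j _ → ≡.sym (const-⊡-at c (g j) n m))))
    where
    distrib : ∀ n (f : ℕ → ℚ) → c ℚ.* sumUpTo n f ≡ sumUpTo n (λ j → c ℚ.* f j)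
    distrib zero f = ≡.refl
    distrib (suc n) f = ≡.trans (ℚ.*-distribˡ-+ c (sumUpTo n f) (f (suc n))) (cong (ℚ._+ c ℚ.* f (suc n)) (distrib n f))

  -- Identifies three tilde series at once. In their definition the factor 1/2 stands before the
  -- sum, in `logjet` inside each term.
  ∑ᴶ-logjet : ∀ {g} (f l m : ℕ → FPS) → (∀ i → g i ≈ᴶ logjet (f (suc i)) (l (suc i)) (m (suc i))) →
    ∑ᴶ g ≈ᴶ jet (sum≥1 f) (sum≥1 (λ i → f i ⊛ l i)) (halfₛ ⊛ sum≥1 (λ i → f i ⊛ (l i ^ₛ 2 ⊕ m i)))
  ∑ᴶ-logjet f l m g≈ = 𝕁.trans (∑ᴶ-cong g≈) (jet≈ refl refl (sym (∑-const ½ (λ i → f (suc i) ⊛ (l (suc i) ^ₛ 2 ⊕ m (suc i))))))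

a-jet : ∑ᴶ aᵢ ≈ᴶ jet α̃ ε̃ ι̃
a-jet = ∑ᴶ-logjet (Fₐ 1) (Lₐ 1) (Mₐ 1) (λ i → 𝕁.trans
  (𝕁.*-congˡ (𝕁.*-congˡ (𝕁.sym (𝕁.*-identityʳ (eᵢ i))))) (logjet-F i 1))

b-jet : ∑ᴶ bᵢ ≈ᴶ jet β̃ ζ̃ κ̃
b-jet = ∑ᴶ-logjet (Fₐ 2) (Lₐ 2) (Mₐ 2) (λ i → logjet-F i 2)

c-jet : ∑ᴶ cᵢ ≈ᴶ jet γ̃ η̃ λ̃
c-jet = ∑ᴶ-logjet H₃ (L'ᵦ 3) (M'ᵦ 3) logjet-H₃

d-jet : ∑ᴶ dᵢ ≈ᴶ jet δ̃ θ̃ μ̃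
d-jet = ∑ᴶ-logjet H₄ (L'ᵦ 4) (M'ᵦ 4) logjet-H₄

-- The linear system

-- Cramer's rule: the linear system for A, B and D has determinant DEN.
module Elimination (R : CommutativeRing 0ℓ 0ℓ) (homo : IntegersInto R) where
  open CommutativeRing R using () renaming (refl to ≈-refl)
  open IntegerSolver R homo

  private
    𝟏 𝟚 𝟜 : ∀ {n} → Polynomial n
    𝟏 = lit 1
    𝟚 = lit 2
    𝟜 = lit 4

    det : ∀ {n} (a b c a′ b′ c′ a″ b″ c″ : Polynomial n) → Polynomial n
    det a b c a′ b′ c′ a″ b″ c″ =
      a :* (b′ :* c″ :- c′ :* b″) :- a′ :* (b :* c″ :- c :* b″) :+ a″ :* (b :* c′ :- c :* b′)

    -- kA, kB and kD are the coefficients of A/(1-q), B and pC/(1-q), with sign reversed, in the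
    -- combination of α, β, γ, δ to which the iteration equates A. The rows for B and C have the
    -- same form.
    kA : ∀ {n} (q β γ δ : Polynomial n) → Polynomial n
    kA q β γ δ = (𝟏 :- q) :* δ :- (𝟏 :- q) :* β :- 𝟚 :* γ
    kB : ∀ {n} (α γ : Polynomial n) → Polynomial n
    kB α γ = γ :- α
    kD : ∀ {n} (q α β : Polynomial n) → Polynomial n
    kD q α β = :- (𝟚 :* (q :* α :+ (𝟏 :- q) :* β))

  cramer = solve 12 (λ a b c a′ b′ c′ a″ b″ c″ x y z →
    let r = a :* x :+ b :* y :+ c :* z
        r′ = a′ :* x :+ b′ :* y :+ c′ :* z
        r″ = a″ :* x :+ b″ :* y :+ c″ :* z in
    det r b c r′ b′ c′ r″ b″ c″ :+ det a b r a′ b′ r′ a″ b″ r″ := det a b c a′ b′ c′ a″ b″ c″ :* (x :+ z)) ≈-refl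

  -- The last summands account for q₃ = q q₂ and q₂ = q².
  denominator-det = solve 16 (λ q q₂ q₃ w α β γ δ ε ζ η θ ι κ λ′ μ →
    let u = 𝟏 :- q
        W = q₂ :* w
        X = ( ι :+ α :* κ :- α :* μ :- β :* ι :+ δ :* ι :- ε :* λ′ :+ η :* ι :- α :* ζ :* λ′ :+ α :* η :* κ :-
            α :* η :* μ :+ α :* θ :* λ′ :+ β :* ε :* λ′ :- β :* η :* ι :- γ :* ε :* κ :+ γ :* ε :* μ :+ γ :* ζ
            :* ι :- γ :* θ :* ι :- δ :* ε :* λ′ :+ δ :* η :* ι )
        Y = (α :* λ′ :- γ :* ι) in
    (u :^ 4) :* ( 𝟏 :- β :+ δ :- ε :+ η :- α :* ζ :+ α :* θ :+ β :* ε :- β :* η :+ γ :* ζ :- γ :* θ :- δ :*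
      ε :+ δ :* η ) :- 𝟚 :* (u :^ 3) :* (γ :+ α :* η :- γ :* ε) :- 𝟚 :* q₂ :* w :* (u :^ 2) :* ( κ :- β :* μ
      :+ δ :* κ :- ε :* κ :+ ζ :* ι :- ζ :* λ′ :+ η :* κ :- α :* ζ :* μ :+ α :* θ :* κ :+ β :* ε :* μ :- β :*
      η :* μ :- β :* θ :* ι :+ β :* θ :* λ′ :+ γ :* ζ :* μ :- γ :* θ :* κ :- δ :* ε :* κ :+ δ :* ζ :* ι :- δ
      :* ζ :* λ′ :+ δ :* η :* κ ) :- 𝟜 :* q₂ :* w :* u :* ( β :* λ′ :- γ :* κ :+ α :* ζ :* λ′ :- α :* η :* κ
      :- β :* ε :* λ′ :+ β :* η :* ι :+ γ :* ε :* κ :- γ :* ζ :* ι )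
      :- 𝟚 :* q₃ :* w :* u :* X :- 𝟜 :* q₃ :* w :* Y
    := det (u :+ kA q β γ δ) (kB α γ) (kD q α β)
          (kA q ζ η θ) (𝟏 :+ kB ε η) (kD q ε ζ)
          (W :* kA q κ λ′ μ) (W :* kB ι λ′) (u :^ 3 :+ W :* kD q ι κ)
      :+ (:- (𝟚 :* w :* u :* X) :- 𝟜 :* w :* Y) :* (q₃ :- q :* q₂)) ≈-refl

  numerator-det = solve 16 (λ q q₂ q₃ w α β γ δ ε ζ η θ ι κ λ′ μ →
    let u = 𝟏 :- q
        W = q₂ :* w
        Z = (α :* λ′ :- γ :* ι) in
    (u :^ 4) :* (α :+ γ :+ 𝟚 :* α :* η :- 𝟚 :* γ :* ε) :+ q₂ :* w :* (u :^ 2) :* ( ι :+ λ′ :- α :* κ :- α :*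
      μ :+ β :* ι :+ β :* λ′ :- γ :* κ :- γ :* μ :+ δ :* ι :+ δ :* λ′ :- 𝟚 :* ε :* λ′ :+ 𝟚 :* η :* ι :+ 𝟚 :* α
      :* ζ :* λ′ :- 𝟚 :* α :* η :* κ :- 𝟚 :* α :* η :* μ :+ 𝟚 :* α :* θ :* λ′ :- 𝟚 :* β :* ε :* λ′ :+ 𝟚 :* β
      :* η :* ι :+ 𝟚 :* γ :* ε :* κ :+ 𝟚 :* γ :* ε :* μ :- 𝟚 :* γ :* ζ :* ι :- 𝟚 :* γ :* θ :* ι :- 𝟚 :* δ :* ε
      :* λ′ :+ 𝟚 :* δ :* η :* ι )
      :+ 𝟚 :* q₂ :* w :* (𝟏 :- q₂) :* Z
    := u :* (det (α :+ γ) (kB α γ) (kD q α β)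
          (ε :+ η) (𝟏 :+ kB ε η) (kD q ε ζ)
          (W :* (ι :+ λ′)) (W :* kB ι λ′) (u :^ 3 :+ W :* kD q ι κ)
      :+ det (u :+ kA q β γ δ) (kB α γ) (α :+ γ)
          (kA q ζ η θ) (𝟏 :+ kB ε η) (ε :+ η)
          (W :* kA q κ λ′ μ) (W :* kB ι λ′) (W :* (ι :+ λ′)))
      :+ (:- (𝟚 :* q₂ :* w :* Z)) :* (q₂ :- q :* q)) ≈-refl

-- Weights of duplex columns, summed over their sizes

D : ℕ → ℕ → FPS
D a b = mono (2 + (a + b)) 1

W : FPS
W = qp 2 ⊡ w

-- `D a b` is the weight of a duplex column with components of a + 1 and b + 1 cells; the
-- factorisation separates the two sums.
D-split : ∀ a b → D a b ≈ W ⊡ (qp a ⊡ qp b)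
D-split a b = trans (mono-mono 2 1 (a + b) 0) (⊡-cong (mono-mono 2 0 0 1) (mono-mono a 0 b 0))

Order≥-Dˡ : ∀ {c} a b → Order≥ a (c ⊡ D a b)
Order≥-Dˡ {c} a b = Order≥-⊡ʳ c (Order≥-weaken (ℕ.≤-trans (ℕ.m≤m+n a b) (ℕ.m≤n+m (a + b) 2)) (Order≥-mono (2 + (a + b)) 1))

Order≥-Dʳ : ∀ {c} a b → Order≥ b (c ⊡ D a b)
Order≥-Dʳ {c} a b = Order≥-⊡ʳ c (Order≥-weaken (ℕ.≤-trans (ℕ.m≤n+m b a) (ℕ.m≤n+m (a + b) 2)) (Order≥-mono (2 + (a + b)) 1))

Order≥-qp : ∀ c a → Order≥ a (c ⊡ qp a)
Order≥-qp c a = Order≥-⊡ʳ c (Order≥-mono a 0)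

∑-qp : ∑ qp ≈ v 1
∑-qp = inverse-unique {𝟙 ⊞ ⊟ q} (trans (⊡-distribʳ _ _ _) (trans (⊞-congʳ (trans (⊡-identityˡ _) eq))
    (solve 3 (λ o q g → o :+ q :* g :+ (:- q) :* g := o) refl 𝟙 q (∑ qp)))) (v-inverse 0)
  where
  open Solver
  eq : ∑ qp ≈ 𝟙 ⊞ q ⊡ ∑ qp
  eq = trans (∑-head (λ a → Order≥-mono a 0)) (⊞-cong mono-𝟙
    (trans (∑-cong qp-suc) (sym (∑-⊡ q (λ a → Order≥-mono a 0)))))

∑-#qp : ∑ (λ a → # a ⊡ qp a) ≈ v 1 ⊡ (q ⊡ v 1)
∑-#qp = begin
  g ≈⟨ ⊡-identityˡ g ⟨
  𝟙 ⊡ g ≈⟨ ⊡-congʳ (sym (v-inverse 0)) ⟩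
  (𝟙 ⊞ ⊟ q) ⊡ v 1 ⊡ g ≈⟨ solve 4 (λ o q v g → (o :- q) :* v :* g := v :* (o :* g :- q :* g)) refl 𝟙 q (v 1) g ⟩
  v 1 ⊡ (𝟙 ⊡ g ⊞ ⊟ (q ⊡ g)) ≈⟨ ⊡-congˡ (⊞-congʳ (trans (⊡-identityˡ g) eq)) ⟩
  v 1 ⊡ (q ⊡ (v 1 ⊞ g) ⊞ ⊟ (q ⊡ g)) ≈⟨ solve 3 (λ q v g → v :* (q :* (v :+ g) :- q :* g) := v :* (q :* v)) refl q (v 1) g ⟩
  v 1 ⊡ (q ⊡ v 1) ∎
  where
  open SetoidReasoning setoid
  open Solver
  g : FPS
  g = ∑ (λ a → # a ⊡ qp a)
  eq : g ≈ q ⊡ (v 1 ⊞ g)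
  eq = begin
    g ≈⟨ ∑-head (λ a → Order≥-qp (# a) a) ⟩
    # 0 ⊡ qp 0 ⊞ ∑ (λ a → # suc a ⊡ qp (suc a)) ≈⟨ ⊞-cong (trans (⊡-congʳ const-0) (zeroˡ (qp 0)))
      (∑-cong (λ a → trans (⊡-cong (#-+ 1 a) (qp-suc a))
        (solve 3 (λ n q t → (lit 1 :+ n) :* (q :* t) := q :* (t :+ n :* t)) refl (# a) q (qp a)))) ⟩
    𝟘 ⊞ ∑ (λ a → q ⊡ (qp a ⊞ # a ⊡ qp a)) ≈⟨ ⊞-identityˡ _ ⟩
    ∑ (λ a → q ⊡ (qp a ⊞ # a ⊡ qp a)) ≈⟨ ∑-⊡ q (λ a → Order≥-⊞ (Order≥-mono a 0) (Order≥-qp (# a) a)) ⟨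
    q ⊡ ∑ (λ a → qp a ⊞ # a ⊡ qp a) ≈⟨ ⊡-congˡ (trans (∑-⊞ _ _) (⊞-congʳ ∑-qp)) ⟩
    q ⊡ (v 1 ⊞ g) ∎

∑-linear-qp : ∀ c d → ∑ (λ a → c ⊡ qp a ⊞ d ⊡ (# a ⊡ qp a)) ≈ c ⊡ v 1 ⊞ d ⊡ (v 1 ⊡ (q ⊡ v 1))
∑-linear-qp c d = trans (∑-⊞ _ _) (⊞-cong
  (trans (sym (∑-⊡ c (λ a → Order≥-mono a 0))) (⊡-congˡ ∑-qp))
  (trans (sym (∑-⊡ d (λ a → Order≥-qp (# a) a))) (⊡-congˡ ∑-#qp)))

-- The total weight of the duplex columns is p, and 2 p v when each is counted with its number of cells.
duplex-sum : ∀ x y → ∑ (λ a → ∑ (λ b → (x ⊞ y ⊡ # (2 + (a + b))) ⊡ D a b)) ≈ x ⊡ p ⊞ y ⊡ (# 2 ⊡ p ⊡ v 1)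
duplex-sum x y = begin
  ∑ (λ a → ∑ (λ b → (x ⊞ y ⊡ # (2 + (a + b))) ⊡ D a b)) ≈⟨ ∑-cong (λ a → trans (∑-cong (λ b → inner a b)) (∑-linear-qp _ _)) ⟩
  ∑ (λ a → (x ⊞ y ⊡ (# 2 ⊞ # a)) ⊡ W ⊡ qp a ⊡ v 1 ⊞ y ⊡ W ⊡ qp a ⊡ (v 1 ⊡ (q ⊡ v 1)))
    ≈⟨ ∑-cong (λ a → solve 7 (λ x y n W t v q →
         (x :+ y :* (lit 2 :+ n)) :* W :* t :* v :+ y :* W :* t :* (v :* (q :* v)) :=
         (W :* v :* (x :+ lit 2 :* y :+ y :* (q :* v))) :* t :+ (W :* v :* y) :* (n :* t)) refl x y (# a) W (qp a) (v 1) q) ⟩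
  ∑ (λ a → W ⊡ v 1 ⊡ (x ⊞ # 2 ⊡ y ⊞ y ⊡ (q ⊡ v 1)) ⊡ qp a ⊞ W ⊡ v 1 ⊡ y ⊡ (# a ⊡ qp a)) ≈⟨ ∑-linear-qp _ _ ⟩
  W ⊡ v 1 ⊡ (x ⊞ # 2 ⊡ y ⊞ y ⊡ (q ⊡ v 1)) ⊡ v 1 ⊞ W ⊡ v 1 ⊡ y ⊡ (v 1 ⊡ (q ⊡ v 1))
    ≈⟨ vanishing-multiple
         (solve 5 (λ x y W v q → W :* v :* (x :+ lit 2 :* y :+ y :* (q :* v)) :* v :+ W :* v :* y :* (v :* (q :* v)) :=
           x :* (W :* v :^ 2) :+ y :* (lit 2 :* (W :* v :^ 2) :* v)
             :+ (:- (lit 2 :* y :* W :* v :^ 2)) :* (v :- (lit 1 :+ q :* v))) refl x y W (v 1) q)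
         (v-equation 0) ⟩
  x ⊡ p ⊞ y ⊡ (# 2 ⊡ p ⊡ v 1) ∎
  where
  open SetoidReasoning setoid
  open Solver
  inner : ∀ a b → (x ⊞ y ⊡ # (2 + (a + b))) ⊡ D a b ≈
    (x ⊞ y ⊡ (# 2 ⊞ # a)) ⊡ W ⊡ qp a ⊡ qp b ⊞ y ⊡ W ⊡ qp a ⊡ (# b ⊡ qp b)
  inner a b = trans (⊡-cong (⊞-congˡ (⊡-congˡ (trans (#-+ 2 (a + b)) (⊞-congˡ (#-+ a b))))) (D-split a b))
    (solve 7 (λ x y n m W s t → (x :+ y :* (lit 2 :+ (n :+ m))) :* (W :* (s :* t)) :=
      (x :+ y :* (lit 2 :+ n)) :* W :* s :* t :+ y :* W :* s :* (m :* t)) refl x y (# a) (# b) W (qp a) (qp b))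

opaque
  unfolding _⊞ᴶ_ ∑ᴶ

  scalar-jet : ∀ s a b c → scalar s ⊡ᴶ jet a b c ≈ᴶ jet (s ⊡ a) (s ⊡ b) (s ⊡ c)
  scalar-jet s a b c = jet≈ refl
    (trans (⊞-congˡ (zeroˡ a)) (⊞-identityʳ _))
    (trans (⊞-cong (trans (⊞-congˡ (zeroˡ b)) (⊞-identityʳ _)) (zeroˡ a)) (⊞-identityʳ _))

  jet-⊞ : ∀ a b c a′ b′ c′ → jet a b c ⊞ᴶ jet a′ b′ c′ ≈ᴶ jet (a ⊞ a′) (b ⊞ b′) (c ⊞ c′)
  jet-⊞ _ _ _ _ _ _ = 𝕁.refl

  ∑ᴶ-jet : ∀ a b c → ∑ᴶ (λ k → jet (a k) (b k) (c k)) ≈ᴶ jet (∑ a) (∑ b) (∑ c)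
  ∑ᴶ-jet _ _ _ = 𝕁.refl

  -- (1 + e)^k modulo e³. Hence the components of F at `z₀` are A, B and C.
  z₀-↑ : ∀ k → z₀ ↑ᴶ k ≈ᴶ jet (# 1) (# k) (# tri k)
  z₀-↑ zero = jet≈ (sym const-1) (sym const-0) (sym const-0)
  z₀-↑ (suc k) = 𝕁.trans (𝕁.*-congˡ (z₀-↑ k)) (jet≈
    (⊡-identityˡ _)
    (trans (⊞-cong (⊡-identityˡ _) (⊡-identityˡ _)) (trans (⊞-comm _ _) (sym (#-+ 1 k))))
    (trans (⊞-cong (⊞-cong (⊡-identityˡ _) (⊡-identityˡ _)) (zeroˡ _))
      (trans (⊞-identityʳ _) (trans (⊞-comm _ _) (sym (#-+ k (tri k)))))))

-- Coefficients and determinant of the system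

det : (a b c a′ b′ c′ a″ b″ c″ : FPS) → FPS
det a b c a′ b′ c′ a″ b″ c″ =
  a ⊡ (b′ ⊡ c″ ⊞ ⊟ (c′ ⊡ b″)) ⊞ ⊟ (a′ ⊡ (b ⊡ c″ ⊞ ⊟ (c ⊡ b″))) ⊞ a″ ⊡ (b ⊡ c′ ⊞ ⊟ (c ⊡ b′))

det-cong₁ : ∀ {a a′ a″ x x′ x″} b c b′ c′ b″ c″ → a ≈ x → a′ ≈ x′ → a″ ≈ x″ →
            det a b c a′ b′ c′ a″ b″ c″ ≈ det x b c x′ b′ c′ x″ b″ c″
det-cong₁ b c b′ c′ b″ c″ p r s = ⊞-cong (⊞-cong (⊡-congʳ p) (⊟-cong (⊡-congʳ r))) (⊡-congʳ s)

det-cong₃ : ∀ {c c′ c″ x x′ x″} a b a′ b′ a″ b″ → c ≈ x → c′ ≈ x′ → c″ ≈ x″ →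
            det a b c a′ b′ c′ a″ b″ c″ ≈ det a b x a′ b′ x′ a″ b″ x″
det-cong₃ a b a′ b′ a″ b″ p r s = ⊞-cong (⊞-cong
  (⊡-congˡ (⊞-cong (⊡-congˡ s) (⊟-cong (⊡-congʳ r))))
  (⊟-cong (⊡-congˡ (⊞-cong (⊡-congˡ s) (⊟-cong (⊡-congʳ p))))))
  (⊡-congˡ (⊞-cong (⊡-congˡ r) (⊟-cong (⊡-congʳ p))))

u : FPS
u = # 1 ⊞ ⊟ q

kA : FPS → FPS → FPS → FPS
kA β γ δ = u ⊡ δ ⊞ ⊟ (u ⊡ β) ⊞ ⊟ (# 2 ⊡ γ)

kB : FPS → FPS → FPS
kB α γ = γ ⊞ ⊟ α

kD : FPS → FPS → FPS
kD α β = ⊟ (# 2 ⊡ (q ⊡ α ⊞ u ⊡ β))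

-- Rows: value, first derivative, half second derivative. Columns: the unknowns A/(1-q), B,
-- pC/(1-q). The third row is multiplied by W = q²w, so that every entry is a polynomial in q, w and
-- the tilde series.
m₁₁ m₁₂ m₁₃ m₂₁ m₂₂ m₂₃ m₃₁ m₃₂ m₃₃ r₁ r₂ r₃ : FPS
m₁₁ = u ⊞ kA β̃ γ̃ δ̃
m₁₂ = kB α̃ γ̃
m₁₃ = kD α̃ β̃
m₂₁ = kA ζ̃ η̃ θ̃
m₂₂ = # 1 ⊞ kB ε̃ η̃
m₂₃ = kD ε̃ ζ̃
m₃₁ = W ⊡ kA κ̃ λ̃ μ̃
m₃₂ = W ⊡ kB ι̃ λ̃
m₃₃ = u ↑ 3 ⊞ W ⊡ kD ι̃ κ̃
r₁ = α̃ ⊞ γ̃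
r₂ = ε̃ ⊞ η̃
r₃ = W ⊡ (ι̃ ⊞ λ̃)

private module Eliminate = Elimination SeriesRing ℤ→Series

private
  denominator-identity = vanishing-multiple
    (Eliminate.denominator-det q (qp 2) (qp 3) w α̃ β̃ γ̃ δ̃ ε̃ ζ̃ η̃ θ̃ ι̃ κ̃ λ̃ μ̃) (qp-suc 2)
  numerator-identity = vanishing-multiple
    (Eliminate.numerator-det q (qp 2) (qp 3) w α̃ β̃ γ̃ δ̃ ε̃ ζ̃ η̃ θ̃ ι̃ κ̃ λ̃ μ̃) (qp-suc 1)

opaque
  unfolding _⊞_

  DEN-det : DEN ≈ det m₁₁ m₁₂ m₁₃ m₂₁ m₂₂ m₂₃ m₃₁ m₃₂ m₃₃
  DEN-det = denominator-identity

  NUM-det : NUM ≈ u ⊡ (det r₁ m₁₂ m₁₃ r₂ m₂₂ m₂₃ r₃ m₃₂ m₃₃ ⊞ det m₁₁ m₁₂ r₁ m₂₁ m₂₂ r₂ m₃₁ m₃₂ r₃)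
  NUM-det = numerator-identity

  -- A closed rational number, settled by evaluation.
  DEN-const : DEN 0 0 ≡ 1ℚ
  DEN-const = ≡.refl

  NUM/DEN-⊡ : NUM/DEN ≈ NUM ⊡ DEN ⁻¹
  NUM/DEN-⊡ = refl

-- `T k` stands for the series of all that may follow a simplex column of k + 1 cells. `U k l s`
-- stands for the number of ways, over all gaps, to place after it a duplex column of s cells and
-- then a simplex column of l + 1 cells. Abstracting both separates the algebra from the counting.
module Solution (T : ℕ → FPS) (U : ℕ → ℕ → ℕ → ℕ)
  (U-spec : ∀ k l s → U k l s + 3 * overlaps l k ≡ tri k * (s + 2 * l) + tri l * (s + 2 * k))
  where
  f : ℕ → FPS
  f k = qp (suc k) ⊡ T k

  -- The four summands: nothing follows; a simplex column is next; a duplex column is next and last;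
  -- a duplex column and then a simplex column are next.
  module _ (T-recursion : ∀ k → T k ≈ 𝟙 ⊞ ∑ (λ l → # (suc (k + l)) ⊡ f l)
      ⊞ ∑ (λ a → ∑ (λ b → # tri k ⊡ D a b))
      ⊞ ∑ (λ l → ∑ (λ a → ∑ (λ b → # U k l (2 + (a + b)) ⊡ (D a b ⊡ f l)))))
    where
    open SetoidReasoning setoid
    open Solver

    f-order : ∀ k → Order≥ k (f k)
    f-order k = Order≥-⊡ˡ (T k) (Order≥-weaken (ℕ.n≤1+n k) (Order≥-mono (suc k) 0))

    moment : (ℕ → ℕ) → FPS
    moment a = ∑ (λ k → f k ⊡ # a k)

    A B C : FPS
    A = moment (λ _ → 1)
    B = moment (λ k → k)
    C = moment tri

    moments : ∀ cA cB cC cK k →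
      ∑ (λ l → f l ⊡ (cA ⊡ # 1 ⊞ cB ⊡ # l ⊞ cC ⊡ # tri l ⊞ cK ⊡ # overlaps l k)) ≈
      cA ⊡ A ⊞ cB ⊡ B ⊞ cC ⊡ C ⊞ cK ⊡ moment (λ l → overlaps l k)
    moments cA cB cC cK k = trans
      (∑-cong (λ l → solve 9 (λ f a a′ b b′ c c′ d d′ → f :* (a :* a′ :+ b :* b′ :+ c :* c′ :+ d :* d′) :=
        a :* (f :* a′) :+ b :* (f :* b′) :+ c :* (f :* c′) :+ d :* (f :* d′)) refl
        (f l) cA (# 1) cB (# l) cC (# tri l) cK (# overlaps l k)))
      (trans (∑-⊞ _ _) (⊞-cong (trans (∑-⊞ _ _) (⊞-cong (trans (∑-⊞ _ _)
        (⊞-cong (pull (λ _ → 1) cA) (pull (λ l → l) cB))) (pull tri cC))) (pull (λ l → overlaps l k) cK)))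
      where
      pull : ∀ a c → ∑ (λ l → c ⊡ (f l ⊡ # a l)) ≈ c ⊡ moment a
      pull a c = sym (∑-⊡ c (λ l → Order≥-⊡ˡ (# a l) (f-order l)))

    -- In the ring of series the overlap term can be subtracted. What remains is affine in s, the
    -- form that `duplex-sum` evaluates.
    U-series : ∀ k l s → # U k l s ≈
      (# 2 ⊡ # tri k ⊡ # l ⊞ # 2 ⊡ # tri l ⊡ # k ⊞ ⊟ (# 3 ⊡ # overlaps l k)) ⊞ (# tri k ⊞ # tri l) ⊡ # s
    U-series k l s = begin
      # U k l s ≈⟨ solve 2 (λ u o → u := u :+ lit 3 :* o :- lit 3 :* o) refl (# U k l s) (# overlaps l k) ⟩
      # U k l s ⊞ # 3 ⊡ # overlaps l k ⊞ ⊟ (# 3 ⊡ # overlaps l k) ≈⟨ ⊞-congʳ (begin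
        # U k l s ⊞ # 3 ⊡ # overlaps l k ≈⟨ trans (#-+ (U k l s) (3 * overlaps l k)) (⊞-congˡ (#-* 3 (overlaps l k))) ⟨
        # (U k l s + 3 * overlaps l k) ≡⟨ cong #_ (U-spec k l s) ⟩
        # (tri k * (s + 2 * l) + tri l * (s + 2 * k)) ≈⟨ trans (#-+ (tri k * (s + 2 * l)) (tri l * (s + 2 * k))) (⊞-cong (expand (tri k) l) (expand (tri l) k)) ⟩
        _ ∎) ⟩
      # tri k ⊡ (# s ⊞ # 2 ⊡ # l) ⊞ # tri l ⊡ (# s ⊞ # 2 ⊡ # k) ⊞ ⊟ (# 3 ⊡ # overlaps l k)
        ≈⟨ solve 6 (λ tk tl s l k o → tk :* (s :+ lit 2 :* l) :+ tl :* (s :+ lit 2 :* k) :- lit 3 :* o :=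
             (lit 2 :* tk :* l :+ lit 2 :* tl :* k :- lit 3 :* o) :+ (tk :+ tl) :* s) refl
             (# tri k) (# tri l) (# s) (# l) (# k) (# overlaps l k) ⟩
      _ ∎
      where
      expand : ∀ t l → # (t * (s + 2 * l)) ≈ # t ⊡ (# s ⊞ # 2 ⊡ # l)
      expand t l = trans (#-* t (s + 2 * l)) (⊡-congˡ (trans (#-+ s (2 * l)) (⊞-congˡ (#-* 2 l))))

    -- Coefficients of 1, k and p binom(k,2). A following simplex column gives 1 + k + l, hence A +
    -- B and k A. A duplex column followed by a simplex one gives 2 binom(k,2) l, 2 binom(l,2) k and
    -- s (binom(k,2) + binom(l,2)), where the weights of the duplex columns sum to p and to 2p/(1-q)
    -- when multiplied by s.
    c₀ᶠ c₁ᶠ c₂ᶠ : FPS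
    c₀ᶠ = # 1 ⊞ A ⊞ B ⊞ # 2 ⊡ p ⊡ v 1 ⊡ C
    c₁ᶠ = A ⊞ # 2 ⊡ p ⊡ C
    c₂ᶠ = # 1 ⊞ # 2 ⊡ B ⊞ # 2 ⊡ v 1 ⊡ A

    recursion : ∀ k → f k ≈ qp (suc k) ⊡
      (c₀ᶠ ⊞ c₁ᶠ ⊡ # k ⊞ p ⊡ c₂ᶠ ⊡ # tri k ⊞ ⊟ (# 3 ⊡ p ⊡ ∑ (λ l → f l ⊡ # overlaps l k)))
    recursion k = ⊡-congˡ (begin
      T k ≈⟨ T-recursion k ⟩
      _ ≈⟨ ⊞-cong (⊞-congˡ duplex-end) (∑-cong duplex-simplex) ⟩
      𝟙 ⊞ ∑ (λ l → # (suc (k + l)) ⊡ f l) ⊞ # tri k ⊡ p ⊞ ∑ rest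
        ≈⟨ solve 4 (λ o a b c → o :+ a :+ b :+ c := o :+ b :+ (a :+ c)) refl 𝟙 _ (# tri k ⊡ p) (∑ rest) ⟩
      𝟙 ⊞ # tri k ⊡ p ⊞ (∑ (λ l → # (suc (k + l)) ⊡ f l) ⊞ ∑ rest) ≈⟨ ⊞-cong (⊞-congʳ (sym const-1)) (trans (sym (∑-⊞ _ _))
        (trans (∑-cong collect) (moments _ _ _ _ k))) ⟩
      _ ≈⟨ solve 8 (λ t p k v A B C K →
             lit 1 :+ t :* p :+ ((lit 1 :+ k :+ lit 2 :* p :* v :* t) :* A
               :+ (lit 1 :+ lit 2 :* p :* t) :* B :+ (lit 2 :* p :* k :+ lit 2 :* p :* v) :* C
               :+ (:- (lit 3 :* p)) :* K) :=
             lit 1 :+ A :+ B :+ lit 2 :* p :* v :* C :+ (A :+ lit 2 :* p :* C) :* k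
               :+ p :* (lit 1 :+ lit 2 :* B :+ lit 2 :* v :* A) :* t :+ (:- (lit 3 :* p :* K)))
             refl (# tri k) p (# k) (v 1) A B C (moment (λ l → overlaps l k)) ⟩
      _ ∎)
      where
      rest : ℕ → FPS
      rest l = f l ⊡ ((# 2 ⊡ # tri k ⊡ # l ⊞ # 2 ⊡ # tri l ⊡ # k ⊞ ⊟ (# 3 ⊡ # overlaps l k)) ⊡ p
        ⊞ (# tri k ⊞ # tri l) ⊡ (# 2 ⊡ p ⊡ v 1))
      duplex-end : ∑ (λ a → ∑ (λ b → # tri k ⊡ D a b)) ≈ # tri k ⊡ p
      duplex-end = trans (∑-cong (λ a → ∑-cong (λ b → ⊡-congʳ
          (solve 2 (λ t n → t := t :+ lit 0 :* n) refl (# tri k) (# (2 + (a + b)))))))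
        (trans (duplex-sum (# tri k) (# 0)) (solve 2 (λ x y → x :+ lit 0 :* y := x) refl (# tri k ⊡ p) (# 2 ⊡ p ⊡ v 1)))
      duplex-simplex : ∀ l → ∑ (λ a → ∑ (λ b → # U k l (2 + (a + b)) ⊡ (D a b ⊡ f l))) ≈ rest l
      duplex-simplex l = begin
        _ ≈⟨ ∑-cong (λ a → trans (∑-cong (λ b → trans (⊡-congʳ (U-series k l (2 + (a + b))))
               (solve 3 (λ u d f → u :* (d :* f) := f :* (u :* d)) refl _ (D a b) (f l))))
               (sym (∑-⊡ (f l) (λ b → Order≥-Dʳ a b)))) ⟩
        ∑ (λ a → f l ⊡ ∑ (λ b → _ ⊡ D a b))
          ≈⟨ ∑-⊡ (f l) (λ a → Order≥-∑ (λ b → Order≥-Dˡ a b)) ⟨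
        f l ⊡ ∑ (λ a → ∑ (λ b → _ ⊡ D a b)) ≈⟨ ⊡-congˡ (duplex-sum _ _) ⟩
        rest l ∎
      collect : ∀ l → # (suc (k + l)) ⊡ f l ⊞ rest l ≈ f l ⊡
        ((# 1 ⊞ # k ⊞ # 2 ⊡ p ⊡ v 1 ⊡ # tri k) ⊡ # 1 ⊞ (# 1 ⊞ # 2 ⊡ p ⊡ # tri k) ⊡ # l
          ⊞ (# 2 ⊡ p ⊡ # k ⊞ # 2 ⊡ p ⊡ v 1) ⊡ # tri l ⊞ ⊟ (# 3 ⊡ p) ⊡ # overlaps l k)
      collect l = trans (⊞-congʳ (⊡-congʳ (trans (#-+ 1 (k + l)) (⊞-congˡ (#-+ k l)))))
        (solve 8 (λ k l f tk tl o p v →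
          (lit 1 :+ (k :+ l)) :* f :+ f :* ((lit 2 :* tk :* l :+ lit 2 :* tl :* k :- lit 3 :* o) :* p
            :+ (tk :+ tl) :* (lit 2 :* p :* v)) :=
          f :* ((lit 1 :+ k :+ lit 2 :* p :* v :* tk) :* lit 1 :+ (lit 1 :+ lit 2 :* p :* tk) :* l
            :+ (lit 2 :* p :* k :+ lit 2 :* p :* v) :* tl :+ (:- (lit 3 :* p)) :* o))
          refl (# k) (# l) (f l) (# tri k) (# tri l) (# overlaps l k) p (v 1))

    open FunctionalEquation f f-order c₀ᶠ c₁ᶠ c₂ᶠ recursion using (F; weighted-cong; iterated)

    F-z₀ : F z₀ ≈ᴶ jet A B C
    F-z₀ = 𝕁.trans (weighted-cong z₀-↑) (𝕁.trans (∑ᴶ-cong (λ k → scalar-jet (f k) _ _ _)) (∑ᴶ-jet _ _ _))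

    combination : FPS → FPS → FPS → FPS → FPS
    combination α β γ δ = (c₀ᶠ ⊞ ⊟ c₁ᶠ) ⊡ α ⊞ c₁ᶠ ⊡ β ⊞ (c₂ᶠ ⊞ ⊟ (# 3 ⊡ B)) ⊡ γ ⊞ ⊟ A ⊡ δ

    system : jet A B C ≈ᴶ jet (combination α̃ β̃ γ̃ δ̃) (combination ε̃ ζ̃ η̃ θ̃) (combination ι̃ κ̃ λ̃ μ̃)
    system = 𝕁.trans (𝕁.sym F-z₀) (𝕁.trans iterated (𝕁.trans
      (𝕁.+-cong (𝕁.trans (𝕁.+-cong (𝕁.trans (𝕁.+-cong (term a-jet) (term b-jet)) (jet-⊞ _ _ _ _ _ _)) (term c-jet))
        (jet-⊞ _ _ _ _ _ _)) (term d-jet))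
      (jet-⊞ _ _ _ _ _ _)))
      where
      term : ∀ {s x a b c} → x ≈ᴶ jet a b c → scalar s ⊡ᴶ x ≈ᴶ jet (s ⊡ a) (s ⊡ b) (s ⊡ c)
      term x≈ = 𝕁.trans (𝕁.*-congˡ x≈) (scalar-jet _ _ _ _)

    -- A/(1-q) and pC/(1-q). In these unknowns the determinant is DEN itself, and the wanted A + pC
    -- is 1-q times their sum.
    A′ E : FPS
    A′ = v 1 ⊡ A
    E = v 1 ⊡ p ⊡ C

    kernel : FPS → FPS → FPS → FPS → FPS
    kernel α β γ δ = kA β γ δ ⊡ A′ ⊞ kB α γ ⊡ B ⊞ kD α β ⊡ E

    combination-kernel : ∀ α β γ δ → combination α β γ δ ≈ α ⊞ γ ⊞ ⊟ kernel α β γ δ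
    combination-kernel α β γ δ = vanishing-multiple
      (solve 10 (λ α β γ δ A B C q v p →
        let u = lit 1 :- q
            c₁ = A :+ lit 2 :* p :* C in
        ((lit 1 :+ A :+ B :+ lit 2 :* p :* v :* C) :- c₁) :* α :+ c₁ :* β
          :+ ((lit 1 :+ lit 2 :* B :+ lit 2 :* v :* A) :- lit 3 :* B) :* γ :+ (:- A) :* δ :=
        α :+ γ :- ((u :* δ :- u :* β :- lit 2 :* γ) :* (v :* A) :+ (γ :- α) :* B
          :+ (:- (lit 2 :* (q :* α :+ u :* β))) :* (v :* p :* C))
          :+ (lit 2 :* p :* C :* α :- A :* β :- lit 2 :* p :* C :* β :+ A :* δ) :* (v :- (lit 1 :+ q :* v)))
        refl α β γ δ A B C q (v 1) p)
      (v-equation 0)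

    move : ∀ {x α β γ δ} → x ≈ combination α β γ δ → x ⊞ kernel α β γ δ ≈ α ⊞ γ
    move {x} {α} {β} {γ} {δ} eq = trans (⊞-congʳ (trans eq (combination-kernel α β γ δ)))
      (solve 2 (λ s k → s :- k :+ k := s) refl (α ⊞ γ) (kernel α β γ δ))

    row₁ : m₁₁ ⊡ A′ ⊞ m₁₂ ⊡ B ⊞ m₁₃ ⊡ E ≈ r₁
    row₁ = trans (vanishing-multiple
      (solve 8 (λ k b d B E q v A → ((lit 1 :- q) :+ k) :* (v :* A) :+ b :* B :+ d :* E :=
        A :+ (k :* (v :* A) :+ b :* B :+ d :* E) :+ A :* (v :- (lit 1 :+ q :* v)))
        refl (kA β̃ γ̃ δ̃) m₁₂ m₁₃ B E q (v 1) A)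
      (v-equation 0)) (move (at₀ system))

    row₂ : m₂₁ ⊡ A′ ⊞ m₂₂ ⊡ B ⊞ m₂₃ ⊡ E ≈ r₂
    row₂ = trans (solve 6 (λ k b d B E A → k :* A :+ (lit 1 :+ b) :* B :+ d :* E :=
        B :+ (k :* A :+ b :* B :+ d :* E)) refl m₂₁ (kB ε̃ η̃) m₂₃ B E A′)
      (move (at₁ system))

    -- p = W/(1-q)² gives W C = (1-q)³ E, so multiplying the third equation by W removes C from it.
    -- The explicit multiple in the proof is (uv)³ - 1 factored by uv - 1, where u = 1-q and v is
    -- its inverse.
    row₃ : m₃₁ ⊡ A′ ⊞ m₃₂ ⊡ B ⊞ m₃₃ ⊡ E ≈ r₃
    row₃ = trans (vanishing-multiple
      (solve 9 (λ k b d B C q v A W → let u = lit 1 :- q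
                                          E = v :* (W :* v :^ 2) :* C in
        W :* k :* A :+ W :* b :* B :+ (u :^ 3 :+ W :* d) :* E :=
        W :* (C :+ (k :* A :+ b :* B :+ d :* E))
          :+ W :* C :* (lit 1 :+ u :* v :+ (u :* v) :^ 2) :* (v :- (lit 1 :+ q :* v)))
        refl (kA κ̃ λ̃ μ̃) (kB ι̃ λ̃) (kD ι̃ κ̃) B C q (v 1) A′ W)
      (v-equation 0)) (⊡-congˡ (move (at₂ system)))

    G : FPS
    G = A ⊞ p ⊡ C

    -- Only the sum of the first and third unknowns is wanted, so the two Cramer numerators are
    -- added; DEN is inverted only afterwards.
    G-DEN : G ⊡ DEN ≈ NUM
    G-DEN = begin
      G ⊡ DEN ≈⟨ ⊡-cong (sym G≈) DEN-det ⟩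
      u ⊡ (A′ ⊞ E) ⊡ det m₁₁ m₁₂ m₁₃ m₂₁ m₂₂ m₂₃ m₃₁ m₃₂ m₃₃
        ≈⟨ solve 3 (λ u x d → u :* x :* d := u :* (d :* x)) refl u (A′ ⊞ E) (det m₁₁ m₁₂ m₁₃ m₂₁ m₂₂ m₂₃ m₃₁ m₃₂ m₃₃) ⟩
      u ⊡ (det m₁₁ m₁₂ m₁₃ m₂₁ m₂₂ m₂₃ m₃₁ m₃₂ m₃₃ ⊡ (A′ ⊞ E))
        ≈⟨ ⊡-congˡ (Eliminate.cramer m₁₁ m₁₂ m₁₃ m₂₁ m₂₂ m₂₃ m₃₁ m₃₂ m₃₃ A′ B E) ⟨
      _ ≈⟨ ⊡-congˡ (⊞-cong (det-cong₁ m₁₂ m₁₃ m₂₂ m₂₃ m₃₂ m₃₃ row₁ row₂ row₃)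
             (det-cong₃ m₁₁ m₁₂ m₂₁ m₂₂ m₃₁ m₃₂ row₁ row₂ row₃)) ⟩
      _ ≈⟨ NUM-det ⟨
      NUM ∎
      where
      G≈ : u ⊡ (A′ ⊞ E) ≈ G
      G≈ = vanishing-multiple
        (solve 5 (λ q v p A C → (lit 1 :- q) :* (v :* A :+ v :* p :* C) :=
          A :+ p :* C :+ (A :+ p :* C) :* (v :- (lit 1 :+ q :* v))) refl q (v 1) p A C)
        (v-equation 0)

    G≈NUM/DEN : G ≈ NUM/DEN
    G≈NUM/DEN = begin
      G ≈⟨ ⊡-identityʳ G ⟨
      G ⊡ 𝟙 ≈⟨ ⊡-congˡ (⁻¹-inverse DEN DEN-const) ⟨
      G ⊡ (DEN ⊡ DEN ⁻¹) ≈⟨ ⊡-assoc G DEN (DEN ⁻¹) ⟨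
      G ⊡ DEN ⊡ DEN ⁻¹ ≈⟨ ⊡-congʳ G-DEN ⟩
      NUM ⊡ DEN ⁻¹ ≈⟨ NUM/DEN-⊡ ⟨
      NUM/DEN ∎

    -- The second sum is for polyominoes with a duplex first column. The simplex column after it, of
    -- l + 1 cells, must join its components, in binom(l,2) ways over all gaps; this sums to pC.
    total : ∑ f ⊞ ∑ (λ l → ∑ (λ a → ∑ (λ b → # tri l ⊡ (D a b ⊡ f l)))) ≈ NUM/DEN
    total = trans (⊞-cong simplex duplex) G≈NUM/DEN
      where
      simplex : ∑ f ≈ A
      simplex = ∑-cong (λ l → sym (trans (⊡-congˡ const-1) (⊡-identityʳ (f l))))
      duplex : ∑ (λ l → ∑ (λ a → ∑ (λ b → # tri l ⊡ (D a b ⊡ f l)))) ≈ p ⊡ C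
      duplex = trans (∑-cong (λ l → begin
          ∑ (λ a → ∑ (λ b → # tri l ⊡ (D a b ⊡ f l))) ≈⟨ ∑-cong (λ a → trans (∑-cong (λ b →
              solve 4 (λ t d f s → t :* (d :* f) := t :* f :* ((lit 1 :+ lit 0 :* s) :* d)) refl (# tri l) (D a b) (f l) (# (2 + (a + b)))))
              (sym (∑-⊡ (# tri l ⊡ f l) (λ b → Order≥-Dʳ a b)))) ⟩
          ∑ (λ a → # tri l ⊡ f l ⊡ ∑ (λ b → _ ⊡ D a b))
            ≈⟨ ∑-⊡ (# tri l ⊡ f l) (λ a → Order≥-∑ (λ b → Order≥-Dˡ a b)) ⟨
          # tri l ⊡ f l ⊡ ∑ (λ a → ∑ (λ b → _ ⊡ D a b)) ≈⟨ ⊡-congˡ (duplex-sum (# 1) (# 0)) ⟩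
          # tri l ⊡ f l ⊡ (# 1 ⊡ p ⊞ # 0 ⊡ (# 2 ⊡ p ⊡ v 1))
            ≈⟨ solve 4 (λ t f p v → t :* f :* (lit 1 :* p :+ lit 0 :* (lit 2 :* p :* v)) := p :* (f :* t)) refl (# tri l) (f l) p (v 1) ⟩
          p ⊡ (f l ⊡ # tri l) ∎))
        (sym (∑-⊡ p (λ l → Order≥-⊡ˡ (# tri l) (f-order l))))

-- Finite cardinalities

open Equivalence using (to; from)

private variable
  X Y : Set

unique-⊆-length : {xs ys : List X} → Unique xs → (∀ {x} → x ∈ xs → x ∈ ys) → length xs ≤ length ys
unique-⊆-length [] _ = z≤n
unique-⊆-length {xs = x ∷ xs} {ys} (x∉xs ∷ u) xs⊆ys with ∈.∈-∃++ (xs⊆ys (here ≡.refl))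
... | as , bs , ≡.refl = ℕ.≤-trans (s≤s (unique-⊆-length u ⊆rest)) (ℕ.≤-reflexive eq)
  where
  eq : suc (length (as ++ bs)) ≡ length (as ++ x ∷ bs)
  eq = ≡.trans (cong suc (List.length-++ as)) (≡.sym (≡.trans (List.length-++ as) (ℕ.+-suc (length as) (length bs))))
  ⊆rest : ∀ {y} → y ∈ xs → y ∈ as ++ bs
  ⊆rest y∈xs with ∈.∈-++⁻ as (xs⊆ys (there y∈xs))
  ... | inj₁ y∈as = ∈.∈-++⁺ˡ y∈as
  ... | inj₂ (here ≡.refl) = ⊥-elim (All.lookup x∉xs y∈xs ≡.refl)
  ... | inj₂ (there y∈bs) = ∈.∈-++⁺ʳ as y∈bs

unique-same-length : {xs ys : List X} → Unique xs → Unique ys → (∀ x → (x ∈ xs) ⇔ (x ∈ ys)) → length xs ≡ length ys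
unique-same-length u u′ same = ℕ.≤-antisym
  (unique-⊆-length u (λ {x} → to (same x))) (unique-⊆-length u′ (λ {x} → from (same x)))

unique-map : {xs : List X} (f : X → Y) → (∀ {x y} → x ∈ xs → y ∈ xs → f x ≡ f y → x ≡ y) →
             Unique xs → Unique (map f xs)
unique-map f inj [] = []
unique-map f inj (x∉xs ∷ u) =
  All.map⁺ (All.tabulate (λ y∈xs fx≡fy → All.lookup x∉xs y∈xs (inj (here ≡.refl) (there y∈xs) fx≡fy)))
  ∷ unique-map f (λ x∈ y∈ → inj (there x∈) (there y∈)) u

-- A duplicate-free enumeration, as the theorem asks for one. Any two enumerations of one predicate
-- have equal length, which lets numbers be compared through what they count.
record Card (P : X → Set) (c : ℕ) : Set where
  field
    elements : List X
    unique   : Unique elements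
    complete : ∀ x → (x ∈ elements) ⇔ P x
    size     : length elements ≡ c
open Card public

card-⇔ : ∀ {P Q : X → Set} {c} → (∀ x → P x ⇔ Q x) → Card P c → Card Q c
card-⇔ P⇔Q C = record
  { elements = elements C ; unique = unique C ; size = size C
  ; complete = λ x → mk⇔ (to (P⇔Q x) ∘ to (complete C x)) (from (complete C x) ∘ from (P⇔Q x)) }

card-size : ∀ {P : X → Set} {c d} → c ≡ d → Card P c → Card P d
card-size {P = P} = subst (Card P)

card-unique : ∀ {P : X → Set} {c d} → Card P c → Card P d → c ≡ d
card-unique C D = ≡.trans (≡.sym (size C)) (≡.trans
  (unique-same-length (unique C) (unique D)
    (λ x → mk⇔ (from (complete D x) ∘ to (complete C x)) (from (complete C x) ∘ to (complete D x))))
  (size D))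

card-∅ : ∀ {P : X → Set} → (∀ x → ¬ P x) → Card P 0
card-∅ ¬P = record { elements = [] ; unique = [] ; size = ≡.refl
  ; complete = λ x → mk⇔ (λ ()) (λ px → ⊥-elim (¬P x px)) }

card-singleton : (x : X) → Card (λ y → y ≡ x) 1
card-singleton x = record { elements = x ∷ [] ; unique = [] ∷ [] ; size = ≡.refl
  ; complete = λ y → mk⇔ (λ { (here eq) → eq ; (there ()) }) here }

card-⊎ : ∀ {P Q : X → Set} {c d} → (∀ x → P x → Q x → ⊥) → Card P c → Card Q d → Card (λ x → P x ⊎ Q x) (c + d)
card-⊎ disjoint C D = record
  { elements = elements C ++ elements D
  ; unique = Unique.++⁺ (unique C) (unique D)
      (λ {x} (x∈C , x∈D) → disjoint x (to (complete C x) x∈C) (to (complete D x) x∈D))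
  ; size = ≡.trans (List.length-++ (elements C)) (cong₂ _+_ (size C) (size D))
  ; complete = λ x → mk⇔
      ([ inj₁ ∘ to (complete C x) , inj₂ ∘ to (complete D x) ]′ ∘ ∈.∈-++⁻ (elements C))
      [ ∈.∈-++⁺ˡ ∘ from (complete C x) , ∈.∈-++⁺ʳ (elements C) ∘ from (complete D x) ]′ }

card-map : ∀ {P : X → Set} {c} (f : X → Y) → (∀ {x y} → P x → P y → f x ≡ f y → x ≡ y) →
           Card P c → Card (λ y → ∃ λ x → P x × y ≡ f x) c
card-map f inj C = record
  { elements = map f (elements C)
  ; unique = unique-map f (λ x∈ y∈ → inj (to (complete C _) x∈) (to (complete C _) y∈)) (unique C)
  ; size = ≡.trans (List.length-map f (elements C)) (size C)
  ; complete = λ y → mk⇔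
      (λ y∈ → let x , x∈ , eq = ∈.∈-map⁻ f y∈ in x , to (complete C x) x∈ , eq)
      (λ (x , px , eq) → subst (_∈ map f (elements C)) (≡.sym eq) (∈.∈-map⁺ f (from (complete C x) px))) }

card-∖ : ∀ {P Q : X → Set} {c d} → Decidable Q → (∀ x → Q x → P x) → Card P c → Card Q d →
         Card (λ x → P x × ¬ Q x) (c ∸ d)
card-∖ {P = P} {Q} {c} {d} Q? Q⊆P C D = card-size eq rest
  where
  rest : Card (λ x → P x × ¬ Q x) (length (filter (¬? ∘ Q?) (elements C)))
  rest = record
    { elements = filter (¬? ∘ Q?) (elements C)
    ; unique = Unique.filter⁺ (¬? ∘ Q?) (unique C)
    ; size = ≡.refl
    ; complete = λ x → mk⇔
        (λ x∈ → let x∈C , ¬q = ∈.∈-filter⁻ (¬? ∘ Q?) x∈ in to (complete C x) x∈C , ¬q)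
        (λ (px , ¬q) → ∈.∈-filter⁺ (¬? ∘ Q?) (from (complete C x) px) ¬q) }
  split : Card P (d + length (filter (¬? ∘ Q?) (elements C)))
  split = card-⇔ (λ x → mk⇔ [ Q⊆P x , proj₁ ]′ (decide x)) (card-⊎ (λ _ q (_ , ¬q) → ¬q q) D rest)
    where
    decide : ∀ x → P x → Q x ⊎ (P x × ¬ Q x)
    decide x px with Q? x
    ... | yes qx = inj₁ qx
    ... | no ¬qx = inj₂ (px , ¬qx)
  eq : length (filter (¬? ∘ Q?) (elements C)) ≡ c ∸ d
  eq = ≡.sym (≡.trans (cong (_∸ d) (card-unique C split)) (ℕ.m+n∸m≡n d _))

-- Inclusion-exclusion: P without the intersection, then Q.
card-∪ : ∀ {P Q : X → Set} {c d e} → Decidable (λ x → P x × Q x) → Card P c → Card Q d → Card (λ x → P x × Q x) e →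
         Card (λ x → P x ⊎ Q x) (c + d ∸ e)
card-∪ {P = P} {Q} {c} {d} {e} both? C D E = card-size
  (≡.trans (ℕ.+-comm (c ∸ e) d) (≡.trans (≡.sym (ℕ.+-∸-assoc d e≤c)) (cong (_∸ e) (ℕ.+-comm d c))))
  (card-⇔ (λ x → mk⇔ [ inj₁ ∘ proj₁ , inj₂ ]′ (split x))
    (card-⊎ (λ x (px , ¬pq) qx → ¬pq (px , qx)) (card-∖ both? (λ _ → proj₁) C E) D))
  where
  split : ∀ x → P x ⊎ Q x → (P x × ¬ (P x × Q x)) ⊎ Q x
  split x (inj₂ qx) = inj₂ qx
  split x (inj₁ px) with both? x
  ... | yes (_ , qx) = inj₂ qx
  ... | no ¬pq = inj₁ (px , ¬pq)
  e≤c : e ≤ c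
  e≤c = ≡.subst₂ _≤_ (size E) (size C)
    (unique-⊆-length (unique E) (λ {x} x∈ → from (complete C x) (proj₁ (to (complete E x) x∈))))

Σ< : ℕ → (ℕ → ℕ) → ℕ
Σ< zero f = 0
Σ< (suc n) f = Σ< n f + f n

card-Σ< : ∀ {Q : ℕ → Y → Set} N {c : ℕ → ℕ} → (∀ i → i < N → Card (Q i) (c i)) →
          Card (λ (iy : ℕ × Y) → proj₁ iy < N × Q (proj₁ iy) (proj₂ iy)) (Σ< N c)
card-Σ< zero _ = card-∅ (λ _ ())
card-Σ< {Q = Q} (suc N) Qs = card-⇔ (λ (i , y) → mk⇔
    [ (λ (i<N , q) → ℕ.m≤n⇒m≤1+n i<N , q) , (λ { (_ , q , ≡.refl) → ℕ.≤-refl , q }) ]′ (split i y))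
  (card-⊎ (λ { _ (i<N , _) (_ , _ , ≡.refl) → ℕ.<-irrefl ≡.refl i<N })
    (card-Σ< N (λ i i<N → Qs i (ℕ.m≤n⇒m≤1+n i<N)))
    (card-map (N ,_) (λ { _ _ ≡.refl → ≡.refl }) (Qs N ℕ.≤-refl)))
  where
  split : ∀ i y → i < suc N × Q i y → (i < N × Q i y) ⊎ ∃ λ y′ → Q N y′ × (i , y) ≡ (N , y′)
  split i y (i<1+N , q) with ℕ.m≤n⇒m<n∨m≡n (ℕ.s≤s⁻¹ i<1+N)
  ... | inj₁ i<N = inj₁ (i<N , q)
  ... | inj₂ ≡.refl = inj₂ (y , q , ≡.refl)

-- The fibre may move with x as long as its size does not. Numbers of positions multiply in this way
-- although each range depends on the previous position.
card-× : ∀ {P : X → Set} {Q : X → Y → Set} {c d} → Card P c → (∀ x → P x → Card (Q x) d) →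
         Card (λ (xy : X × Y) → P (proj₁ xy) × Q (proj₁ xy) (proj₂ xy)) (c * d)
card-× {X = X} {Y = Y} {P} {Q} {c} {d} C Qs = card-size (cong (_* d) (size C))
  (card-⇔ (λ (x , y) → mk⇔ (λ (x∈ , q) → to (complete C x) x∈ , q) (λ (px , q) → from (complete C x) px , q))
    (build (elements C) (unique C) (λ x x∈ → Qs x (to (complete C x) x∈))))
  where
  build : (xs : List X) → Unique xs → (∀ x → x ∈ xs → Card (Q x) d) →
          Card (λ (xy : X × Y) → proj₁ xy ∈ xs × Q (proj₁ xy) (proj₂ xy)) (length xs * d)
  build [] _ _ = card-∅ (λ { _ () })
  build (x ∷ xs) (x∉xs ∷ u) Qs = card-⇔ (λ (x′ , y) → mk⇔
      [ (λ { (_ , q , ≡.refl) → here ≡.refl , q }) , (λ (x∈ , q) → there x∈ , q) ]′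
      (λ { (here ≡.refl , q) → inj₁ (y , q , ≡.refl) ; (there x∈ , q) → inj₂ (x∈ , q) }))
    (card-⊎ (λ { _ (_ , _ , ≡.refl) (x∈ , _) → All.lookup x∉xs x∈ ≡.refl })
      (card-map (x ,_) (λ { _ _ ≡.refl → ≡.refl }) (Qs x (here ≡.refl)))
      (build xs u (λ x x∈ → Qs x (there x∈))))

card-between : ∀ lo hi → Card (λ y → lo ≤ y × y < hi) (hi ∸ lo)
card-between lo hi = card-size (≡.trans (List.length-map (lo +_) (upTo (hi ∸ lo))) (List.length-upTo (hi ∸ lo))) (record
  { elements = map (lo +_) (upTo (hi ∸ lo))
  ; unique = unique-map (lo +_) (λ _ _ → ℕ.+-cancelˡ-≡ lo _ _) (Unique.upTo⁺ (hi ∸ lo))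
  ; size = ≡.refl
  ; complete = λ y → mk⇔ (sound y) (λ (lo≤y , y<hi) → subst (_∈ map (lo +_) (upTo (hi ∸ lo))) (ℕ.m+[n∸m]≡n lo≤y)
      (∈.∈-map⁺ (lo +_) (∈.∈-upTo⁺ (ℕ.∸-monoˡ-< y<hi lo≤y)))) })
  where
  sound : ∀ y → y ∈ map (lo +_) (upTo (hi ∸ lo)) → lo ≤ y × y < hi
  sound y y∈ with ∈.∈-map⁻ (lo +_) y∈
  ... | i , i∈ , ≡.refl = ℕ.m≤m+n lo i , ℕ.<-≤-trans (ℕ.+-monoʳ-< lo i<) (ℕ.≤-reflexive (ℕ.m+[n∸m]≡n (ℕ.<⇒≤ lo<hi)))
    where
    i< : i < hi ∸ lo
    i< = ∈.∈-upTo⁻ i∈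
    lo<hi : lo < hi
    lo<hi = ℕ.m∸n≢0⇒n<m (λ eq → ℕ.n≮0 (subst (i <_) eq i<))

-- The condition `s ≤ L` keeps the lower end L - s of the window from being cut off at 0.
card-window : ∀ {s t L R} → s ≤ L → Card (λ y → L ≤ y + s × y + t ≤ R) (suc R + s ∸ (L + t))
card-window {s} {t} {L} {R} s≤L = card-size eq (card-⇔ (λ y → mk⇔
    (λ (l , r) → ℕ.≤-trans (ℕ.m≤n+m∸n L s) (ℕ.≤-trans (ℕ.+-monoʳ-≤ s l) (ℕ.≤-reflexive (ℕ.+-comm s y)))
               , ℕ.s≤s⁻¹ (lower r))
    (λ (l , r) → ℕ.m≤n+o⇒m∸n≤o L s (ℕ.≤-trans l (ℕ.≤-reflexive (ℕ.+-comm y s)))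
               , raise (s≤s r)))
  (card-between (L ∸ s) (suc R ∸ t)))
  where
  lower : ∀ {y} → y < suc R ∸ t → suc (y + t) ≤ suc R
  lower {y} r = ℕ.≤-trans (ℕ.+-monoˡ-≤ t r) (ℕ.≤-reflexive (ℕ.m∸n+n≡m {suc R} {t} (ℕ.<⇒≤ (ℕ.m∸n≢0⇒n<m {suc R} {t} (λ eq → ℕ.n≮0 (subst (y <_) eq r))))))
  raise : ∀ {y} → suc (y + t) ≤ suc R → y < suc R ∸ t
  raise {y} r = ℕ.m+n≤o⇒m≤o∸n (suc y) r
  eq : suc R ∸ t ∸ (L ∸ s) ≡ suc R + s ∸ (L + t)
  eq = begin
    suc R ∸ t ∸ (L ∸ s) ≡⟨ ℕ.∸-+-assoc (suc R) t (L ∸ s) ⟩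
    suc R ∸ (t + (L ∸ s)) ≡⟨ ℕ.[m+n]∸[m+o]≡n∸o s (suc R) (t + (L ∸ s)) ⟨
    (s + suc R) ∸ (s + (t + (L ∸ s))) ≡⟨ cong₂ _∸_ (ℕ.+-comm s (suc R)) (≡.trans (rearrange s t (L ∸ s)) (cong (_+ t) (ℕ.m+[n∸m]≡n s≤L))) ⟩
    suc R + s ∸ (L + t) ∎
    where
    open ≡.≡-Reasoning
    rearrange : ∀ a b c → a + (b + c) ≡ a + c + b
    rearrange a b c = ≡.trans (cong (a +_) (ℕ.+-comm b c)) (≡.sym (ℕ.+-assoc a c b))

-- Column sequences

-- sim y l is the column of the cells y, …, y + l; dup d a g b has a lower component
-- d, …, d + a and, g + 1 cells further up, an upper component with b + 1 cells.
data Col : Set where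
  sim : (y l : ℕ) → Col
  dup : (d a g b : ℕ) → Col

upper : ℕ → ℕ → ℕ → ℕ
upper d a g = d + a + (2 + g)

Touch : ℕ → ℕ → ℕ → ℕ → Set
Touch y l y′ l′ = y ≤ y′ + l′ × y′ ≤ y + l

Both OneOf : ℕ → ℕ → ℕ → ℕ → ℕ → ℕ → Set
Both y l d a g b = Touch y l d a × Touch y l (upper d a g) b
OneOf y l d a g b = Touch y l d a ⊎ Touch y l (upper d a g) b

-- A duplex column between sim z k and sim y l; the second case excludes the first.
Link : ℕ → ℕ → ℕ → ℕ → ℕ → ℕ → ℕ → ℕ → Set
Link z k d a g b y l = (Both z k d a g b × OneOf y l d a g b)
  ⊎ ((OneOf z k d a g b × ¬ Both z k d a g b) × Both y l d a g b)

-- A duplex column at the end has a single neighbour, which must therefore join both components by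
-- itself.
ValidAfter : ℕ → ℕ → List Col → Set
ValidAfter z k [] = ⊤
ValidAfter z k (sim y l ∷ t) = Touch z k y l × ValidAfter y l t
ValidAfter z k (dup d a g b ∷ []) = Both z k d a g b
ValidAfter z k (dup d a g b ∷ sim y l ∷ t) = Link z k d a g b y l × ValidAfter y l t
ValidAfter z k (dup _ _ _ _ ∷ dup _ _ _ _ ∷ t) = ⊥

Valid : List Col → Set
Valid [] = ⊥
Valid (sim z k ∷ t) = ValidAfter z k t
Valid (dup d a g b ∷ []) = ⊥
Valid (dup d a g b ∷ sim y l ∷ t) = Both y l d a g b × ValidAfter y l t
Valid (dup _ _ _ _ ∷ dup _ _ _ _ ∷ t) = ⊥

colArea colDups : Col → ℕ
colArea (sim y l) = suc l
colArea (dup d a g b) = 2 + (a + b)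
colDups (sim y l) = 0
colDups (dup d a g b) = 1

totalArea totalDups : List Col → ℕ
totalArea [] = 0
totalArea (c ∷ t) = colArea c + totalArea t
totalDups [] = 0
totalDups (c ∷ t) = colDups c + totalDups t

-- Numbers of positions of neighbouring columns

touch? : ∀ y l y′ l′ → Dec (Touch y l y′ l′)
touch? y l y′ l′ = (y ℕ.≤? y′ + l′) ×-dec (y′ ℕ.≤? y + l)

both? : ∀ y l d a g b → Dec (Both y l d a g b)
both? y l d a g b = touch? y l d a ×-dec touch? y l (upper d a g) b

d≤upper : ∀ d a g → d ≤ upper d a g
d≤upper d a g = ℕ.≤-trans (ℕ.m≤m+n d a) (ℕ.m≤m+n (d + a) (2 + g))

low<upper : ∀ d a g → suc (d + a) < upper d a g
low<upper d a g = ℕ.≤-trans (ℕ.≤-reflexive (ℕ.+-comm 2 (d + a))) (ℕ.+-monoʳ-≤ (d + a) (ℕ.m≤m+n 2 g))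

-- A simplex column reaching from the lower component up to the upper one covers the gap, so two of
-- the four inequalities imply the others.
both-⇔ : ∀ y l d a g b → (y ≤ d + a × upper d a g ≤ y + l) ⇔ Both y l d a g b
both-⇔ y l d a g b = mk⇔
  (λ (p , r) → (p , ℕ.≤-trans (d≤upper d a g) r)
             , (ℕ.≤-trans p (ℕ.≤-trans (ℕ.m≤m+n (d + a) (2 + g)) (ℕ.m≤m+n (upper d a g) b)) , r))
  (λ ((p , _) , (_ , r)) → p , r)

-- The simplex column covers g + 1 gap cells and a cell on either side, so even g + 2 ≤ l; the
-- weaker bound is enough to make the sums over gaps finite.
both-gap : ∀ {y l d a g b} → Both y l d a g b → g < l
both-gap {y} {l} {d} {a} {g} ((p , _) , (_ , r)) = ℕ.+-cancelˡ-≤ (d + a) (suc g) l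
  (ℕ.≤-trans (ℕ.+-monoʳ-≤ (d + a) (ℕ.n≤1+n (suc g))) (ℕ.≤-trans r (ℕ.+-monoˡ-≤ l p)))

-- The bottom of the simplex column ranges from d + a + 2 + g - l to d + a.
both-count : ℕ → ℕ → ℕ
both-count l g = l ∸ suc g

-- Inclusion-exclusion over the two components, touched in a + l + 1 and b + l + 1 positions, where
-- s = a + b + 2.
oneOf-count : ℕ → ℕ → ℕ → ℕ
oneOf-count l g s = s + 2 * l ∸ both-count l g

card-window₀ : ∀ {s L R} → s ≤ L → Card (λ y → y ≤ R × L ≤ y + s) (suc R + s ∸ L)
card-window₀ {s} {L} {R} s≤L = card-size (cong (suc R + s ∸_) (ℕ.+-identityʳ L)) (card-⇔
  (λ y → mk⇔ (λ (p , r) → subst (_≤ R) (ℕ.+-identityʳ y) r , p) (λ (r , p) → p , subst (_≤ R) (≡.sym (ℕ.+-identityʳ y)) r))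
  (card-window {s} {0} s≤L))

card-touched : ∀ d a l → l ≤ d → Card (λ y → Touch y l d a) (suc (a + l))
card-touched d a l l≤d = card-size (≡.trans (cong (_∸ d) (eq d a l)) (ℕ.m+n∸m≡n d _)) (card-window₀ l≤d)
  where
  eq : ∀ d a l → suc (d + a) + l ≡ d + suc (a + l)
  eq = solve-∀

card-both-right : ∀ d a g b l → l ≤ upper d a g → Card (λ y → Both y l d a g b) (both-count l g)
card-both-right d a g b l l≤ = card-size (≡.trans (cong (suc (d + a) + l ∸_) (eq d a g)) (ℕ.[m+n]∸[m+o]≡n∸o (suc (d + a)) l (suc g)))
  (card-⇔ (λ y → both-⇔ y l d a g b) (card-window₀ l≤))
  where
  eq : ∀ d a g → d + a + (2 + g) ≡ suc (d + a) + suc g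
  eq = solve-∀

card-oneOf-right : ∀ d a g b l → l ≤ d → Card (λ y → OneOf y l d a g b) (oneOf-count l g (2 + (a + b)))
card-oneOf-right d a g b l l≤d = card-size (cong (_∸ both-count l g) (eq a b l))
  (card-∪ (λ y → both? y l d a g b) (card-touched d a l l≤d) (card-touched (upper d a g) b l l≤upper)
    (card-both-right d a g b l l≤upper))
  where
  l≤upper : l ≤ upper d a g
  l≤upper = ℕ.≤-trans l≤d (d≤upper d a g)
  eq : ∀ a b l → suc (a + l) + suc (b + l) ≡ 2 + (a + b) + 2 * l
  eq = solve-∀

card-touch : ∀ z k l → l ≤ z → Card (λ y → Touch z k y l) (suc (k + l))
card-touch z k l l≤z = card-size (≡.trans (cong (_∸ z) (eq z k l)) (ℕ.m+n∸m≡n z _))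
  (card-⇔ (λ y → mk⇔ (λ (p , r) → r , p) (λ (p , r) → r , p)) (card-window₀ l≤z))
  where
  eq : ∀ z k l → suc (z + k) + l ≡ z + suc (k + l)
  eq = solve-∀

upper-assoc : ∀ d a g → d + (a + (2 + g)) ≡ upper d a g
upper-assoc d a g = ≡.sym (ℕ.+-assoc d a (2 + g))

-- Now the simplex column is fixed and the duplex column moves. The count agrees with the one for a
-- moving simplex column, as only relative positions matter.
card-both-left : ∀ z k a g b → a ≤ z → Card (λ d → Both z k d a g b) (both-count k g)
card-both-left z k a g b a≤z = card-size
  (≡.trans (cong₂ _∸_ (eq₁ z k a) (eq₂ z a g)) (ℕ.[m+n]∸[m+o]≡n∸o (suc (z + a)) k (suc g)))
  (card-⇔ (λ d → mk⇔
      (λ (p , r) → to (both-⇔ z k d a g b) (p , subst (_≤ z + k) (upper-assoc d a g) r))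
      (λ both → let p , r = from (both-⇔ z k d a g b) both in p , subst (_≤ z + k) (≡.sym (upper-assoc d a g)) r))
    (card-window {a} {a + (2 + g)} a≤z))
  where
  eq₁ : ∀ z k a → suc (z + k) + a ≡ suc (z + a) + k
  eq₁ = solve-∀
  eq₂ : ∀ z a g → z + (a + (2 + g)) ≡ suc (z + a) + suc g
  eq₂ = solve-∀

card-up-left : ∀ z k a g b → a + (2 + g) + b ≤ z → Card (λ d → Touch z k (upper d a g) b) (suc (k + b))
card-up-left z k a g b ≤z = card-size
  (≡.trans (cong (_∸ (z + (a + (2 + g)))) (eq z k (a + (2 + g)) b)) (ℕ.m+n∸m≡n (z + (a + (2 + g))) _))
  (card-⇔ (λ d → mk⇔
      (λ (p , r) → subst (z ≤_) (assoc d) p , subst (_≤ z + k) (upper-assoc d a g) r)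
      (λ (p , r) → subst (z ≤_) (≡.sym (assoc d)) p , subst (_≤ z + k) (≡.sym (upper-assoc d a g)) r))
    (card-window {a + (2 + g) + b} {a + (2 + g)} ≤z))
  where
  eq : ∀ z k c b → suc (z + k) + (c + b) ≡ z + c + suc (k + b)
  eq = solve-∀
  assoc : ∀ d → d + (a + (2 + g) + b) ≡ upper d a g + b
  assoc d = ≡.trans (≡.sym (ℕ.+-assoc d (a + (2 + g)) b)) (cong (_+ b) (upper-assoc d a g))

card-oneOf-left : ∀ z k a g b → a + (2 + g) + b ≤ z → Card (λ d → OneOf z k d a g b) (oneOf-count k g (2 + (a + b)))
card-oneOf-left z k a g b ≤z = card-size
  (cong (_∸ both-count k g) (eq k a b))
  (card-∪ (λ d → both? z k d a g b) (card-touch z k a a≤z) (card-up-left z k a g b ≤z) (card-both-left z k a g b a≤z))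
  where
  a≤z : a ≤ z
  a≤z = ℕ.≤-trans (ℕ.≤-trans (ℕ.m≤m+n a (2 + g)) (ℕ.m≤m+n (a + (2 + g)) b)) ≤z
  eq : ∀ k a b → suc (k + a) + suc (k + b) ≡ 2 + (a + b) + 2 * k
  eq = solve-∀

links : ℕ → ℕ → ℕ → ℕ
links k l s = Σ< k (λ g → both-count k g * oneOf-count l g s)
  + Σ< l (λ g → (oneOf-count k g s ∸ both-count k g) * both-count l g)

-- The two summands of `links` are the two disjoint cases of `Link`. The bound on z is the area of
-- the two columns being placed, which keeps all their positions above 0.
card-links : ∀ z k l a b → 3 + (a + b + l) ≤ z →
  Card (λ ((g , d , y) : ℕ × ℕ × ℕ) → Link z k d a g b y l) (links k l (2 + (a + b)))
card-links z k l a b ≤z = card-⊎ (λ _ (both , _) ((_ , ¬both) , _) → ¬both both)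
  (card-⇔ (λ (g , d , y) → mk⇔ proj₂ (λ (both , one) → both-gap {z} {k} {d} {a} {g} {b} both , both , one))
    (card-Σ< k (λ g _ → card-× (card-both-left z k a g b a≤z) (λ d both → card-oneOf-right d a g b l (l≤d d both)))))
  (card-⇔ (λ (g , d , y) → mk⇔ proj₂ (λ (left , both) → both-gap {y} {l} {d} {a} {g} {b} both , left , both))
    (card-Σ< l (λ g g<l → card-×
      (card-∖ (λ d → both? z k d a g b) (λ _ both → inj₁ (proj₁ both)) (card-oneOf-left z k a g b (≤z′ g g<l)) (card-both-left z k a g b a≤z))
      (λ d (one , _) → card-both-right d a g b l (l≤upper g d one)))))
  where
  a≤z : a ≤ z
  a≤z = ℕ.≤-trans (ℕ.≤-trans (ℕ.m≤m+n a b) (ℕ.≤-trans (ℕ.m≤m+n (a + b) l) (ℕ.m≤n+m (a + b + l) 3))) ≤z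
  a+l≤z : a + l ≤ z
  a+l≤z = ℕ.≤-trans (ℕ.≤-trans (ℕ.+-monoˡ-≤ l (ℕ.m≤m+n a b)) (ℕ.m≤n+m (a + b + l) 3)) ≤z
  b+l≤z : b + l ≤ z
  b+l≤z = ℕ.≤-trans (ℕ.≤-trans (ℕ.+-monoˡ-≤ l (ℕ.m≤n+m b a)) (ℕ.m≤n+m (a + b + l) 3)) ≤z
  l≤d : ∀ d {g} → Both z k d a g b → l ≤ d
  l≤d d ((p , _) , _) = ℕ.+-cancelʳ-≤ a l d (ℕ.≤-trans (ℕ.≤-reflexive (ℕ.+-comm l a)) (ℕ.≤-trans a+l≤z p))
  -- A duplex column hanging by its upper component also reaches down past the gap. The simplex
  -- column after it has to cover that gap, so g < l charges it to the area l + 1.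
  ≤z′ : ∀ g → g < l → a + (2 + g) + b ≤ z
  ≤z′ g g<l = ℕ.≤-trans (ℕ.≤-trans (ℕ.≤-reflexive (eq a g b)) (s≤s (ℕ.≤-trans (ℕ.+-monoʳ-≤ (a + b) g<l) (ℕ.m≤n+m (a + b + l) 2)))) ≤z
    where
    eq : ∀ a g b → a + (2 + g) + b ≡ 1 + (a + b + suc g)
    eq = solve-∀
  l≤upper : ∀ g d → OneOf z k d a g b → l ≤ upper d a g
  l≤upper g d (inj₁ (p , _)) = ℕ.≤-trans (ℕ.m≤n+m l a) (ℕ.≤-trans a+l≤z (ℕ.≤-trans p (ℕ.m≤m+n (d + a) (2 + g))))
  l≤upper g d (inj₂ (p , _)) = ℕ.+-cancelʳ-≤ b l _ (ℕ.≤-trans (ℕ.≤-reflexive (ℕ.+-comm l b)) (ℕ.≤-trans b+l≤z p))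

Σ<-head : ∀ n f → Σ< (suc n) f ≡ f 0 + Σ< n (f ∘ suc)
Σ<-head zero f = ≡.sym (ℕ.+-identityʳ (f 0))
Σ<-head (suc n) f = ≡.trans (cong (_+ f (suc n)) (Σ<-head n f)) (ℕ.+-assoc (f 0) _ _)

Σ<-cong : ∀ n {f g : ℕ → ℕ} → (∀ i → f i ≡ g i) → Σ< n f ≡ Σ< n g
Σ<-cong zero f≡g = ≡.refl
Σ<-cong (suc n) f≡g = cong₂ _+_ (Σ<-cong n f≡g) (f≡g n)

Σ<-+ : ∀ n f g → Σ< n (λ i → f i + g i) ≡ Σ< n f + Σ< n g
Σ<-+ zero f g = ≡.refl
Σ<-+ (suc n) f g = ≡.trans (cong (_+ (f n + g n)) (Σ<-+ n f g)) (regroup (Σ< n f) (Σ< n g) (f n) (g n))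
  where
  regroup : ∀ a b c d → a + b + (c + d) ≡ a + c + (b + d)
  regroup = solve-∀

Σ<-*ʳ : ∀ n f c → Σ< n (λ i → f i * c) ≡ Σ< n f * c
Σ<-*ʳ zero f c = ≡.refl
Σ<-*ʳ (suc n) f c = ≡.trans (cong (_+ f n * c) (Σ<-*ʳ n f c)) (≡.sym (ℕ.*-distribʳ-+ c (Σ< n f) (f n)))

Σ<-both-count : ∀ k → Σ< k (both-count k) ≡ tri k
Σ<-both-count zero = ≡.refl
Σ<-both-count (suc k) = ≡.trans (Σ<-head k (both-count (suc k))) (cong (k +_) (Σ<-both-count k))

Σ<-zero : ∀ n → Σ< n (λ _ → 0) ≡ 0
Σ<-zero zero = ≡.refl
Σ<-zero (suc n) = ≡.trans (ℕ.+-identityʳ _) (Σ<-zero n)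

-- The products vanish once g + 1 reaches k or l, so summing up to k here and up to l below gives
-- the same number.
Σ<-overlapsˡ : ∀ k l → Σ< k (λ g → both-count k g * both-count l g) ≡ overlaps l k
Σ<-overlapsˡ zero zero = ≡.refl
Σ<-overlapsˡ zero (suc l) = ≡.refl
Σ<-overlapsˡ (suc k) zero = ≡.trans (Σ<-cong (suc k) (λ g → ℕ.*-zeroʳ (both-count (suc k) g))) (Σ<-zero (suc k))
Σ<-overlapsˡ (suc k) (suc l) = ≡.trans (Σ<-head k _) (cong₂ _+_ (ℕ.*-comm k l) (Σ<-overlapsˡ k l))

Σ<-overlapsʳ : ∀ k l → Σ< l (λ g → both-count k g * both-count l g) ≡ overlaps l k
Σ<-overlapsʳ zero zero = ≡.refl
Σ<-overlapsʳ zero (suc l) = Σ<-zero (suc l)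
Σ<-overlapsʳ (suc k) zero = ≡.refl
Σ<-overlapsʳ (suc k) (suc l) = ≡.trans (Σ<-head l _) (cong₂ _+_ (ℕ.*-comm k l) (Σ<-overlapsʳ k l))

both≤oneOf : ∀ k g s → both-count k g ≤ s + 2 * k
both≤oneOf k g s = ℕ.≤-trans (ℕ.m∸n≤m k (suc g)) (ℕ.≤-trans (ℕ.m≤m+n k (k + 0)) (ℕ.m≤n+m (2 * k) s))

-- The origin of the factor 3. With b and b′ the numbers of positions meeting both components on the
-- two sides, the first case gives b (s + 2l - b′), the second (s + 2k - 2b) b′; together they lose
-- 3 b b′ for each gap. The loss is moved to the left to stay in ℕ.
links-spec : ∀ k l s → links k l s + 3 * overlaps l k ≡ tri k * (s + 2 * l) + tri l * (s + 2 * k)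
links-spec k l s = begin
  s₁ + s₂ + 3 * o ≡⟨ rearrange s₁ s₂ o ⟩
  (s₁ + o) + (s₂ + (o + o)) ≡⟨ cong₂ _+_ first second ⟩
  tri k * (s + 2 * l) + tri l * (s + 2 * k) ∎
  where
  open ≡.≡-Reasoning
  o s₁ s₂ : ℕ
  o = overlaps l k
  s₁ = Σ< k (λ g → both-count k g * oneOf-count l g s)
  s₂ = Σ< l (λ g → (oneOf-count k g s ∸ both-count k g) * both-count l g)
  rearrange : ∀ s₁ s₂ o → s₁ + s₂ + 3 * o ≡ (s₁ + o) + (s₂ + (o + o))
  rearrange = solve-∀
  first : s₁ + o ≡ tri k * (s + 2 * l)
  first = begin
    s₁ + o ≡⟨ cong (s₁ +_) (Σ<-overlapsˡ k l) ⟨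
    s₁ + Σ< k (λ g → both-count k g * both-count l g) ≡⟨ Σ<-+ k _ _ ⟨
    Σ< k (λ g → both-count k g * oneOf-count l g s + both-count k g * both-count l g)
      ≡⟨ Σ<-cong k (λ g → ≡.trans (≡.sym (ℕ.*-distribˡ-+ (both-count k g) (oneOf-count l g s) (both-count l g)))
           (cong (both-count k g *_) (ℕ.m∸n+n≡m (both≤oneOf l g s)))) ⟩
    Σ< k (λ g → both-count k g * (s + 2 * l)) ≡⟨ Σ<-*ʳ k (both-count k) (s + 2 * l) ⟩
    Σ< k (both-count k) * (s + 2 * l) ≡⟨ cong (_* (s + 2 * l)) (Σ<-both-count k) ⟩
    tri k * (s + 2 * l) ∎
  second : s₂ + (o + o) ≡ tri l * (s + 2 * k)
  second = begin
    s₂ + (o + o) ≡⟨ cong (λ x → s₂ + (x + x)) (Σ<-overlapsʳ k l) ⟨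
    s₂ + (Σ< l (λ g → both-count k g * both-count l g) + Σ< l (λ g → both-count k g * both-count l g))
      ≡⟨ cong (s₂ +_) (Σ<-+ l _ _) ⟨
    s₂ + Σ< l (λ g → both-count k g * both-count l g + both-count k g * both-count l g) ≡⟨ Σ<-+ l _ _ ⟨
    Σ< l (λ g → (oneOf-count k g s ∸ both-count k g) * both-count l g
      + (both-count k g * both-count l g + both-count k g * both-count l g))
      ≡⟨ Σ<-cong l (λ g → ≡.trans (factor (oneOf-count k g s ∸ both-count k g) (both-count k g) (both-count l g))
           (cong (both-count l g *_) (≡.trans (cong (_+ both-count k g) (ℕ.m∸n+n≡m (twice≤ g))) (ℕ.m∸n+n≡m (both≤oneOf k g s))))) ⟩
    Σ< l (λ g → both-count l g * (s + 2 * k)) ≡⟨ Σ<-*ʳ l (both-count l) (s + 2 * k) ⟩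
    Σ< l (both-count l) * (s + 2 * k) ≡⟨ cong (_* (s + 2 * k)) (Σ<-both-count l) ⟩
    tri l * (s + 2 * k) ∎
    where
    factor : ∀ x y z → x * z + (y * z + y * z) ≡ z * (x + y + y)
    factor = solve-∀
    twice≤ : ∀ g → both-count k g ≤ oneOf-count k g s
    twice≤ g = ℕ.m+n≤o⇒m≤o∸n (both-count k g) (ℕ.≤-trans
      (ℕ.+-mono-≤ (ℕ.m∸n≤m k (suc g)) (ℕ.m∸n≤m k (suc g)))
      (ℕ.≤-trans (ℕ.≤-reflexive (cong (k +_) (≡.sym (ℕ.+-identityʳ k)))) (ℕ.m≤n+m (2 * k) s)))

-- Counting column sequences by area and number of duplex columns

Shifted : ℕ → ℕ → (ℕ → ℕ → X → Set) → ℕ → ℕ → X → Set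
Shifted a b P n m x = ∃ λ n′ → ∃ λ m′ → n ≡ a + n′ × m ≡ b + m′ × P n′ m′ x

-- Splitting off a part with area a and b duplex columns corresponds to multiplication by q^a w^b.
card-shift : ∀ a b {P : ℕ → ℕ → X → Set} {h} n m → (∀ n′ m′ → n ≡ a + n′ → m ≡ b + m′ → Card (P n′ m′) (h n′ m′)) →
             Card (Shifted a b P n m) (shift 0 a b h n m)
card-shift zero zero n m C = card-⇔
  (λ x → mk⇔ (λ p → n , m , ≡.refl , ≡.refl , p) (λ { (_ , _ , ≡.refl , ≡.refl , p) → p })) (C n m ≡.refl ≡.refl)
card-shift zero (suc b) n zero C = card-∅ (λ { _ (_ , _ , _ , () , _) })
card-shift zero (suc b) n (suc m) C = card-⇔
  (λ x → mk⇔ (λ { (_ , _ , ≡.refl , ≡.refl , p) → _ , _ , ≡.refl , ≡.refl , p })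
             (λ { (_ , _ , ≡.refl , ≡.refl , p) → _ , _ , ≡.refl , ≡.refl , p }))
  (card-shift zero b n m (λ n′ m′ eq eq′ → C n′ m′ eq (cong suc eq′)))
card-shift (suc a) b zero m C = card-∅ (λ { _ (_ , _ , () , _ , _) })
card-shift (suc a) b (suc n) m C = card-⇔
  (λ x → mk⇔ (λ { (_ , _ , ≡.refl , ≡.refl , p) → _ , _ , ≡.refl , ≡.refl , p })
             (λ { (_ , _ , ≡.refl , ≡.refl , p) → _ , _ , ≡.refl , ≡.refl , p }))
  (card-shift a b n m (λ n′ m′ eq eq′ → C n′ m′ (cong suc eq) eq′))

shift-* : ∀ a b u h n m → shift 0 a b (λ n m → u * h n m) n m ≡ u * shift 0 a b h n m
shift-* zero zero u h n m = ≡.refl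
shift-* zero (suc b) u h n zero = ≡.sym (ℕ.*-zeroʳ u)
shift-* zero (suc b) u h n (suc m) = shift-* zero b u h n m
shift-* (suc a) b u h zero m = ≡.sym (ℕ.*-zeroʳ u)
shift-* (suc a) b u h (suc n) m = shift-* a b u h n m

shift-cong : ∀ {X : Set} {z : X} a b {h h′ : ℕ → ℕ → X} → (∀ n m → h n m ≡ h′ n m) → ∀ n m → shift z a b h n m ≡ shift z a b h′ n m
shift-cong zero zero eq n m = eq n m
shift-cong zero (suc b) eq n zero = ≡.refl
shift-cong zero (suc b) eq n (suc m) = shift-cong zero b eq n m
shift-cong (suc a) b eq zero m = ≡.refl
shift-cong (suc a) b eq (suc n) m = shift-cong a b eq n m

one : ℕ → ℕ → ℕ
one zero zero = 1
one zero (suc m) = 0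
one (suc n) m = 0

card-one : (x : X) → ∀ n m → Card (λ y → y ≡ x × n ≡ 0 × m ≡ 0) (one n m)
card-one x zero zero = card-⇔ (λ y → mk⇔ (λ eq → eq , ≡.refl , ≡.refl) proj₁) (card-singleton x)
card-one x zero (suc m) = card-∅ (λ { _ (_ , _ , ()) })
card-one x (suc n) m = card-∅ (λ { _ (_ , () , _) })

Tail : ℕ → ℕ → ℕ → ℕ → List Col → Set
Tail z k n m t = ValidAfter z k t × totalArea t ≡ n × totalDups t ≡ m

extend-simplex extend-duplex : (ℕ → ℕ → ℕ → ℕ) → ℕ → ℕ → ℕ → ℕ
extend-simplex h k n m = Σ< (suc n) (λ l → suc (k + l) * shift 0 (suc l) 0 (h l) n m)
extend-duplex h k n m = Σ< (suc n) (λ l → Σ< (suc n) (λ a → Σ< (suc n) (λ b →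
  links k l (2 + (a + b)) * shift 0 (2 + (a + b)) 1 (shift 0 (suc l) 0 (h l)) n m)))

end-duplex : ℕ → ℕ → ℕ → ℕ
end-duplex k n m = Σ< (suc n) (λ a → Σ< (suc n) (λ b → tri k * shift 0 (2 + (a + b)) 1 one n m))

-- The right side of the recursion for `T`, coefficient by coefficient, with h in the place of the
-- counts of shorter tails.
extend : (ℕ → ℕ → ℕ → ℕ) → ℕ → ℕ → ℕ → ℕ
extend h k n m = one n m + extend-simplex h k n m + end-duplex k n m + extend-duplex h k n m

within-left : ∀ a b r → a < suc (2 + (a + b) + r)
within-left a b r = s≤s (ℕ.≤-trans (ℕ.m≤m+n a b) (ℕ.≤-trans (ℕ.m≤n+m (a + b) 2) (ℕ.m≤m+n (2 + (a + b)) r)))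

within-right : ∀ a b r → b < suc (2 + (a + b) + r)
within-right a b r = s≤s (ℕ.≤-trans (ℕ.m≤n+m b a) (ℕ.≤-trans (ℕ.m≤n+m (a + b) 2) (ℕ.m≤m+n (2 + (a + b)) r)))

within-next : ∀ l s r → l < suc (s + (suc l + r))
within-next l s r = s≤s (ℕ.≤-trans (ℕ.≤-trans (ℕ.n≤1+n l) (ℕ.m≤m+n (suc l) r)) (ℕ.m≤n+m (suc l + r) s))

-- The invariant n ≤ z says that the height of the last column is at least the area still to come;
-- it makes the count independent of z. Keeping h abstract serves both the truncated recursion and
-- `tailCount`.
module Extension (h : ℕ → ℕ → ℕ → ℕ) (z k n m : ℕ) (n≤z : n ≤ z)
  (tails : ∀ y l n′ m′ → n′ < n → n′ ≤ y → Card (Tail y l n′ m′) (h l n′ m′)) where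

  card-extend-simplex : Card (λ (t : List Col) → ∃ λ ((l , y , t′) : ℕ × ℕ × List Col) →
    (l < suc n × Shifted (suc l) 0 (λ n′ m′ (y , t′) → Touch z k y l × Tail y l n′ m′ t′) n m (y , t′))
    × t ≡ sim y l ∷ t′) (extend-simplex h k n m)
  card-extend-simplex = card-map (λ (l , y , t′) → sim y l ∷ t′) (λ { _ _ ≡.refl → ≡.refl })
    (card-Σ< (suc n) (λ l l≤n → card-size (shift-* (suc l) 0 (suc (k + l)) (h l) n m)
      (card-shift (suc l) 0 n m (λ n′ m′ n≡ m≡ →
        card-× (card-touch z k l (ℕ.≤-trans (ℕ.s≤s⁻¹ l≤n) n≤z))
          (λ y touch → tails y l n′ m′ (n′<n l n≡) (n′≤y l y n≡ (proj₁ touch)))))))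
    where
    n′<n : ∀ l {n′} → n ≡ suc l + n′ → n′ < n
    n′<n l {n′} ≡.refl = s≤s (ℕ.m≤n+m n′ l)
    n′≤y : ∀ l y {n′} → n ≡ suc l + n′ → z ≤ y + l → n′ ≤ y
    n′≤y l y {n′} ≡.refl z≤ = ℕ.+-cancelʳ-≤ l n′ y (ℕ.≤-trans (ℕ.≤-reflexive (ℕ.+-comm n′ l)) (ℕ.≤-trans (ℕ.n≤1+n (l + n′)) (ℕ.≤-trans n≤z z≤)))

  card-end-duplex : Card (λ (t : List Col) → ∃ λ ((a , b , (g , d) , e) : ℕ × ℕ × (ℕ × ℕ) × ⊤) →
    (a < suc n × b < suc n × Shifted (2 + (a + b)) 1
      (λ n′ m′ ((g , d) , e) → (g < k × Both z k d a g b) × e ≡ tt × n′ ≡ 0 × m′ ≡ 0) n m ((g , d) , e))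
    × t ≡ dup d a g b ∷ []) (end-duplex k n m)
  card-end-duplex = card-map (λ (a , b , (g , d) , _) → dup d a g b ∷ []) (λ { _ _ ≡.refl → ≡.refl })
    (card-Σ< (suc n) (λ a a≤n → card-Σ< (suc n) (λ b _ → card-size (shift-* (2 + (a + b)) 1 (tri k) one n m)
      (card-shift (2 + (a + b)) 1 n m (λ n′ m′ _ _ → card-×
        (card-size (Σ<-both-count k) (card-Σ< k (λ g _ → card-both-left z k a g b (ℕ.≤-trans (ℕ.s≤s⁻¹ a≤n) n≤z))))
        (λ _ _ → card-one tt n′ m′))))))

  card-extend-duplex : Card (λ (t : List Col) → ∃ λ ((l , a , b , (g , d , y) , t′) : ℕ × ℕ × ℕ × (ℕ × ℕ × ℕ) × List Col) →
    (l < suc n × a < suc n × b < suc n × Shifted (2 + (a + b)) 1 (Shifted (suc l) 0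
      (λ n′ m′ ((g , d , y) , t′) → Link z k d a g b y l × Tail y l n′ m′ t′)) n m ((g , d , y) , t′))
    × t ≡ dup d a g b ∷ sim y l ∷ t′) (extend-duplex h k n m)
  card-extend-duplex = card-map (λ (l , a , b , (g , d , y) , t′) → dup d a g b ∷ sim y l ∷ t′) (λ { _ _ ≡.refl → ≡.refl })
    (card-Σ< (suc n) (λ l _ → card-Σ< (suc n) (λ a _ → card-Σ< (suc n) (λ b _ →
      card-size (≡.trans (shift-cong (2 + (a + b)) 1 (shift-* (suc l) 0 (links k l (2 + (a + b))) (h l)) n m)
          (shift-* (2 + (a + b)) 1 (links k l (2 + (a + b))) (shift 0 (suc l) 0 (h l)) n m))
        (card-shift (2 + (a + b)) 1 n m (λ n₁ m₁ n≡ _ → card-shift (suc l) 0 n₁ m₁ (λ n′ m′ n₁≡ _ →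
          card-× (card-links z k l a b (fits l a b (n-split l a b n≡ n₁≡)))
            (λ (g , d , y) link → tails y l n′ m′ (n′<n l a b (n-split l a b n≡ n₁≡))
              (n′≤y l a b g d y (n-split l a b n≡ n₁≡) link)))))))))
    where
    n-split : ∀ l a b {n₁ n′} → n ≡ 2 + (a + b) + n₁ → n₁ ≡ suc l + n′ → n ≡ 3 + (a + b + l) + n′
    n-split l a b {n′ = n′} ≡.refl ≡.refl = eq a b l n′
      where
      eq : ∀ a b l n′ → 2 + (a + b) + (suc l + n′) ≡ 3 + (a + b + l) + n′
      eq = solve-∀
    fits : ∀ l a b {n′} → n ≡ 3 + (a + b + l) + n′ → 3 + (a + b + l) ≤ z
    fits l a b {n′} n≡ = ℕ.≤-trans (ℕ.m≤m+n (3 + (a + b + l)) n′) (subst (_≤ z) n≡ n≤z)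
    n′<n : ∀ l a b {n′} → n ≡ 3 + (a + b + l) + n′ → n′ < n
    n′<n l a b {n′} ≡.refl = s≤s (ℕ.m≤n+m n′ (2 + (a + b + l)))
    -- The invariant for the next column: following the touching components from z down to y costs
    -- at most a or b, then l, and all of that is part of the area used up.
    n′≤y : ∀ l a b g d y {n′} → n ≡ 3 + (a + b + l) + n′ → Link z k d a g b y l → n′ ≤ y
    n′≤y l a b g d y {n′} n≡ link = ℕ.+-cancelʳ-≤ l n′ y (reach link)
      where
      budget : 3 + (a + b + l) + n′ ≤ z
      budget = subst (_≤ z) n≡ n≤z
      budget-a : n′ + l + a ≤ z
      budget-a = ℕ.≤-trans (ℕ.≤-trans (ℕ.m≤n+m (n′ + l + a) (3 + b)) (ℕ.≤-reflexive (eq a b l n′))) budget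
        where
        eq : ∀ a b l n′ → 3 + b + (n′ + l + a) ≡ 3 + (a + b + l) + n′
        eq = solve-∀
      budget-b : n′ + l + b ≤ z
      budget-b = ℕ.≤-trans (ℕ.≤-trans (ℕ.m≤n+m (n′ + l + b) (3 + a)) (ℕ.≤-reflexive (eq a b l n′))) budget
        where
        eq : ∀ a b l n′ → 3 + a + (n′ + l + b) ≡ 3 + (a + b + l) + n′
        eq = solve-∀
      from-low : z ≤ d + a → n′ + l ≤ d
      from-low p = ℕ.+-cancelʳ-≤ a _ d (ℕ.≤-trans budget-a p)
      from-up : z ≤ upper d a g + b → n′ + l ≤ upper d a g
      from-up p = ℕ.+-cancelʳ-≤ b _ (upper d a g) (ℕ.≤-trans budget-b p)
      reach : Link z k d a g b y l → n′ + l ≤ y + l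
      reach (inj₁ (((p , _) , _) , inj₁ (_ , r))) = ℕ.≤-trans (from-low p) r
      reach (inj₁ (((p , _) , _) , inj₂ (_ , r))) = ℕ.≤-trans (from-low p) (ℕ.≤-trans (d≤upper d a g) r)
      reach (inj₂ ((inj₁ (p , _) , _) , ((_ , r) , _))) = ℕ.≤-trans (from-low p) r
      reach (inj₂ ((inj₂ (p , _) , _) , (_ , (_ , r)))) = ℕ.≤-trans (from-up p) r

  card-extend : Card (Tail z k n m) (extend h k n m)
  card-extend = card-⇔ (λ t → mk⇔ (assemble t) (analyse t))
    (card-⊎ (λ { _ (inj₁ (inj₁ (≡.refl , _))) (_ , _ , ())
               ; _ (inj₁ (inj₂ (_ , _ , ≡.refl))) (_ , _ , ())
               ; _ (inj₂ (_ , _ , ≡.refl)) (_ , _ , ()) })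
      (card-⊎ (λ { _ (inj₁ (≡.refl , _)) (_ , _ , ()) ; _ (inj₂ (_ , _ , ≡.refl)) (_ , _ , ()) })
        (card-⊎ (λ { _ (≡.refl , _) (_ , _ , ()) }) (card-one {X = List Col} [] n m) card-extend-simplex)
        card-end-duplex)
      card-extend-duplex)
    where
    assemble : ∀ t → _ → Tail z k n m t
    assemble .[] (inj₁ (inj₁ (inj₁ (≡.refl , ≡.refl , ≡.refl)))) = tt , ≡.refl , ≡.refl
    assemble _ (inj₁ (inj₁ (inj₂ (_ , (_ , _ , _ , ≡.refl , ≡.refl , touch , valid , ≡.refl , ≡.refl) , ≡.refl)))) =
      (touch , valid) , ≡.refl , ≡.refl
    assemble _ (inj₁ (inj₂ (_ , (_ , _ , _ , _ , ≡.refl , ≡.refl , (_ , both) , _ , ≡.refl , ≡.refl) , ≡.refl))) =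
      both , ≡.refl , ≡.refl
    assemble _ (inj₂ (_ , (_ , _ , _ , _ , _ , ≡.refl , ≡.refl , _ , _ , ≡.refl , ≡.refl , link , valid , ≡.refl , ≡.refl) , ≡.refl)) =
      (link , valid) , ≡.refl , ≡.refl

    analyse : ∀ t → Tail z k n m t → _
    analyse [] (_ , ≡.refl , ≡.refl) = inj₁ (inj₁ (inj₁ (≡.refl , ≡.refl , ≡.refl)))
    analyse (sim y l ∷ t) ((touch , valid) , ≡.refl , ≡.refl) =
      inj₁ (inj₁ (inj₂ (_ , (s≤s (ℕ.m≤n⇒m≤1+n (ℕ.m≤m+n l (totalArea t))) , _ , _ , ≡.refl , ≡.refl , touch , valid , ≡.refl , ≡.refl) , ≡.refl)))
    analyse (dup d a g b ∷ []) (both , ≡.refl , ≡.refl) =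
      inj₁ (inj₂ (_ , (within-left a b 0 , within-right a b 0 , _ , _ , ≡.refl , ≡.refl
        , (both-gap {z} {k} {d} {a} {g} {b} both , both) , ≡.refl , ≡.refl , ≡.refl) , ≡.refl))
    analyse (dup d a g b ∷ sim y l ∷ t) ((link , valid) , ≡.refl , ≡.refl) =
      inj₂ (_ , (within-next l (2 + (a + b)) (totalArea t) , within-left a b (suc l + totalArea t) , within-right a b (suc l + totalArea t)
        , _ , _ , ≡.refl , ≡.refl , _ , _ , ≡.refl , ≡.refl , link , valid , ≡.refl , ≡.refl) , ≡.refl)
    analyse (dup _ _ _ _ ∷ dup _ _ _ _ ∷ _) (() , _)

-- The recursion for the number of tails, truncated at a given depth.
fuelled : ℕ → ℕ → ℕ → ℕ → ℕ
fuelled zero k n m = 0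
fuelled (suc f) = extend (fuelled f)

card-fuelled : ∀ f z k n m → n < f → n ≤ z → Card (Tail z k n m) (fuelled f k n m)
card-fuelled (suc f) z k n m (s≤s n≤f) n≤z = Extension.card-extend (fuelled f) z k n m n≤z
  (λ y l n′ m′ n′<n n′≤y → card-fuelled f y l n′ m′ (ℕ.<-≤-trans n′<n n≤f) n′≤y)

tailCount : ℕ → ℕ → ℕ → ℕ
tailCount k n m = fuelled (suc n) k n m

card-tail : ∀ z k n m → n ≤ z → Card (Tail z k n m) (tailCount k n m)
card-tail z k n m = card-fuelled (suc n) z k n m ℕ.≤-refl

-- Both sides enumerate the tails behind a column at height n, so they agree; the truncation depths
-- need not be compared.
tailCount-extend : ∀ k n m → tailCount k n m ≡ extend tailCount k n m
tailCount-extend k n m = card-unique (card-tail n k n m ℕ.≤-refl)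
  (Extension.card-extend tailCount n k n m ℕ.≤-refl (λ y l n′ m′ _ → card-tail y l n′ m′))

bottom : Col → ℕ
bottom (sim y l) = y
bottom (dup d a g b) = d

headBottom : List Col → ℕ
headBottom [] = 0
headBottom (c ∷ _) = bottom c

-- A first column at height N ≥ n leaves room below, so that the number of positions of
-- each further column does not depend on N.
Anchored : ℕ → ℕ → ℕ → List Col → Set
Anchored N n m cs = (Valid cs × headBottom cs ≡ N) × totalArea cs ≡ n × totalDups cs ≡ m

start-simplex start-duplex : ℕ → ℕ → ℕ
start-simplex n m = Σ< (suc n) (λ k → shift 0 (suc k) 0 (tailCount k) n m)
start-duplex n m = Σ< (suc n) (λ l → Σ< (suc n) (λ a → Σ< (suc n) (λ b →
  tri l * shift 0 (2 + (a + b)) 1 (shift 0 (suc l) 0 (tailCount l)) n m)))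

module Start (N n m : ℕ) (n≤N : n ≤ N) where

  card-start-simplex : Card (λ (cs : List Col) → ∃ λ ((k , t) : ℕ × List Col) →
    (k < suc n × Shifted (suc k) 0 (λ n′ m′ t → Tail N k n′ m′ t) n m t) × cs ≡ sim N k ∷ t) (start-simplex n m)
  card-start-simplex = card-map (λ (k , t) → sim N k ∷ t) (λ { _ _ ≡.refl → ≡.refl })
    (card-Σ< (suc n) (λ k _ → card-shift (suc k) 0 n m (λ n′ m′ n≡ _ →
      card-tail N k n′ m′ (ℕ.≤-trans (ℕ.m≤n+m n′ (suc k)) (subst (_≤ N) n≡ n≤N)))))

  card-start-duplex : Card (λ (cs : List Col) → ∃ λ ((l , a , b , (g , y) , t) : ℕ × ℕ × ℕ × (ℕ × ℕ) × List Col) →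
    (l < suc n × a < suc n × b < suc n × Shifted (2 + (a + b)) 1 (Shifted (suc l) 0
      (λ n′ m′ ((g , y) , t) → (g < l × Both y l N a g b) × Tail y l n′ m′ t)) n m ((g , y) , t))
    × cs ≡ dup N a g b ∷ sim y l ∷ t) (start-duplex n m)
  card-start-duplex = card-map (λ (l , a , b , (g , y) , t) → dup N a g b ∷ sim y l ∷ t) (λ { _ _ ≡.refl → ≡.refl })
    (card-Σ< (suc n) (λ l l≤n → card-Σ< (suc n) (λ a _ → card-Σ< (suc n) (λ b _ →
      card-size (≡.trans (shift-cong (2 + (a + b)) 1 (shift-* (suc l) 0 (tri l) (tailCount l)) n m)
          (shift-* (2 + (a + b)) 1 (tri l) (shift 0 (suc l) 0 (tailCount l)) n m))
        (card-shift (2 + (a + b)) 1 n m (λ n₁ m₁ n≡ _ → card-shift (suc l) 0 n₁ m₁ (λ n′ m′ n₁≡ _ →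
          card-× (card-size (Σ<-both-count l) (card-Σ< l (λ g _ →
              card-both-right N a g b l (ℕ.≤-trans (ℕ.≤-trans (ℕ.s≤s⁻¹ l≤n) n≤N) (d≤upper N a g)))))
            (λ (g , y) (_ , (_ , r) , _) → card-tail y l n′ m′ (n′≤y l a b y n≡ n₁≡ r)))))))))
    where
    n′≤y : ∀ l a b y {n₁ n′} → n ≡ 2 + (a + b) + n₁ → n₁ ≡ suc l + n′ → N ≤ y + l → n′ ≤ y
    n′≤y l a b y {n′ = n′} ≡.refl ≡.refl N≤ = ℕ.+-cancelʳ-≤ l n′ y
      (ℕ.≤-trans (ℕ.≤-reflexive (ℕ.+-comm n′ l)) (ℕ.≤-trans (ℕ.n≤1+n (l + n′))
        (ℕ.≤-trans (ℕ.m≤n+m (suc l + n′) (2 + (a + b))) (ℕ.≤-trans n≤N N≤))))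

  card-anchored : Card (Anchored N n m) (start-simplex n m + start-duplex n m)
  card-anchored = card-⇔ (λ cs → mk⇔ (assemble cs) (analyse cs))
    (card-⊎ (λ { _ (_ , _ , ≡.refl) (_ , _ , ()) }) card-start-simplex card-start-duplex)
    where
    assemble : ∀ cs → _ → Anchored N n m cs
    assemble _ (inj₁ (_ , (_ , _ , _ , ≡.refl , ≡.refl , valid , ≡.refl , ≡.refl) , ≡.refl)) = (valid , ≡.refl) , ≡.refl , ≡.refl
    assemble _ (inj₂ (_ , (_ , _ , _ , _ , _ , ≡.refl , ≡.refl , _ , _ , ≡.refl , ≡.refl , (_ , both) , valid , ≡.refl , ≡.refl) , ≡.refl)) =
      ((both , valid) , ≡.refl) , ≡.refl , ≡.refl
    analyse : ∀ cs → Anchored N n m cs → _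
    analyse [] ((() , _) , _)
    analyse (sim z k ∷ t) ((valid , ≡.refl) , ≡.refl , ≡.refl) =
      inj₁ (_ , (s≤s (ℕ.m≤n⇒m≤1+n (ℕ.m≤m+n k (totalArea t))) , _ , _ , ≡.refl , ≡.refl , valid , ≡.refl , ≡.refl) , ≡.refl)
    analyse (dup d a g b ∷ []) ((() , _) , _)
    analyse (dup d a g b ∷ sim y l ∷ t) (((both , valid) , ≡.refl) , ≡.refl , ≡.refl) =
      inj₂ (_ , (within-next l (2 + (a + b)) (totalArea t) , within-left a b (suc l + totalArea t) , within-right a b (suc l + totalArea t)
        , _ , _ , ≡.refl , ≡.refl , _ , _ , ≡.refl , ≡.refl
        , (both-gap {y} {l} {d} {a} {g} {b} both , both) , valid , ≡.refl , ≡.refl) , ≡.refl)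
    analyse (dup _ _ _ _ ∷ dup _ _ _ _ ∷ _) ((() , _) , _)

-- From counts to series

opaque
  series : (ℕ → ℕ → ℕ) → FPS
  series h n m = nℚ (h n m)

  series-at : ∀ h n m → series h n m ≡ nℚ (h n m)
  series-at h n m = ≡.refl

nℚ-Σ< : ∀ n f → nℚ (Σ< (suc n) f) ≡ sumUpTo n (nℚ ∘ f)
nℚ-Σ< zero f = ≡.refl
nℚ-Σ< (suc n) f = ≡.trans (nℚ-+ (Σ< (suc n) f) (f (suc n))) (cong (ℚ._+ nℚ (f (suc n))) (nℚ-Σ< n f))

opaque
  unfolding _⊞_ ∑ series

  nℚ-shift : ∀ a b h n m → nℚ (shift 0 a b h n m) ≡ shift 0ℚ a b (series h) n m
  nℚ-shift zero zero h n m = ≡.refl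
  nℚ-shift zero (suc b) h n zero = ≡.refl
  nℚ-shift zero (suc b) h n (suc m) = nℚ-shift zero b h n m
  nℚ-shift (suc a) b h zero m = ≡.refl
  nℚ-shift (suc a) b h (suc n) m = nℚ-shift a b h n m

  series-shift : ∀ a b h → series (shift 0 a b h) ≈ mono a b ⊡ series h
  series-shift a b h = pointwise λ n m → ≡.trans (nℚ-shift a b h n m) (≡.sym (mono-⊡ a b (series h) n m))

  series-+ : ∀ (g h : ℕ → ℕ → ℕ) → series (λ n m → g n m + h n m) ≈ series g ⊞ series h
  series-+ g h = pointwise λ n m → nℚ-+ (g n m) (h n m)

  series-* : ∀ c (h : ℕ → ℕ → ℕ) → series (λ n m → c * h n m) ≈ # c ⊡ series h
  series-* c h = pointwise λ n m → ≡.trans (nℚ-* c (h n m)) (≡.sym (const-⊡-at (nℚ c) (series h) n m))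

  series-Σ< : ∀ (h : ℕ → ℕ → ℕ → ℕ) → series (λ n m → Σ< (suc n) (λ i → h i n m)) ≈ ∑ (λ i → series (h i))
  series-Σ< h = pointwise λ n m → nℚ-Σ< n (λ i → h i n m)

  series-one : series one ≈ 𝟙
  series-one = pointwise λ { zero zero → ≡.refl ; zero (suc m) → ≡.refl ; (suc n) m → ≡.refl }

  series-cong : ∀ {g h : ℕ → ℕ → ℕ} → (∀ n m → g n m ≡ h n m) → series g ≈ series h
  series-cong g≡h = pointwise λ n m → cong nℚ (g≡h n m)

T : ℕ → FPS
T k = series (tailCount k)

open Solution T links links-spec using (f)

shifted-duplex : ∀ c l a b → series (λ n m → c * shift 0 (2 + (a + b)) 1 (shift 0 (suc l) 0 (tailCount l)) n m) ≈
  # c ⊡ (D a b ⊡ f l)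
shifted-duplex c l a b = trans (series-* c _) (⊡-congˡ
  (trans (series-shift (2 + (a + b)) 1 _) (⊡-congˡ (series-shift (suc l) 0 (tailCount l)))))

T-recursion : ∀ k → T k ≈ 𝟙 ⊞ ∑ (λ l → # (suc (k + l)) ⊡ f l)
  ⊞ ∑ (λ a → ∑ (λ b → # tri k ⊡ D a b))
  ⊞ ∑ (λ l → ∑ (λ a → ∑ (λ b → # links k l (2 + (a + b)) ⊡ (D a b ⊡ f l))))
T-recursion k = begin
  T k ≈⟨ series-cong (tailCount-extend k) ⟩
  series (extend tailCount k) ≈⟨ trans (series-+ _ _) (⊞-congʳ (trans (series-+ _ _) (⊞-congʳ (series-+ _ _)))) ⟩
  series one ⊞ series (extend-simplex tailCount k) ⊞ series (end-duplex k) ⊞ series (extend-duplex tailCount k)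
    ≈⟨ ⊞-cong (⊞-cong (⊞-cong series-one simplex) duplex) both ⟩
  _ ∎
  where
  open SetoidReasoning setoid
  simplex : series (extend-simplex tailCount k) ≈ ∑ (λ l → # (suc (k + l)) ⊡ f l)
  simplex = trans (series-Σ< _) (∑-cong (λ l → trans (series-* (suc (k + l)) _) (⊡-congˡ (series-shift (suc l) 0 (tailCount l)))))
  duplex : series (end-duplex k) ≈ ∑ (λ a → ∑ (λ b → # tri k ⊡ D a b))
  duplex = trans (series-Σ< _) (∑-cong (λ a → trans (series-Σ< _) (∑-cong (λ b → trans (series-* (tri k) _)
    (⊡-congˡ (trans (series-shift (2 + (a + b)) 1 one) (trans (⊡-congˡ series-one) (⊡-identityʳ (D a b)))))))))
  both : series (extend-duplex tailCount k) ≈ ∑ (λ l → ∑ (λ a → ∑ (λ b → # links k l (2 + (a + b)) ⊡ (D a b ⊡ f l))))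
  both = trans (series-Σ< _) (∑-cong (λ l → trans (series-Σ< _) (∑-cong (λ a → trans (series-Σ< _)
    (∑-cong (λ b → shifted-duplex (links k l (2 + (a + b))) l a b))))))

anchored-series : series (λ n m → start-simplex n m + start-duplex n m) ≈ NUM/DEN
anchored-series = trans (series-+ _ _) (trans (⊞-cong simplex duplex) (Solution.total T links links-spec T-recursion))
  where
  simplex : series start-simplex ≈ ∑ f
  simplex = trans (series-Σ< _) (∑-cong (λ l → series-shift (suc l) 0 (tailCount l)))
  duplex : series start-duplex ≈ ∑ (λ l → ∑ (λ a → ∑ (λ b → # tri l ⊡ (D a b ⊡ f l))))
  duplex = trans (series-Σ< _) (∑-cong (λ l → trans (series-Σ< _) (∑-cong (λ a → trans (series-Σ< _)
    (∑-cong (λ b → shifted-duplex (tri l) l a b))))))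

-- Polyominoes and their columns

infix 4 _[_]=_
data _[_]=_ : List Col → ℕ → Col → Set where
  first : ∀ {c cs} → c ∷ cs [ 0 ]= c
  later : ∀ {c c′ cs i} → cs [ i ]= c → c′ ∷ cs [ suc i ]= c

[]=-functional : ∀ {cs i c c′} → cs [ i ]= c → cs [ i ]= c′ → c ≡ c′
[]=-functional first first = ≡.refl
[]=-functional (later p) (later p′) = []=-functional p p′

unlater : ∀ {c c′ cs i} → c′ ∷ cs [ suc i ]= c → cs [ i ]= c
unlater (later at) = at

Within : ℕ → ℕ → ℕ → Set
Within lo n v = lo ≤ v × v ≤ lo + n

InCol : Col → ℕ → Set
InCol (sim y l) v = Within y l v
InCol (dup d a g b) v = Within d a v ⊎ Within (upper d a g) b v

segment : ℕ → ℕ → ℕ → List Cell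
segment x lo n = applyUpTo (λ i → x , lo + i) (suc n)

column : ℕ → Col → List Cell
column x (sim y l) = segment x y l
column x (dup d a g b) = segment x d a ++ segment x (upper d a g) b

cells : ℕ → List Col → List Cell
cells x [] = []
cells x (c ∷ cs) = column x c ++ cells (suc x) cs

∈-segment⁻ : ∀ {x lo n x′ v} → (x′ , v) ∈ segment x lo n → x′ ≡ x × Within lo n v
∈-segment⁻ {x} {lo} p with ∈.∈-applyUpTo⁻ (λ i → x , lo + i) p
... | i , i<n , ≡.refl = ≡.refl , ℕ.m≤m+n lo i , ℕ.+-monoʳ-≤ lo (ℕ.s≤s⁻¹ i<n)

∈-segment⁺ : ∀ {x lo n v} → Within lo n v → (x , v) ∈ segment x lo n
∈-segment⁺ {x} {lo} {n} {v} (lo≤v , v≤) = subst (λ v → (x , v) ∈ segment x lo n) (ℕ.m+[n∸m]≡n lo≤v)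
  (∈.∈-applyUpTo⁺ (λ i → x , lo + i) (s≤s (ℕ.m≤n+o⇒m∸n≤o v lo v≤)))

∈-column⁻ : ∀ {x} c {x′ v} → (x′ , v) ∈ column x c → x′ ≡ x × InCol c v
∈-column⁻ (sim y l) p = ∈-segment⁻ p
∈-column⁻ {x} (dup d a g b) p with ∈.∈-++⁻ (segment x d a) p
... | inj₁ q = let eq , w = ∈-segment⁻ q in eq , inj₁ w
... | inj₂ q = let eq , w = ∈-segment⁻ q in eq , inj₂ w

∈-column⁺ : ∀ {x} c {v} → InCol c v → (x , v) ∈ column x c
∈-column⁺ (sim y l) w = ∈-segment⁺ w
∈-column⁺ (dup d a g b) (inj₁ w) = ∈.∈-++⁺ˡ (∈-segment⁺ w)
∈-column⁺ {x} (dup d a g b) (inj₂ w) = ∈.∈-++⁺ʳ (segment x d a) (∈-segment⁺ w)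

∈-cells⁻ : ∀ {x} cs {x′ v} → (x′ , v) ∈ cells x cs → ∃ λ i → ∃ λ c → x′ ≡ x + i × cs [ i ]= c × InCol c v
∈-cells⁻ {x} (c ∷ cs) p with ∈.∈-++⁻ (column x c) p
... | inj₁ q = let eq , w = ∈-column⁻ c q in 0 , c , ≡.trans eq (≡.sym (ℕ.+-identityʳ x)) , first , w
... | inj₂ q = let i , c′ , eq , at , w = ∈-cells⁻ cs q in suc i , c′ , ≡.trans eq (≡.sym (ℕ.+-suc x i)) , later at , w

∈-cells⁺ : ∀ {x cs i c v} → cs [ i ]= c → InCol c v → (x + i , v) ∈ cells x cs
∈-cells⁺ {x} {c ∷ cs} {v = v} first w = ∈.∈-++⁺ˡ (subst (λ x′ → (x′ , v) ∈ column x c) (≡.sym (ℕ.+-identityʳ x)) (∈-column⁺ c w))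
∈-cells⁺ {x} {c′ ∷ cs} {suc i} {v = v} (later at) w =
  ∈.∈-++⁺ʳ (column x c′) (subst (λ x′ → (x′ , v) ∈ cells (suc x) cs) (≡.sym (ℕ.+-suc x i)) (∈-cells⁺ at w))

∈-cells : ∀ cs {i c} → cs [ i ]= c → ∀ v → ((i , v) ∈ cells 0 cs) ⇔ InCol c v
∈-cells cs {i} {c} at v = mk⇔ sound (∈-cells⁺ at)
  where
  sound : (i , v) ∈ cells 0 cs → InCol c v
  sound p with ∈-cells⁻ cs p
  ... | _ , _ , ≡.refl , at′ , w = subst (λ c → InCol c v) ([]=-functional at′ at) w

length-cells : ∀ x cs → length (cells x cs) ≡ totalArea cs
length-cells x [] = ≡.refl
length-cells x (c ∷ cs) = ≡.trans (List.length-++ (column x c)) (cong₂ _+_ (length-column c) (length-cells (suc x) cs))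
  where
  length-column : ∀ c → length (column x c) ≡ colArea c
  length-column (sim y l) = List.length-applyUpTo (λ i → x , y + i) (suc l)
  length-column (dup d a g b) = ≡.trans (List.length-++ (segment x d a))
    (≡.trans (cong₂ _+_ (List.length-applyUpTo (λ i → x , d + i) (suc a)) (List.length-applyUpTo (λ i → x , upper d a g + i) (suc b)))
      (cong suc (ℕ.+-suc a b)))

segment-sorted : ∀ x lo n → AllPairs _<ₗ_ (segment x lo n)
segment-sorted x lo n = AllPairs.applyUpTo⁺₁ (λ i → x , lo + i) (suc n) (λ i<j _ → inj₂ (≡.refl , ℕ.+-monoʳ-< lo i<j))

column-sorted : ∀ x c → AllPairs _<ₗ_ (column x c)
column-sorted x (sim y l) = segment-sorted x y l
column-sorted x (dup d a g b) = AllPairs.++⁺ (segment-sorted x d a) (segment-sorted x (upper d a g) b)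
  (All.tabulate (λ {p} p∈ → All.tabulate (λ {q} q∈ → order p∈ q∈)))
  where
  order : ∀ {p q} → p ∈ segment x d a → q ∈ segment x (upper d a g) b → p <ₗ q
  order p∈ q∈ with ∈-segment⁻ p∈ | ∈-segment⁻ q∈
  ... | ≡.refl , (_ , p≤) | ≡.refl , (≤q , _) = inj₂ (≡.refl , ℕ.≤-<-trans p≤ (ℕ.<-≤-trans (ℕ.<⇒≤ (low<upper d a g)) ≤q))

cells-sorted : ∀ x cs → AllPairs _<ₗ_ (cells x cs)
cells-sorted x [] = []
cells-sorted x (c ∷ cs) = AllPairs.++⁺ (column-sorted x c) (cells-sorted (suc x) cs)
  (All.tabulate (λ {p} p∈ → All.tabulate (λ {q} q∈ → order p∈ q∈)))
  where
  order : ∀ {p q} → p ∈ column x c → q ∈ cells (suc x) cs → p <ₗ q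
  order p∈ q∈ with ∈-column⁻ c p∈ | ∈-cells⁻ cs q∈
  ... | ≡.refl , _ | i , _ , ≡.refl , _ = inj₁ (ℕ.m≤m+n (suc x) i)

<ₗ-irrefl : ∀ {c} → ¬ c <ₗ c
<ₗ-irrefl (inj₁ lt) = ℕ.<-irrefl ≡.refl lt
<ₗ-irrefl (inj₂ (_ , lt)) = ℕ.<-irrefl ≡.refl lt

<ₗ-trans : ∀ {c d e} → c <ₗ d → d <ₗ e → c <ₗ e
<ₗ-trans (inj₁ p) (inj₁ r) = inj₁ (ℕ.<-trans p r)
<ₗ-trans (inj₁ p) (inj₂ (≡.refl , _)) = inj₁ p
<ₗ-trans (inj₂ (≡.refl , _)) (inj₁ r) = inj₁ r
<ₗ-trans (inj₂ (≡.refl , p)) (inj₂ (≡.refl , r)) = inj₂ (≡.refl , ℕ.<-trans p r)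

-- Each head is the least element of the common set of cells, so the heads agree and can be removed.
sorted-unique : ∀ {S S′ : List Cell} → AllPairs _<ₗ_ S → AllPairs _<ₗ_ S′ → (∀ c → (c ∈ S) ⇔ (c ∈ S′)) → S ≡ S′
sorted-unique [] [] same = ≡.refl
sorted-unique [] (_∷_ {x = c} _ _) same with from (same c) (here ≡.refl)
... | ()
sorted-unique (_∷_ {x = c} _ _) [] same with to (same c) (here ≡.refl)
... | ()
sorted-unique (_∷_ {x = c} {S} c< p) (_∷_ {x = c′} {S′} c′< p′) same
  with heads (to (same c) (here ≡.refl)) (from (same c′) (here ≡.refl))
  where
  heads : c ∈ c′ ∷ S′ → c′ ∈ c ∷ S → c ≡ c′
  heads (here eq) _ = eq
  heads (there _) (here eq) = ≡.sym eq
  heads (there c∈) (there c′∈) = ⊥-elim (<ₗ-irrefl (<ₗ-trans (All.lookup c< c′∈) (All.lookup c′< c∈)))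
... | ≡.refl = cong (c ∷_) (sorted-unique p p′ (λ e → mk⇔ (drop (to (same e)) c<) (drop (from (same e)) c′<)))
  where
  drop : ∀ {e R R′} → (e ∈ c ∷ R → e ∈ c ∷ R′) → All (c <ₗ_) R → e ∈ R → e ∈ R′
  drop f c<R e∈ with f (there e∈)
  ... | here ≡.refl = ⊥-elim (<ₗ-irrefl (All.lookup c<R e∈))
  ... | there e∈′ = e∈′

adjacent-sym : ∀ {c d} → Adjacent c d → Adjacent d c
adjacent-sym (inj₁ (≡.refl , inj₁ p)) = inj₁ (≡.refl , inj₂ p)
adjacent-sym (inj₁ (≡.refl , inj₂ p)) = inj₁ (≡.refl , inj₁ p)
adjacent-sym (inj₂ (≡.refl , inj₁ p)) = inj₂ (≡.refl , inj₂ p)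
adjacent-sym (inj₂ (≡.refl , inj₂ p)) = inj₂ (≡.refl , inj₁ p)

base : ∀ {lo n} → Within lo n lo
base {lo} {n} = ℕ.≤-refl , ℕ.m≤m+n lo n

touch-sym : ∀ {y l y′ l′} → Touch y l y′ l′ → Touch y′ l′ y l
touch-sym (p , r) = r , p

module _ {S : List Cell} where
  path-trans : ∀ {c d e} → Path S c d → Path S d e → Path S c e
  path-trans here r = r
  path-trans (step adj d∈ p) r = step adj d∈ (path-trans p r)

  path-reverse : ∀ {c d} → c ∈ S → Path S c d → Path S d c
  path-reverse c∈ here = here
  path-reverse c∈ (step adj d∈ p) = path-trans (path-reverse d∈ p) (step (adjacent-sym adj) c∈ here)

  Block : ℕ → ℕ → ℕ → Set
  Block x lo n = ∀ {v} → Within lo n v → (x , v) ∈ S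

  descend : ∀ {x lo n} → Block x lo n → ∀ {v} → Within lo n v → Path S (x , v) (x , lo)
  descend {x} {lo} {n} block {v} (lo≤v , v≤) = subst (λ v → Path S (x , v) (x , lo)) (ℕ.m+[n∸m]≡n lo≤v)
    (go (v ∸ lo) (ℕ.m≤n+o⇒m∸n≤o v lo v≤))
    where
    go : ∀ j → j ≤ n → Path S (x , lo + j) (x , lo)
    go zero _ = subst (λ v → Path S (x , v) (x , lo)) (≡.sym (ℕ.+-identityʳ lo)) here
    go (suc j) j<n = step (inj₁ (≡.refl , inj₂ (≡.sym (ℕ.+-suc lo j))))
      (block (ℕ.m≤m+n lo j , ℕ.+-monoʳ-≤ lo (ℕ.<⇒≤ j<n))) (go j (ℕ.<⇒≤ j<n))

  within-block : ∀ {x lo n} → Block x lo n → ∀ {v v′} → Within lo n v → Within lo n v′ → Path S (x , v) (x , v′)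
  within-block block w w′ = path-trans (descend block w) (path-reverse (block w′) (descend block w′))

  cross : ∀ {x lo n lo′ n′} → Block x lo n → Block (suc x) lo′ n′ → Touch lo n lo′ n′ →
          ∀ {v v′} → Within lo n v → Within lo′ n′ v′ → Path S (x , v) (suc x , v′)
  cross {lo = lo} {n} {lo′} {n′} block block′ (p , r) w w′ =
    path-trans (within-block block w common) (step (inj₂ (≡.refl , inj₁ ≡.refl)) (block′ common′) (within-block block′ common′ w′))
    where
    common : Within lo n (lo ℕ.⊔ lo′)
    common = ℕ.m≤m⊔n lo lo′ , ℕ.⊔-lub (ℕ.m≤m+n lo n) r
    common′ : Within lo′ n′ (lo ℕ.⊔ lo′)
    common′ = ℕ.m≤n⊔m lo lo′ , ℕ.⊔-lub p (ℕ.m≤m+n lo′ n′)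

  cross⁻ : ∀ {x lo n lo′ n′} → Block x lo n → Block (suc x) lo′ n′ → Touch lo n lo′ n′ →
           ∀ {v v′} → Within lo n v → Within lo′ n′ v′ → Path S (suc x , v′) (x , v)
  cross⁻ block block′ t w w′ = path-reverse (block w) (cross block block′ t w w′)

  -- Every cell is led back to the first column. In a link one neighbour meets both components and
  -- the other at least one: if the left one meets only one, the other component is reached through
  -- the right one. S stays fixed, so that paths found for a tail remain paths in the whole.
  connect : ∀ x z k t → ValidAfter z k t → (∀ {c} → c ∈ cells x (sim z k ∷ t) → c ∈ S) →
            ∀ {c} → c ∈ cells x (sim z k ∷ t) → Path S c (x , z)
  connect x z k t valid ⊆S c∈ with ∈.∈-++⁻ (segment x z k) c∈
  ... | inj₁ c∈seg with ∈-segment⁻ {x} c∈seg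
  ...   | ≡.refl , w = descend (λ w → ⊆S (∈.∈-++⁺ˡ (∈-segment⁺ w))) w
  connect x z k t valid ⊆S c∈ | inj₂ c∈t = tail t valid (λ w → ⊆S (∈.∈-++⁺ˡ (∈-segment⁺ w))) (⊆S ∘ ∈.∈-++⁺ʳ (segment x z k)) c∈t
    where
    tail : ∀ t → ValidAfter z k t → Block x z k → (∀ {c} → c ∈ cells (suc x) t → c ∈ S) →
           ∀ {c} → c ∈ cells (suc x) t → Path S c (x , z)
    tail (sim y l ∷ t) (touch , valid) left ⊆S c∈ =
      path-trans (connect (suc x) y l t valid ⊆S c∈)
        (cross⁻ left (λ w → ⊆S (∈.∈-++⁺ˡ (∈-segment⁺ w))) touch base base)
    tail (dup d a g b ∷ t) valid left ⊆S c∈ = components t valid (⊆S ∘ ∈.∈-++⁺ʳ (column (suc x) (dup d a g b))) (∈.∈-++⁻ (column (suc x) (dup d a g b)) c∈)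
      where
      low : Block (suc x) d a
      low w = ⊆S (∈.∈-++⁺ˡ (∈-column⁺ (dup d a g b) (inj₁ w)))
      up : Block (suc x) (upper d a g) b
      up w = ⊆S (∈.∈-++⁺ˡ (∈-column⁺ (dup d a g b) (inj₂ w)))
      via : ∀ {c} → c ∈ column (suc x) (dup d a g b) → Path S (suc x , d) (x , z) → Path S (suc x , upper d a g) (x , z) → Path S c (x , z)
      via c∈ fromLow fromUp with ∈-column⁻ {suc x} (dup d a g b) c∈
      ... | ≡.refl , inj₁ w = path-trans (descend low w) fromLow
      ... | ≡.refl , inj₂ w = path-trans (descend up w) fromUp
      components : ∀ t → ValidAfter z k (dup d a g b ∷ t) → (∀ {c} → c ∈ cells (2 + x) t → c ∈ S) →
                   ∀ {c} → c ∈ column (suc x) (dup d a g b) ⊎ c ∈ cells (2 + x) t → Path S c (x , z)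
      components [] (t₁ , t₂) _ (inj₁ c∈) = via c∈ (cross⁻ left low t₁ base base) (cross⁻ left up t₂ base base)
      components (sim y l ∷ t) (link , valid) ⊆S c∈ = finish link c∈
        where
        right : Block (2 + x) y l
        right w = ⊆S (∈.∈-++⁺ˡ (∈-segment⁺ w))
        close : ∀ {c} → Path S (suc x , d) (x , z) → Path S (suc x , upper d a g) (x , z) → Path S (2 + x , y) (x , z) →
                c ∈ column (suc x) (dup d a g b) ⊎ c ∈ cells (2 + x) (sim y l ∷ t) → Path S c (x , z)
        close fromLow fromUp _ (inj₁ c∈) = via c∈ fromLow fromUp
        close _ _ fromRight (inj₂ c∈) = path-trans (connect (2 + x) y l t valid ⊆S c∈) fromRight
        finish : ∀ {c} → Link z k d a g b y l → c ∈ column (suc x) (dup d a g b) ⊎ c ∈ cells (2 + x) (sim y l ∷ t) → Path S c (x , z)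
        finish (inj₁ ((t₁ , t₂) , inj₁ t₃)) = close fromLow (cross⁻ left up t₂ base base)
          (path-trans (cross⁻ low right (touch-sym t₃) base base) fromLow)
          where fromLow = cross⁻ left low t₁ base base
        finish (inj₁ ((t₁ , t₂) , inj₂ t₃)) = close (cross⁻ left low t₁ base base) fromUp
          (path-trans (cross⁻ up right (touch-sym t₃) base base) fromUp)
          where fromUp = cross⁻ left up t₂ base base
        finish (inj₂ ((inj₁ t₁ , _) , (t₂ , t₃))) = close fromLow
          (path-trans (cross up right (touch-sym t₃) base base) fromRight) fromRight
          where
          fromLow = cross⁻ left low t₁ base base
          fromRight = path-trans (cross⁻ low right (touch-sym t₂) base base) fromLow
        finish (inj₂ ((inj₂ t₁ , _) , (t₂ , t₃))) = close
          (path-trans (cross low right (touch-sym t₂) base base) fromRight) fromUp fromRight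
          where
          fromUp = cross⁻ left up t₁ base base
          fromRight = path-trans (cross⁻ up right (touch-sym t₃) base base) fromUp
      components (dup _ _ _ _ ∷ _) ()

valid-connected : ∀ cs → Valid cs → ∃ λ r → ∀ {c} → c ∈ cells 0 cs → Path (cells 0 cs) c r
valid-connected (sim z k ∷ t) valid = (0 , z) , connect 0 z k t valid (λ c∈ → c∈)
valid-connected (dup d a g b ∷ sim y l ∷ t) ((t₁ , t₂) , valid) = (1 , y) , reach
  where
  S = cells 0 (dup d a g b ∷ sim y l ∷ t)
  ⊆S : ∀ {c} → c ∈ cells 1 (sim y l ∷ t) → c ∈ S
  ⊆S = ∈.∈-++⁺ʳ (column 0 (dup d a g b))
  low : Block {S} 0 d a
  low w = ∈.∈-++⁺ˡ (∈-column⁺ (dup d a g b) (inj₁ w))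
  up : Block {S} 0 (upper d a g) b
  up w = ∈.∈-++⁺ˡ (∈-column⁺ (dup d a g b) (inj₂ w))
  right : Block {S} 1 y l
  right w = ⊆S (∈.∈-++⁺ˡ (∈-segment⁺ w))
  reach : ∀ {c} → c ∈ S → Path S c (1 , y)
  reach c∈ with ∈.∈-++⁻ (column 0 (dup d a g b)) c∈
  ... | inj₂ c∈t = connect 1 y l t valid ⊆S c∈t
  ... | inj₁ c∈c with ∈-column⁻ {0} (dup d a g b) c∈c
  ...   | ≡.refl , inj₁ w = cross low right (touch-sym t₁) w base
  ...   | ≡.refl , inj₂ w = cross up right (touch-sym t₂) w base

IsDup : List Col → ℕ → Set
IsDup cs i = ∃ λ d → ∃ λ a → ∃ λ g → ∃ λ b → cs [ i ]= dup d a g b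

simplex-at : ∀ cs {i y l} → cs [ i ]= sim y l → Simplex (cells 0 cs) i
simplex-at cs {y = y} {l} at = y , y + l , ℕ.m≤m+n y l , ∈-cells cs at

duplex-at : ∀ cs {i} → IsDup cs i → Duplex (cells 0 cs) i
duplex-at cs (d , a , g , b , at) = d , d + a , upper d a g , upper d a g + b
  , ℕ.m≤m+n d a , low<upper d a g
  , ℕ.m≤m+n (upper d a g) b , ∈-cells cs at

-- Row b + 1, just above the lower component, lies between two occupied rows but is not occupied
-- itself.
simplex-not-duplex : ∀ {S x} → Simplex S x → ¬ Duplex S x
simplex-not-duplex (lo , hi , _ , simplex) (a , b , c , d , a≤b , b<c , c≤d , duplex) =
  [ (λ (_ , r) → ℕ.<-irrefl ≡.refl r) , (λ (r , _) → ℕ.<-irrefl ≡.refl (ℕ.<-≤-trans b<c r)) ]′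
    (to (duplex (suc b)) (from (simplex (suc b))
      ( ℕ.m≤n⇒m≤1+n (proj₁ (to (simplex b) (from (duplex b) (inj₁ (a≤b , ℕ.≤-refl)))))
      , ℕ.≤-trans (ℕ.<⇒≤ b<c) (proj₂ (to (simplex c) (from (duplex c) (inj₂ (ℕ.≤-refl , c≤d))))))))

duplex⇒dup : ∀ cs {i} → Duplex (cells 0 cs) i → IsDup cs i
duplex⇒dup cs {i} D@(a , b , c , d , a≤b , _ , _ , duplex) with ∈-cells⁻ cs (from (duplex a) (inj₁ (ℕ.≤-refl , a≤b)))
... | _ , sim y l , ≡.refl , at , _ = ⊥-elim (simplex-not-duplex (simplex-at cs at) D)
... | _ , dup _ _ _ _ , ≡.refl , at , _ = _ , _ , _ , _ , at

after-no-adjacent : ∀ z k t {i} → ValidAfter z k t → IsDup t i → ¬ IsDup t (suc i)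
after-no-adjacent z k (sim y l ∷ t) (_ , valid) (_ , _ , _ , _ , later p) (_ , _ , _ , _ , later r) =
  after-no-adjacent y l t valid (_ , _ , _ , _ , p) (_ , _ , _ , _ , r)
after-no-adjacent z k (dup _ _ _ _ ∷ []) _ _ (_ , _ , _ , _ , later ())
after-no-adjacent z k (dup _ _ _ _ ∷ sim y l ∷ t) _ (_ , _ , _ , _ , first) (_ , _ , _ , _ , later ())
after-no-adjacent z k (dup _ _ _ _ ∷ sim y l ∷ t) (_ , valid) (_ , _ , _ , _ , later (later p)) (_ , _ , _ , _ , later (later r)) =
  after-no-adjacent y l t valid (_ , _ , _ , _ , p) (_ , _ , _ , _ , r)

valid-no-adjacent : ∀ cs {i} → Valid cs → IsDup cs i → ¬ IsDup cs (suc i)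
valid-no-adjacent (sim z k ∷ t) valid (_ , _ , _ , _ , later p) (_ , _ , _ , _ , later r) =
  after-no-adjacent z k t valid (_ , _ , _ , _ , p) (_ , _ , _ , _ , r)
valid-no-adjacent (dup _ _ _ _ ∷ sim y l ∷ t) _ (_ , _ , _ , _ , first) (_ , _ , _ , _ , later ())
valid-no-adjacent (dup _ _ _ _ ∷ sim y l ∷ t) (_ , valid) (_ , _ , _ , _ , later (later p)) (_ , _ , _ , _ , later (later r)) =
  after-no-adjacent y l t valid (_ , _ , _ , _ , p) (_ , _ , _ , _ , r)

dupIndices : ℕ → List Col → List ℕ
dupIndices x [] = []
dupIndices x (sim _ _ ∷ cs) = dupIndices (suc x) cs
dupIndices x (dup _ _ _ _ ∷ cs) = x ∷ dupIndices (suc x) cs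

∈-dupIndices⁻ : ∀ {x} cs {j} → j ∈ dupIndices x cs → ∃ λ i → j ≡ x + i × IsDup cs i
∈-dupIndices⁻ {x} (sim _ _ ∷ cs) j∈ = let i , eq , _ , _ , _ , _ , at = ∈-dupIndices⁻ cs j∈ in
  suc i , ≡.trans eq (≡.sym (ℕ.+-suc x i)) , _ , _ , _ , _ , later at
∈-dupIndices⁻ {x} (dup _ _ _ _ ∷ cs) (here ≡.refl) = 0 , ≡.sym (ℕ.+-identityʳ x) , _ , _ , _ , _ , first
∈-dupIndices⁻ {x} (dup _ _ _ _ ∷ cs) (there j∈) = let i , eq , _ , _ , _ , _ , at = ∈-dupIndices⁻ cs j∈ in
  suc i , ≡.trans eq (≡.sym (ℕ.+-suc x i)) , _ , _ , _ , _ , later at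

∈-dupIndices⁺ : ∀ {x} cs {i} → IsDup cs i → x + i ∈ dupIndices x cs
∈-dupIndices⁺ {x} (sim _ _ ∷ cs) {suc i} (_ , _ , _ , _ , later at) =
  subst (_∈ dupIndices (suc x) cs) (≡.sym (ℕ.+-suc x i)) (∈-dupIndices⁺ cs (_ , _ , _ , _ , at))
∈-dupIndices⁺ {x} (dup _ _ _ _ ∷ cs) (_ , _ , _ , _ , first) = here (ℕ.+-identityʳ x)
∈-dupIndices⁺ {x} (dup _ _ _ _ ∷ cs) {suc i} (_ , _ , _ , _ , later at) =
  there (subst (_∈ dupIndices (suc x) cs) (≡.sym (ℕ.+-suc x i)) (∈-dupIndices⁺ cs (_ , _ , _ , _ , at)))

dupIndices-unique : ∀ x cs → Unique (dupIndices x cs)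
dupIndices-unique x [] = []
dupIndices-unique x (sim _ _ ∷ cs) = dupIndices-unique (suc x) cs
dupIndices-unique x (dup _ _ _ _ ∷ cs) = All.tabulate (λ j∈ x≡j → fresh j∈ x≡j) ∷ dupIndices-unique (suc x) cs
  where
  fresh : ∀ {j} → j ∈ dupIndices (suc x) cs → ¬ x ≡ j
  fresh j∈ ≡.refl = let i , eq , _ = ∈-dupIndices⁻ cs j∈ in ℕ.<-irrefl eq (ℕ.m≤m+n (suc x) i)

length-dupIndices : ∀ x cs → length (dupIndices x cs) ≡ totalDups cs
length-dupIndices x [] = ≡.refl
length-dupIndices x (sim _ _ ∷ cs) = length-dupIndices (suc x) cs
length-dupIndices x (dup _ _ _ _ ∷ cs) = cong suc (length-dupIndices (suc x) cs)

∈-dupIndices : ∀ cs x → (x ∈ dupIndices 0 cs) ⇔ Duplex (cells 0 cs) x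
∈-dupIndices cs x = mk⇔
  (λ x∈ → let i , eq , isDup = ∈-dupIndices⁻ cs x∈ in duplex-at cs (subst (IsDup cs) (≡.sym eq) isDup))
  (∈-dupIndices⁺ cs ∘ duplex⇒dup cs)

duplexCount : ∀ cs → DuplexCount (cells 0 cs) (totalDups cs)
duplexCount cs = dupIndices 0 cs , dupIndices-unique 0 cs , ∈-dupIndices cs , length-dupIndices 0 cs

duplexCount-unique : ∀ {S m m′} → DuplexCount S m → DuplexCount S m′ → m ≡ m′
duplexCount-unique (_ , u , mem , size) (_ , u′ , mem′ , size′) = ≡.trans (≡.sym size)
  (≡.trans (unique-same-length u u′ (λ x → mk⇔ (from (mem′ x) ∘ to (mem x)) (from (mem x) ∘ to (mem′ x)))) size′)

Normalized : List Col → Set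
Normalized cs = ∃ λ i → ∃ λ c → cs [ i ]= c × bottom c ≡ 0

bottom-in : ∀ c → InCol c (bottom c)
bottom-in (sim y l) = base
bottom-in (dup d a g b) = inj₁ base

polyomino : ∀ cs → Valid cs → Normalized cs → IsSimplexDuplex (cells 0 cs)
polyomino cs valid (i₀ , c₀ , at₀ , bottom≡0) =
  ( Linked.AllPairs⇒Linked (cells-sorted 0 cs) , leftmost cs valid
  , lose (∈-cells⁺ at₀ (bottom-in c₀)) bottom≡0 , connected )
  , columns , λ x (D , D′) → valid-no-adjacent cs valid (duplex⇒dup cs D) (duplex⇒dup cs D′)
  where
  leftmost : ∀ cs → Valid cs → Any (λ c → proj₁ c ≡ 0) (cells 0 cs)
  leftmost (sim z k ∷ t) _ = here ≡.refl
  leftmost (dup d a g b ∷ t) _ = here ≡.refl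
  connected : ∀ c d → c ∈ cells 0 cs → d ∈ cells 0 cs → Path (cells 0 cs) c d
  connected c d c∈ d∈ = let _ , reach = valid-connected cs valid in path-trans (reach c∈) (path-reverse d∈ (reach d∈))
  columns : ∀ x → (Σ ℕ λ y → (x , y) ∈ cells 0 cs) → Simplex (cells 0 cs) x ⊎ Duplex (cells 0 cs) x
  columns x (y , xy∈) with ∈-cells⁻ cs xy∈
  ... | _ , sim _ _ , ≡.refl , at , _ = inj₁ (simplex-at cs at)
  ... | _ , dup _ _ _ _ , ≡.refl , at , _ = inj₂ (duplex-at cs (_ , _ , _ , _ , at))

-- A discrete intermediate value theorem: along a path h rises by at most one per step.
intermediate : ∀ {S : List Cell} (h : Cell → ℕ) → (∀ {c d} → Adjacent c d → h d ≤ suc (h c)) →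
  ∀ {c d t} → c ∈ S → Path S c d → h c ≤ t → t ≤ h d → ∃ λ e → e ∈ S × h e ≡ t
intermediate h slow {c} c∈ here c≤t t≤d = c , c∈ , ℕ.≤-antisym c≤t t≤d
intermediate h slow {c} {t = t} c∈ (step adj e∈ p) c≤t t≤d with h c ℕ.≟ t
... | yes eq = c , c∈ , eq
... | no neq = intermediate h slow e∈ p (ℕ.≤-trans (slow adj) (ℕ.≤∧≢⇒< c≤t neq)) t≤d

adjacent-x : ∀ {c d} → Adjacent c d → proj₁ d ≤ suc (proj₁ c)
adjacent-x (inj₁ (≡.refl , _)) = ℕ.n≤1+n _
adjacent-x (inj₂ (_ , inj₁ ≡.refl)) = ℕ.≤-refl
adjacent-x (inj₂ (_ , inj₂ ≡.refl)) = ℕ.m≤n⇒m≤1+n (ℕ.n≤1+n _)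

adjacent-y : ∀ {c d} → Adjacent c d → proj₂ d ≤ suc (proj₂ c)
adjacent-y (inj₁ (_ , inj₁ ≡.refl)) = ℕ.≤-refl
adjacent-y (inj₁ (_ , inj₂ ≡.refl)) = ℕ.m≤n⇒m≤1+n (ℕ.n≤1+n _)
adjacent-y (inj₂ (≡.refl , _)) = ℕ.n≤1+n _

-- All the ordinates below that of a cell occur in a normalized polyomino.
height-bound : ∀ {S} → IsPolyomino S → ∀ {x y} → (x , y) ∈ S → y < length S
height-bound {S} (_ , _ , lowest , connected) {x} {y} xy∈ with find lowest
... | c , c∈ , y≡0 = ℕ.≤-trans (ℕ.≤-reflexive (≡.sym (List.length-upTo (suc y))))
    (ℕ.≤-trans (unique-⊆-length (Unique.upTo⁺ (suc y)) occurs) (ℕ.≤-reflexive (List.length-map proj₂ S)))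
  where
  occurs : ∀ {t} → t ∈ upTo (suc y) → t ∈ map proj₂ S
  occurs t∈ with intermediate proj₂ adjacent-y c∈ (connected c (x , y) c∈ xy∈)
                   (ℕ.≤-trans (ℕ.≤-reflexive y≡0) z≤n) (ℕ.s≤s⁻¹ (∈.∈-upTo⁻ t∈))
  ... | e , e∈ , ≡.refl = ∈.∈-map⁺ proj₂ e∈

rightmost : ∀ {S : List Cell} {c} → c ∈ S → ∃ λ e → e ∈ S × ∀ {d} → d ∈ S → proj₁ d ≤ proj₁ e
rightmost {c ∷ []} _ = c , here ≡.refl , λ { (here ≡.refl) → ℕ.≤-refl }
rightmost {c ∷ c′ ∷ S} _ with rightmost {c′ ∷ S} (here ≡.refl)
... | e , e∈ , max with ℕ.≤-total (proj₁ c) (proj₁ e)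
...   | inj₁ c≤e = e , there e∈ , λ { (here ≡.refl) → c≤e ; (there d∈) → max d∈ }
...   | inj₂ e≤c = c , here ≡.refl , λ { (here ≡.refl) → ℕ.≤-refl ; (there d∈) → ℕ.≤-trans (max d∈) e≤c }

-- Reading the columns off a polyomino

Describes : List Cell → ℕ → Col → Set
Describes S x c = ∀ v → ((x , v) ∈ S) ⇔ InCol c v

describe : ∀ {S x} → Simplex S x ⊎ Duplex S x → ∃ (Describes S x)
describe {S} {x} (inj₁ (a , b , a≤b , simplex)) = sim a (b ∸ a)
  , λ v → subst (λ b → ((x , v) ∈ S) ⇔ (a ≤ v × v ≤ b)) (≡.sym (ℕ.m+[n∸m]≡n a≤b)) (simplex v)
describe {S} {x} (inj₂ (a , b , c , d , a≤b , b<c , c≤d , duplex)) = dup a (b ∸ a) (c ∸ (2 + b)) (d ∸ c)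
  , λ v → subst (λ (b , c , d) → ((x , v) ∈ S) ⇔ ((a ≤ v × v ≤ b) ⊎ (c ≤ v × v ≤ d))) (≡.sym eq) (duplex v)
  where
  low : a + (b ∸ a) ≡ b
  low = ℕ.m+[n∸m]≡n a≤b
  up : upper a (b ∸ a) (c ∸ (2 + b)) ≡ c
  up = ≡.trans (cong (_+ (2 + (c ∸ (2 + b)))) low) (≡.trans (≡.sym (ℕ.+-assoc b 2 (c ∸ (2 + b))))
    (≡.trans (cong (_+ (c ∸ (2 + b))) (ℕ.+-comm b 2)) (ℕ.m+[n∸m]≡n b<c)))
  eq : (a + (b ∸ a) , upper a (b ∸ a) (c ∸ (2 + b)) , upper a (b ∸ a) (c ∸ (2 + b)) + (d ∸ c)) ≡ (b , c , d)
  eq = cong₂ _,_ low (cong₂ _,_ up (≡.trans (cong (_+ (d ∸ c)) up) (ℕ.m+[n∸m]≡n c≤d)))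

build : ∀ {S} count x → (∀ i → i < count → ∃ (Describes S (x + i))) →
  ∃ λ cs → (∀ i → i < count → ∃ λ c → cs [ i ]= c) × (∀ i c → cs [ i ]= c → Describes S (x + i) c)
build zero x columns = [] , (λ _ ()) , λ _ _ ()
build {S} (suc count) x columns with columns 0 (s≤s z≤n)
  | build {S} count (suc x) (λ i i< → let c , D = columns (suc i) (s≤s i<) in c , subst (λ x → Describes S x c) (ℕ.+-suc x i) D)
... | c , D | cs , total , correct = c ∷ cs
  , (λ { zero _ → c , first ; (suc i) (s≤s i<) → let c′ , at = total i i< in c′ , later at })
  , (λ { zero _ first → D ; (suc i) c′ (later at) → subst (λ x → Describes S x c′) (≡.sym (ℕ.+-suc x i)) (correct i c′ at) })

-- A path from abscissa 0 to the rightmost cell passes through every abscissa between, so no column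
-- is empty; sortedness turns equality of cell sets into equality of lists.
column-list : ∀ {S} → IsSimplexDuplex S → ∃ λ cs → S ≡ cells 0 cs
column-list {S} ((linked , leftmost , _ , connected) , columns , _) with find leftmost
... | c₀ , c₀∈ , x≡0 with rightmost c₀∈
...   | e , e∈ , max with build {S} (suc (proj₁ e)) 0 described
  where
  described : ∀ i → i < suc (proj₁ e) → ∃ (Describes S i)
  described i i≤ with intermediate proj₁ adjacent-x c₀∈ (connected c₀ e c₀∈ e∈) (ℕ.≤-trans (ℕ.≤-reflexive x≡0) z≤n) (ℕ.s≤s⁻¹ i≤)
  ... | (_ , y) , d∈ , ≡.refl = describe (columns i (y , d∈))
...     | cs , total , correct = cs , sorted-unique (Linked.Linked⇒AllPairs <ₗ-trans linked) (cells-sorted 0 cs)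
  (λ (x , v) → mk⇔
    (λ d∈ → let c , at = total x (s≤s (max d∈)) in ∈-cells⁺ at (to (correct x c at v) d∈))
    (back x v))
  where
  back : ∀ x v → (x , v) ∈ cells 0 cs → (x , v) ∈ S
  back x v d∈ with ∈-cells⁻ cs d∈
  ... | _ , c , ≡.refl , at , w = from (correct x c at v) w

-- Look at the first step of the path that goes beyond abscissa i; it is horizontal and its two
-- cells share a row.
crossing : ∀ {S : List Cell} {c d i} → c ∈ S → Path S c d → proj₁ c ≤ i → i < proj₁ d →
           ∃ λ v → (i , v) ∈ S × (suc i , v) ∈ S
crossing c∈ here c≤i i<d = ⊥-elim (ℕ.<-irrefl ≡.refl (ℕ.<-≤-trans i<d c≤i))
crossing {c = x , y} {i = i} c∈ (step {d = x′ , y′} adj e∈ p) c≤i i<d with x′ ℕ.≤? i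
... | yes e≤i = crossing e∈ p e≤i i<d
... | no e≰i with adj
...   | inj₁ (≡.refl , _) = ⊥-elim (e≰i c≤i)
...   | inj₂ (_ , inj₂ ≡.refl) = ⊥-elim (e≰i (ℕ.≤-trans (ℕ.n≤1+n x′) c≤i))
...   | inj₂ (≡.refl , inj₁ ≡.refl) with ℕ.≤-antisym c≤i (ℕ.s≤s⁻¹ (ℕ.≰⇒> e≰i))
...     | ≡.refl = y , c∈ , e∈

common-touch : ∀ {y l y′ l′ v} → Within y l v → Within y′ l′ v → Touch y l y′ l′
common-touch (p , r) (p′ , r′) = ℕ.≤-trans p r′ , ℕ.≤-trans p′ r

common-oneOf : ∀ {y l d a g b v} → Within y l v → InCol (dup d a g b) v → OneOf y l d a g b
common-oneOf w (inj₁ w′) = inj₁ (common-touch w w′)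
common-oneOf w (inj₂ w′) = inj₂ (common-touch w w′)

-- If neither neighbour of a duplex column meets both components, then the lower component,
-- together with the sides of the polyomino that it meets, is closed under adjacency.
module Separation (S : List Cell) (i d a g b : ℕ) (col : ∀ v → ((i , v) ∈ S) ⇔ InCol (dup d a g b) v) where

  Meets : ℕ → ℕ → ℕ → Set
  Meets x lo n = ∃ λ v → Within lo n v × (x , v) ∈ S

  -- Stated through a predecessor j of i, so that it is empty for the leftmost column.
  MeetsLeft : ℕ → ℕ → Set
  MeetsLeft lo n = ∃ λ j → suc j ≡ i × Meets j lo n

  module _ (¬left : ¬ (MeetsLeft d a × MeetsLeft (upper d a g) b))
           (¬right : ¬ (Meets (suc i) d a × Meets (suc i) (upper d a g) b)) where

    Side : Cell → Set
    Side (x , v) = (x ≡ i × Within d a v) ⊎ (x < i × MeetsLeft d a) ⊎ (i < x × Meets (suc i) d a)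

    low-or-up : ∀ {v} → (i , v) ∈ S → Within d a v ⊎ Within (upper d a g) b v
    low-or-up {v} = to (col v)

    closed : ∀ {c e} → Adjacent c e → c ∈ S → e ∈ S → Side c → Side e
    closed (inj₁ (≡.refl , vertical)) _ e∈ (inj₁ (≡.refl , w)) with low-or-up e∈
    ... | inj₁ w′ = inj₁ (≡.refl , w′)
    ... | inj₂ (up≤ , _) = ⊥-elim (jump vertical w up≤)
      where
      jump : ∀ {v v′} → suc v ≡ v′ ⊎ suc v′ ≡ v → Within d a v → upper d a g ≤ v′ → ⊥
      jump (inj₁ ≡.refl) (_ , v≤) up≤ = ℕ.<-irrefl ≡.refl (ℕ.<-≤-trans (s≤s (s≤s v≤))
        (ℕ.≤-trans (low<upper d a g) up≤))
      jump (inj₂ ≡.refl) (_ , v≤) up≤ = ℕ.<-irrefl ≡.refl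
        (ℕ.<-≤-trans (ℕ.<⇒≤ (low<upper d a g)) (ℕ.≤-trans up≤ (ℕ.≤-trans (ℕ.n≤1+n _) v≤)))
    closed (inj₁ (≡.refl , _)) _ _ (inj₂ side) = inj₂ side
    closed (inj₂ (≡.refl , inj₁ ≡.refl)) _ e∈ (inj₁ (≡.refl , w)) = inj₂ (inj₂ (ℕ.≤-refl , _ , w , e∈))
    closed (inj₂ (≡.refl , inj₂ ≡.refl)) _ e∈ (inj₁ (≡.refl , w)) = inj₂ (inj₁ (ℕ.≤-refl , _ , ≡.refl , _ , w , e∈))
    closed {x , _} (inj₂ (≡.refl , inj₁ ≡.refl)) c∈ e∈ (inj₂ (inj₁ (x<i , L))) with ℕ.m≤n⇒m<n∨m≡n x<i
    ... | inj₁ 1+x<i = inj₂ (inj₁ (1+x<i , L))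
    ... | inj₂ ≡.refl with low-or-up e∈
    ...   | inj₁ w = inj₁ (≡.refl , w)
    ...   | inj₂ w = ⊥-elim (¬left (L , x , ≡.refl , _ , w , c∈))
    closed (inj₂ (≡.refl , inj₂ ≡.refl)) _ _ (inj₂ (inj₁ (x<i , L))) = inj₂ (inj₁ (ℕ.<-trans ℕ.≤-refl x<i , L))
    closed (inj₂ (≡.refl , inj₁ ≡.refl)) _ _ (inj₂ (inj₂ (i<x , R))) = inj₂ (inj₂ (ℕ.m≤n⇒m≤1+n i<x , R))
    closed {e = x , _} (inj₂ (≡.refl , inj₂ ≡.refl)) c∈ e∈ (inj₂ (inj₂ (i<x , R))) with ℕ.m≤n⇒m<n∨m≡n (ℕ.s≤s⁻¹ i<x)
    ... | inj₁ i<x′ = inj₂ (inj₂ (i<x′ , R))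
    ... | inj₂ ≡.refl with low-or-up e∈
    ...   | inj₁ w = inj₁ (≡.refl , w)
    ...   | inj₂ w = ⊥-elim (¬right (R , _ , w , c∈))

    side-path : ∀ {c e} → c ∈ S → Path S c e → Side c → Side e
    side-path c∈ here s = s
    side-path c∈ (step adj e∈ p) s = side-path e∈ p (closed adj c∈ e∈ s)

    separated : (∀ c e → c ∈ S → e ∈ S → Path S c e) → ⊥
    separated connected with side-path low∈ (connected (i , d) (i , upper d a g) low∈ up∈) (inj₁ (≡.refl , base))
      where
      low∈ : (i , d) ∈ S
      low∈ = from (col d) (inj₁ base)
      up∈ : (i , upper d a g) ∈ S
      up∈ = from (col (upper d a g)) (inj₂ base)
    ... | inj₁ (_ , _ , up≤) = ℕ.<-irrefl ≡.refl (ℕ.<-≤-trans (ℕ.<⇒≤ (low<upper d a g)) up≤)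
    ... | inj₂ (inj₁ (i<i , _)) = ℕ.<-irrefl ≡.refl i<i
    ... | inj₂ (inj₂ (i<i , _)) = ℕ.<-irrefl ≡.refl i<i

module Validity (cs : List Col)
  (connected : ∀ c d → c ∈ cells 0 cs → d ∈ cells 0 cs → Path (cells 0 cs) c d)
  (sparse : ∀ x → ¬ (Duplex (cells 0 cs) x × Duplex (cells 0 cs) (suc x))) where

  neighbours : ∀ {i c c′} → cs [ i ]= c → cs [ suc i ]= c′ → ∃ λ v → InCol c v × InCol c′ v
  neighbours {i} {c} {c′} at at′ =
    let c∈ = ∈-cells⁺ at (bottom-in c)
        d∈ = ∈-cells⁺ at′ (bottom-in c′)
        v , p , r = crossing c∈ (connected _ _ c∈ d∈) ℕ.≤-refl ℕ.≤-refl
    in v , to (∈-cells cs at v) p , to (∈-cells cs at′ v) r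

  module _ {i d a g b} (at : cs [ i ]= dup d a g b) where
    open Separation (cells 0 cs) i d a g b (∈-cells cs at)

    private
      no-left : ∀ {z k} → (∀ j → suc j ≡ i → cs [ j ]= sim z k) → ¬ Both z k d a g b →
                ¬ (MeetsLeft d a × MeetsLeft (upper d a g) b)
      no-left left ¬both ((j , ≡.refl , v , w , v∈) , (_ , ≡.refl , v′ , w′ , v′∈)) = ¬both
        ( common-touch (to (∈-cells cs (left j ≡.refl) v) v∈) w
        , common-touch (to (∈-cells cs (left j ≡.refl) v′) v′∈) w′)

      no-right : ∀ {y l} → cs [ suc i ]= sim y l → ¬ Both y l d a g b →
                 ¬ (Meets (suc i) d a × Meets (suc i) (upper d a g) b)
      no-right right ¬both ((v , w , v∈) , (v′ , w′ , v′∈)) = ¬both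
        ( common-touch (to (∈-cells cs right v) v∈) w
        , common-touch (to (∈-cells cs right v′) v′∈) w′)

      no-column : (∀ c → ¬ cs [ suc i ]= c) → ¬ (Meets (suc i) d a × Meets (suc i) (upper d a g) b)
      no-column end ((_ , _ , v∈) , _) with ∈-cells⁻ cs v∈
      ... | _ , c , ≡.refl , at′ , _ = end c at′

    both-left : ∀ {z k} → (∀ j → suc j ≡ i → cs [ j ]= sim z k) → (∀ c → ¬ cs [ suc i ]= c) → Both z k d a g b
    both-left {z} {k} left end with both? z k d a g b
    ... | yes both = both
    ... | no ¬both = ⊥-elim (separated (no-left left ¬both) (no-column end) connected)

    both-right : ∀ {y l} → (∀ j → ¬ suc j ≡ i) → cs [ suc i ]= sim y l → Both y l d a g b
    both-right {y} {l} start right with both? y l d a g b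
    ... | yes both = both
    ... | no ¬both = ⊥-elim (separated (λ ((j , eq , _) , _) → start j eq) (no-right right ¬both) connected)

    -- If neither neighbour met both components, `separated` would contradict connectedness. Asking
    -- about the left neighbour first matches the order of the cases of `Link`.
    link : ∀ {z k y l} → (∀ j → suc j ≡ i → cs [ j ]= sim z k) → OneOf z k d a g b → cs [ suc i ]= sim y l →
           OneOf y l d a g b → Link z k d a g b y l
    link {z} {k} {y} {l} left one right one′ with both? z k d a g b
    ... | yes both = inj₁ (both , one′)
    ... | no ¬both with both? y l d a g b
    ...   | yes both = inj₂ ((one , ¬both) , both)
    ...   | no ¬both′ = ⊥-elim (separated (no-left left ¬both) (no-right right ¬both′) connected)

    alone : (∀ j → ¬ suc j ≡ i) → (∀ c → ¬ cs [ suc i ]= c) → ⊥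
    alone start end = separated (λ ((j , eq , _) , _) → start j eq) (no-column end) connected

  -- Connectedness concerns the whole sequence while `ValidAfter` recurses on tails; this locates a
  -- tail t at index i of `cs`.
  Suffix : ℕ → List Col → Set
  Suffix i t = ∀ j c → (t [ j ]= c) ⇔ (cs [ j + i ]= c)

  suffix-tail : ∀ {i c t} → Suffix i (c ∷ t) → Suffix (suc i) t
  suffix-tail {i} suffix j c = mk⇔
    (λ at → subst (λ n → cs [ n ]= c) (≡.sym (ℕ.+-suc j i)) (to (suffix (suc j) c) (later at)))
    (λ at → unlater (from (suffix (suc j) c) (subst (λ n → cs [ n ]= c) (ℕ.+-suc j i) at)))

  private
    previous : ∀ {i z k} → cs [ i ]= sim z k → ∀ j → suc j ≡ suc i → cs [ j ]= sim z k
    previous at j ≡.refl = at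

  validAfter : ∀ i z k t → cs [ i ]= sim z k → Suffix (suc i) t → ValidAfter z k t
  validAfter i z k [] at suffix = tt
  validAfter i z k (sim y l ∷ t) at suffix =
    let at′ = to (suffix 0 _) first
        v , w , w′ = neighbours at at′
    in common-touch w w′ , validAfter (suc i) y l t at′ (suffix-tail suffix)
  validAfter i z k (dup d a g b ∷ []) at suffix =
    both-left (to (suffix 0 _) first) (previous at) (λ c at′ → absurd (from (suffix 1 c) at′))
    where
    absurd : ∀ {c c′} → ¬ (c′ ∷ []) [ 1 ]= c
    absurd (later ())
  validAfter i z k (dup d a g b ∷ sim y l ∷ t) at suffix =
    let at′ = to (suffix 0 _) first
        at″ = to (suffix 1 _) (later first)
        v , w , w′ = neighbours at at′
        v′ , u , u′ = neighbours at′ at″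
    in link at′ (previous at) (common-oneOf {b = b} w w′) at″ (common-oneOf {b = b} u′ u)
     , validAfter (2 + i) y l t at″ (suffix-tail (suffix-tail suffix))
  validAfter i z k (dup _ _ _ _ ∷ dup _ _ _ _ ∷ t) at suffix = sparse (suc i)
    ( duplex-at cs (_ , _ , _ , _ , to (suffix 0 _) first)
    , duplex-at cs (_ , _ , _ , _ , to (suffix 1 _) (later first)))

whole : ∀ cs j c → (cs [ j ]= c) ⇔ (cs [ j + 0 ]= c)
whole cs j c = mk⇔ (subst (λ n → cs [ n ]= c) (≡.sym (ℕ.+-identityʳ j))) (subst (λ n → cs [ n ]= c) (ℕ.+-identityʳ j))

valid : ∀ cs {c} → c ∈ cells 0 cs → (∀ c d → c ∈ cells 0 cs → d ∈ cells 0 cs → Path (cells 0 cs) c d) →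
  (∀ x → ¬ (Duplex (cells 0 cs) x × Duplex (cells 0 cs) (suc x))) → Valid cs
valid (sim z k ∷ t) _ connected sparse = validAfter 0 z k t first (suffix-tail (whole (sim z k ∷ t)))
  where open Validity (sim z k ∷ t) connected sparse
valid (dup d a g b ∷ []) _ connected sparse = alone first (λ _ ()) (λ { _ (later ()) })
  where open Validity (dup d a g b ∷ []) connected sparse
valid (dup d a g b ∷ sim y l ∷ t) _ connected sparse = both-right first (λ _ ()) (later first)
  , validAfter 1 y l t (later first) (suffix-tail (suffix-tail (whole (dup d a g b ∷ sim y l ∷ t))))
  where open Validity (dup d a g b ∷ sim y l ∷ t) connected sparse
valid cs@(dup _ _ _ _ ∷ dup _ _ _ _ ∷ t) _ connected sparse = sparse 0
  (duplex-at cs (_ , _ , _ , _ , first) , duplex-at cs (_ , _ , _ , _ , later first))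

-- Vertical translation

upper-raise : ∀ j d a g → upper (j + d) a g ≡ j + upper d a g
upper-raise j d a g = ≡.trans (cong (_+ (2 + g)) (ℕ.+-assoc j d a)) (ℕ.+-assoc j (d + a) (2 + g))

raise lower : ℕ → Col → Col
raise j (sim y l) = sim (j + y) l
raise j (dup d a g b) = dup (j + d) a g b
lower j (sim y l) = sim (y ∸ j) l
lower j (dup d a g b) = dup (d ∸ j) a g b

module _ (j : ℕ) where
  ≤-raise : ∀ {x y c} → (x ≤ y + c) ⇔ (j + x ≤ j + y + c)
  ≤-raise {x} {y} {c} = mk⇔
    (λ p → ℕ.≤-trans (ℕ.+-monoʳ-≤ j p) (ℕ.≤-reflexive (≡.sym (ℕ.+-assoc j y c))))
    (λ p → ℕ.+-cancelˡ-≤ j x (y + c) (ℕ.≤-trans p (ℕ.≤-reflexive (ℕ.+-assoc j y c))))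

  touch-raise : ∀ {y l y′ l′} → Touch y l y′ l′ ⇔ Touch (j + y) l (j + y′) l′
  touch-raise = mk⇔ (λ (p , r) → to ≤-raise p , to ≤-raise r) (λ (p , r) → from ≤-raise p , from ≤-raise r)

  touch-upper : ∀ {y l d a g b} → Touch y l (upper d a g) b ⇔ Touch (j + y) l (upper (j + d) a g) b
  touch-upper {y} {l} {d} {a} {g} {b} = subst (λ u → Touch y l (upper d a g) b ⇔ Touch (j + y) l u b)
    (≡.sym (upper-raise j d a g)) touch-raise

  both-raise : ∀ {y l d a g b} → Both y l d a g b ⇔ Both (j + y) l (j + d) a g b
  both-raise {g = g} = mk⇔ (λ (p , r) → to touch-raise p , to (touch-upper {g = g}) r)
    (λ (p , r) → from touch-raise p , from (touch-upper {g = g}) r)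

  oneOf-raise : ∀ {y l d a g b} → OneOf y l d a g b ⇔ OneOf (j + y) l (j + d) a g b
  oneOf-raise {g = g} = mk⇔ (Sum.map (to touch-raise) (to (touch-upper {g = g})))
    (Sum.map (from touch-raise) (from (touch-upper {g = g})))

  link-raise : ∀ {z k d a g b y l} → Link z k d a g b y l ⇔ Link (j + z) k (j + d) a g b (j + y) l
  link-raise {g = g} = mk⇔
    (Sum.map (λ (p , r) → to (both-raise {g = g}) p , to (oneOf-raise {g = g}) r)
      (λ ((p , ¬p) , r) → (to (oneOf-raise {g = g}) p , ¬p ∘ from (both-raise {g = g})) , to (both-raise {g = g}) r))
    (Sum.map (λ (p , r) → from (both-raise {g = g}) p , from (oneOf-raise {g = g}) r)
      (λ ((p , ¬p) , r) → (from (oneOf-raise {g = g}) p , ¬p ∘ to (both-raise {g = g})) , from (both-raise {g = g}) r))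

  validAfter-raise : ∀ z k t → ValidAfter z k t ⇔ ValidAfter (j + z) k (map (raise j) t)
  validAfter-raise z k [] = mk⇔ (λ _ → tt) (λ _ → tt)
  validAfter-raise z k (sim y l ∷ t) = mk⇔
    (λ (p , v) → to touch-raise p , to (validAfter-raise y l t) v)
    (λ (p , v) → from touch-raise p , from (validAfter-raise y l t) v)
  validAfter-raise z k (dup d a g b ∷ []) = both-raise {g = g}
  validAfter-raise z k (dup d a g b ∷ sim y l ∷ t) = mk⇔
    (λ (p , v) → to (link-raise {g = g}) p , to (validAfter-raise y l t) v)
    (λ (p , v) → from (link-raise {g = g}) p , from (validAfter-raise y l t) v)
  validAfter-raise z k (dup _ _ _ _ ∷ dup _ _ _ _ ∷ t) = mk⇔ (λ ()) (λ ())

  valid-raise : ∀ cs → Valid cs ⇔ Valid (map (raise j) cs)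
  valid-raise [] = mk⇔ (λ ()) (λ ())
  valid-raise (sim z k ∷ t) = validAfter-raise z k t
  valid-raise (dup _ _ _ _ ∷ []) = mk⇔ (λ ()) (λ ())
  valid-raise (dup d a g b ∷ sim y l ∷ t) = mk⇔
    (λ (p , v) → to (both-raise {g = g}) p , to (validAfter-raise y l t) v)
    (λ (p , v) → from (both-raise {g = g}) p , from (validAfter-raise y l t) v)
  valid-raise (dup _ _ _ _ ∷ dup _ _ _ _ ∷ t) = mk⇔ (λ ()) (λ ())

  area-raise : ∀ cs → totalArea (map (raise j) cs) ≡ totalArea cs
  area-raise [] = ≡.refl
  area-raise (sim y l ∷ cs) = cong (suc l +_) (area-raise cs)
  area-raise (dup d a g b ∷ cs) = cong (2 + (a + b) +_) (area-raise cs)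

  dups-raise : ∀ cs → totalDups (map (raise j) cs) ≡ totalDups cs
  dups-raise [] = ≡.refl
  dups-raise (sim _ _ ∷ cs) = dups-raise cs
  dups-raise (dup _ _ _ _ ∷ cs) = cong suc (dups-raise cs)

  bottom-raise : ∀ c → bottom (raise j c) ≡ j + bottom c
  bottom-raise (sim _ _) = ≡.refl
  bottom-raise (dup _ _ _ _) = ≡.refl

  lower-raise : ∀ cs → map (lower j) (map (raise j) cs) ≡ cs
  lower-raise [] = ≡.refl
  lower-raise (sim y l ∷ cs) = cong₂ _∷_ (cong (λ y → sim y l) (ℕ.m+n∸m≡n j y)) (lower-raise cs)
  lower-raise (dup d a g b ∷ cs) = cong₂ _∷_ (cong (λ d → dup d a g b) (ℕ.m+n∸m≡n j d)) (lower-raise cs)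

  raise-lower : ∀ {cs} → All (λ c → j ≤ bottom c) cs → map (raise j) (map (lower j) cs) ≡ cs
  raise-lower [] = ≡.refl
  raise-lower (_∷_ {x = sim y l} j≤ cs) = cong₂ _∷_ (cong (λ y → sim y l) (ℕ.m+[n∸m]≡n j≤)) (raise-lower cs)
  raise-lower (_∷_ {x = dup d a g b} j≤ cs) = cong₂ _∷_ (cong (λ d → dup d a g b) (ℕ.m+[n∸m]≡n j≤)) (raise-lower cs)

minBottom : List Col → ℕ
minBottom [] = 0
minBottom (c ∷ []) = bottom c
minBottom (c ∷ cs@(_ ∷ _)) = bottom c ℕ.⊓ minBottom cs

minBottom-raise : ∀ j c cs → minBottom (map (raise j) (c ∷ cs)) ≡ j + minBottom (c ∷ cs)
minBottom-raise j c [] = bottom-raise j c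
minBottom-raise j c (c′ ∷ cs) = ≡.trans (cong₂ ℕ._⊓_ (bottom-raise j c) (minBottom-raise j c′ cs))
  (≡.sym (ℕ.+-distribˡ-⊓ j (bottom c) (minBottom (c′ ∷ cs))))

minBottom-≤ : ∀ cs → All (λ c → minBottom cs ≤ bottom c) cs
minBottom-≤ [] = []
minBottom-≤ (c ∷ []) = ℕ.≤-refl ∷ []
minBottom-≤ (c ∷ cs@(_ ∷ _)) = ℕ.m⊓n≤m (bottom c) (minBottom cs)
  ∷ All.map (ℕ.≤-trans (ℕ.m⊓n≤n (bottom c) (minBottom cs))) (minBottom-≤ cs)

minBottom-attained : ∀ c cs → ∃ λ i → ∃ λ c′ → (c ∷ cs) [ i ]= c′ × bottom c′ ≡ minBottom (c ∷ cs)
minBottom-attained c [] = 0 , c , first , ≡.refl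
minBottom-attained c (c′ ∷ cs) with ℕ.⊓-sel (bottom c) (minBottom (c′ ∷ cs)) | minBottom-attained c′ cs
... | inj₁ eq | _ = 0 , c , first , ≡.sym eq
... | inj₂ eq | i , c″ , at , eq′ = suc i , c″ , later at , ≡.trans eq′ (≡.sym eq)

all-[]= : ∀ {P : Col → Set} {cs i c} → All P cs → cs [ i ]= c → P c
all-[]= (p ∷ _) first = p
all-[]= (_ ∷ ps) (later at) = all-[]= ps at

normalize : List Col → List Col
normalize cs = map (lower (minBottom cs)) cs

raise-normalize : ∀ cs → map (raise (minBottom cs)) (normalize cs) ≡ cs
raise-normalize cs = raise-lower (minBottom cs) (minBottom-≤ cs)

Normal : ℕ → ℕ → List Col → Set
Normal n m cs = (Valid cs × Normalized cs) × totalArea cs ≡ n × totalDups cs ≡ m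

headBottom-normalize : ∀ cs → Valid cs → minBottom cs + headBottom (normalize cs) ≡ headBottom cs
headBottom-normalize (c ∷ cs) _ = ≡.trans (≡.sym (bottom-raise (minBottom (c ∷ cs)) (lower (minBottom (c ∷ cs)) c)))
  (cong headBottom (raise-normalize (c ∷ cs)))

-- The common height N of the first columns reveals by how much each sequence was lowered.
normalize-injective : ∀ {N cs cs′} → Valid cs → headBottom cs ≡ N → Valid cs′ → headBottom cs′ ≡ N →
                      normalize cs ≡ normalize cs′ → cs ≡ cs′
normalize-injective {N} {cs} {cs′} v h v′ h′ eq = ≡.trans (≡.sym (raise-normalize cs))
  (≡.trans (cong₂ (λ j → map (raise j)) same eq) (raise-normalize cs′))
  where
  same : minBottom cs ≡ minBottom cs′
  same = ℕ.+-cancelʳ-≡ (headBottom (normalize cs)) _ _ (≡.trans (≡.trans (headBottom-normalize cs v) h)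
    (≡.sym (≡.trans (cong (minBottom cs′ +_) (cong headBottom eq)) (≡.trans (headBottom-normalize cs′ v′) h′))))

-- In a normalized polyomino all ordinates below that of a cell occur. This is why n -
-- `headBottom cs` is an exact difference when raising back to height n.
headBottom-bound : ∀ cs → Valid cs → Normalized cs → headBottom cs ≤ totalArea cs
headBottom-bound cs@(c ∷ _) v nz = ℕ.<⇒≤ (subst (headBottom cs <_) (length-cells 0 cs)
  (height-bound (proj₁ (polyomino cs v nz)) (∈-cells⁺ {0} {cs} first (bottom-in c))))

-- Lowering to ordinate 0 has as inverse raising until the first column is at height n.
card-normal : ∀ n m → Card (Normal n m) (start-simplex n m + start-duplex n m)
card-normal n m = card-⇔ (λ cs → mk⇔ forward (backward cs))
  (card-map normalize (λ ((v , h) , _) ((v′ , h′) , _) → normalize-injective v h v′ h′) (Start.card-anchored n n m ℕ.≤-refl))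
  where
  forward : ∀ {cs} → (∃ λ cs′ → Anchored n n m cs′ × cs ≡ normalize cs′) → Normal n m cs
  forward (cs′@(c ∷ t) , ((v , _) , area≡ , dups≡) , ≡.refl) =
    ( from (valid-raise j (normalize cs′)) (subst Valid (≡.sym (raise-normalize cs′)) v)
    , let i , c′ , at , eq = minBottom-attained (lower j c) (map (lower j) t) in i , c′ , at , ≡.trans eq zero-min )
    , ≡.trans (≡.trans (≡.sym (area-raise j (normalize cs′))) (cong totalArea (raise-normalize cs′))) area≡
    , ≡.trans (≡.trans (≡.sym (dups-raise j (normalize cs′))) (cong totalDups (raise-normalize cs′))) dups≡
    where
    j : ℕ
    j = minBottom cs′
    zero-min : minBottom (normalize cs′) ≡ 0
    zero-min = ℕ.+-cancelˡ-≡ j _ 0 (≡.trans (≡.sym (minBottom-raise j (lower j c) (map (lower j) t)))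
      (≡.trans (cong minBottom (raise-normalize cs′)) (≡.sym (ℕ.+-identityʳ j))))
  backward : ∀ cs → Normal n m cs → ∃ λ cs′ → Anchored n n m cs′ × cs ≡ normalize cs′
  backward cs@(c ∷ t) ((v , nz@(i , c′ , at , b≡0)) , area≡ , dups≡) = map (raise j) cs
    , ( ( to (valid-raise j cs) v
        , ≡.trans (bottom-raise j c) (ℕ.m∸n+n≡m (subst (headBottom cs ≤_) area≡ (headBottom-bound cs v nz))) )
      , ≡.trans (area-raise j cs) area≡ , ≡.trans (dups-raise j cs) dups≡ )
    , ≡.sym (≡.trans (cong (λ j → map (lower j) (map (raise (n ∸ headBottom cs)) cs)) min≡) (lower-raise j cs))
    where
    j : ℕ
    j = n ∸ headBottom cs
    min≡ : minBottom (map (raise j) cs) ≡ j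
    min≡ = ≡.trans (minBottom-raise j c t) (≡.trans (cong (j +_)
      (ℕ.n≤0⇒n≡0 (ℕ.≤-trans (all-[]= (minBottom-≤ cs) at) (ℕ.≤-reflexive b≡0)))) (ℕ.+-identityʳ j))

-- A column sequence is determined by its cells

dup-bottom : ∀ {d a g b v} → InCol (dup d a g b) v → d ≤ v
dup-bottom (inj₁ (p , _)) = p
dup-bottom {d} {a} {g} (inj₂ (p , _)) = ℕ.≤-trans (d≤upper d a g) p

dup-above : ∀ {d a g b v} → InCol (dup d a g b) v → d + a < v → Within (upper d a g) b v
dup-above (inj₁ (_ , r)) lt = ⊥-elim (ℕ.<-irrefl ≡.refl (ℕ.<-≤-trans lt r))
dup-above (inj₂ w) _ = w

-- Otherwise row d + a + 1 would belong to the first column, although it lies in its gap.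
dup-low-≤ : ∀ {d a g b a′ g′ b′} → (∀ v → InCol (dup d a′ g′ b′) v → InCol (dup d a g b) v) → a′ ≤ a
dup-low-≤ {d} {a} {g} {b} {a′} sub = ℕ.≮⇒≥ λ a<a′ → ℕ.<-irrefl ≡.refl (ℕ.<-≤-trans (low<upper d a g)
  (proj₁ (dup-above {b = b} (sub (suc (d + a)) (inj₁ (ℕ.m≤n⇒m≤1+n (ℕ.m≤m+n d a) , ℕ.≤-trans (ℕ.≤-reflexive (≡.sym (ℕ.+-suc d a))) (ℕ.+-monoʳ-≤ d a<a′)))) ℕ.≤-refl)))

dup-up-≤ : ∀ {d a g b g′ b′} → (∀ v → InCol (dup d a g′ b′) v → InCol (dup d a g b) v) →
           upper d a g ≤ upper d a g′ × upper d a g′ + b′ ≤ upper d a g + b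
dup-up-≤ {d} {a} {g} {b} {g′} {b′} sub =
    proj₁ (dup-above {b = b} (sub (upper d a g′) (inj₂ base)) above)
  , proj₂ (dup-above {b = b} (sub (upper d a g′ + b′) (inj₂ (ℕ.m≤m+n _ b′ , ℕ.≤-refl))) (ℕ.<-≤-trans above (ℕ.m≤m+n _ b′)))
  where
  above : d + a < upper d a g′
  above = ℕ.<-trans ℕ.≤-refl (low<upper d a g′)

sim-≡ : ∀ {y l y′ l′} → (∀ v → Within y l v ⇔ Within y′ l′ v) → sim y l ≡ sim y′ l′
sim-≡ {y} {l} {y′} {l′} same with ℕ.≤-antisym (proj₁ (from (same y′) base)) (proj₁ (to (same y) base))
... | ≡.refl = cong (sim y) (ℕ.+-cancelˡ-≡ y l l′ (ℕ.≤-antisym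
  (proj₂ (to (same (y + l)) (ℕ.m≤m+n y l , ℕ.≤-refl))) (proj₂ (from (same (y + l′)) (ℕ.m≤m+n y l′ , ℕ.≤-refl)))))

-- The parameters are recovered in turn: d is the least row, d + a ends the first run, then the
-- start of the second run gives g and its end gives b.
dup-≡ : ∀ {d a g b d′ a′ g′ b′} → (∀ v → InCol (dup d a g b) v ⇔ InCol (dup d′ a′ g′ b′) v) → dup d a g b ≡ dup d′ a′ g′ b′
dup-≡ {d} {a} {g} {b} {d′} {a′} {g′} {b′} same
  with ℕ.≤-antisym (dup-bottom {a = a} {g} {b} (from (same d′) (inj₁ base))) (dup-bottom {a = a′} {g′} {b′} (to (same d) (inj₁ base)))
... | ≡.refl with ℕ.≤-antisym (dup-low-≤ {d} {a′} {g′} {b′} {a} {g} {b} (λ v → to (same v))) (dup-low-≤ {d} {a} {g} {b} {a′} {g′} {b′} (λ v → from (same v)))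
...   | ≡.refl with dup-up-≤ {d} {a} {g} {b} {g′} {b′} (λ v → from (same v)) | dup-up-≤ {d} {a} {g′} {b′} {g} {b} (λ v → to (same v))
...     | u , t | u′ , t′ with ℕ.+-cancelˡ-≡ 2 g g′ (ℕ.+-cancelˡ-≡ (d + a) (2 + g) (2 + g′) (ℕ.≤-antisym u u′))
...       | ≡.refl = cong (dup d a g) (ℕ.+-cancelˡ-≡ (upper d a g) b b′ (ℕ.≤-antisym t′ t))

[]=-extensional : ∀ cs cs′ → (∀ i c → (cs [ i ]= c) ⇔ (cs′ [ i ]= c)) → cs ≡ cs′
[]=-extensional [] [] _ = ≡.refl
[]=-extensional [] (c ∷ _) same with from (same 0 c) first
... | ()
[]=-extensional (c ∷ _) [] same with to (same 0 c) first
... | ()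
[]=-extensional (c ∷ cs) (c′ ∷ cs′) same with to (same 0 c) first
... | first = cong (c ∷_) ([]=-extensional cs cs′ (λ i e → mk⇔
    (λ at → unlater (to (same (suc i) e) (later at))) (λ at → unlater (from (same (suc i) e) (later at)))))

cells-injective : ∀ cs cs′ → cells 0 cs ≡ cells 0 cs′ → cs ≡ cs′
cells-injective cs cs′ eq = []=-extensional cs cs′ (λ i c → mk⇔ (transfer cs cs′ eq) (transfer cs′ cs (≡.sym eq)))
  where
  same-column : ∀ cs cs′ → cells 0 cs ≡ cells 0 cs′ → ∀ {i} c c′ → cs [ i ]= c → cs′ [ i ]= c′ → c ≡ c′
  same-column cs cs′ eq {i} c c′ at at′ = compare c c′ at at′ (λ v → mk⇔
      (to (∈-cells cs′ at′ v) ∘ subst ((i , v) ∈_) eq ∘ from (∈-cells cs at v))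
      (to (∈-cells cs at v) ∘ subst ((i , v) ∈_) (≡.sym eq) ∘ from (∈-cells cs′ at′ v)))
    where
    compare : ∀ c c′ → cs [ i ]= c → cs′ [ i ]= c′ → (∀ v → InCol c v ⇔ InCol c′ v) → c ≡ c′
    compare (sim _ _) (sim _ _) _ _ same = sim-≡ same
    compare (dup _ _ _ _) (dup _ _ _ _) _ _ same = dup-≡ same
    compare (sim _ _) (dup _ _ _ _) at at′ _ = ⊥-elim (simplex-not-duplex (simplex-at cs at)
      (subst (λ S → Duplex S i) (≡.sym eq) (duplex-at cs′ (_ , _ , _ , _ , at′))))
    compare (dup _ _ _ _) (sim _ _) at at′ _ = ⊥-elim (simplex-not-duplex (simplex-at cs′ at′)
      (subst (λ S → Duplex S i) eq (duplex-at cs (_ , _ , _ , _ , at))))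
  transfer : ∀ cs cs′ → cells 0 cs ≡ cells 0 cs′ → ∀ {i c} → cs [ i ]= c → cs′ [ i ]= c
  transfer cs cs′ eq {i} {c} at with ∈-cells⁻ cs′ (subst ((i , bottom c) ∈_) eq (∈-cells⁺ at (bottom-in c)))
  ... | _ , c′ , ≡.refl , at′ , _ = subst (cs′ [ i ]=_) (≡.sym (same-column cs cs′ eq c c′ at at′)) at′

zero-bottom : ∀ c → InCol c 0 → bottom c ≡ 0
zero-bottom (sim y l) (y≤0 , _) = ℕ.n≤0⇒n≡0 y≤0
zero-bottom (dup d a g b) w = ℕ.n≤0⇒n≡0 (dup-bottom {d} {a} {g} {b} w)

polyomino-columns : ∀ {P} → IsSimplexDuplex P → ∃ λ cs → P ≡ cells 0 cs × Valid cs × Normalized cs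
polyomino-columns {P} sd@((_ , leftmost , lowest , connected) , _ , sparse) with column-list sd
... | cs , ≡.refl = cs , ≡.refl , valid cs (proj₁ (proj₂ (find leftmost))) connected sparse , normalized
  where
  normalized : Normalized cs
  normalized with find lowest
  ... | (x , _) , c∈ , ≡.refl with ∈-cells⁻ cs c∈
  ...   | i , c , ≡.refl , at , w = i , c , at , zero-bottom c w

card-polyominoes : ∀ n m → Card (λ P → IsSimplexDuplex P × area P ≡ n × DuplexCount P m) (start-simplex n m + start-duplex n m)
card-polyominoes n m = card-⇔ (λ P → mk⇔ forward backward)
  (card-map (cells 0) (λ {cs} {cs′} _ _ → cells-injective cs cs′) (card-normal n m))
  where
  forward : ∀ {P} → (∃ λ cs → Normal n m cs × P ≡ cells 0 cs) → IsSimplexDuplex P × area P ≡ n × DuplexCount P m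
  forward (cs , ((v , nz) , ≡.refl , ≡.refl) , ≡.refl) = polyomino cs v nz , length-cells 0 cs , duplexCount cs
  backward : ∀ {P} → IsSimplexDuplex P × area P ≡ n × DuplexCount P m → ∃ λ cs → Normal n m cs × P ≡ cells 0 cs
  backward (sd , area≡ , count) with polyomino-columns sd
  ... | cs , ≡.refl , v , nz = cs , ((v , nz) , ≡.trans (≡.sym (length-cells 0 cs)) area≡
    , duplexCount-unique {cells 0 cs} (duplexCount cs) count) , ≡.refl

theorem2 : (n m : ℕ) →
    Σ (List (List Cell)) λ L →
    Unique L
    × (∀ P → (P ∈ L) ⇔ (IsSimplexDuplex P × area P ≡ n × DuplexCount P m))
    × nℚ (length L) ≡ NUM/DEN n m
theorem2 n m = elements C , unique C , complete C
  , ≡.trans (cong nℚ (size C)) (≡.trans (≡.sym (series-at _ n m)) (at anchored-series n m))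
  where
  C : Card (λ P → IsSimplexDuplex P × area P ≡ n × DuplexCount P m) (start-simplex n m + start-duplex n m)
  C = card-polyominoes n m
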